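{- For any integer $n\ge 3$, \begin{align*} e_0(n)&=n-3,\\ e_1(n)&=\tfrac32(n-3)+\delta_1(n),\\ e_2(n)&=2(n-3)+\delta_2(n),\\ e_3(n)&=\tfrac94(n-3)+\delta_3(n),\\ e_4(n)&=\tfrac52(n-3)+\delta_4(n), \end{align*} with the exception of $e_4(3)=0$ and $e_4(4)=2$ (so the formula for $e_4(n)$ holds for all $n\ge 5$). Here - $\delta_1(n)=\tfrac12$ if $n\equiv 0 \pmod 2$, and $\delta_1(n)=0$ otherwise; - $\delta_2(n)=1$ if $n\equiv 2\pmod 3$, and $\delta_2(n)=0$ otherwise; - $\delta_3(n)=-\tfrac14,\ \tfrac12,\ \tfrac54,\ 0$ if $n\equiv 0,1,2,3\pmod 4$, respectively; - $\delta_4(n)=\tfrac12,\ 0,\ \tfrac32,\ 1$ if $n\equiv 0,1,2,3\pmod 4$, respectively.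
   Context: $D_n$ denotes the complete convex graph on $n$ vertices minus the sides of the polygon: its vertices are the vertices of a convex $n$-gon and its edges are all the diagonals (straight segments) of the polygon. Two edges cross if they intersect at a point interior to both. For an integer $\ell\ge 0$, $e_\ell(n)$ is the maximum number of edges over all subgraphs of $D_n$ in which each edge is crossed at most $\ell$ times by other edges of the subgraph. -}

module Defs where

open import Level using (Level; _⊔_) renaming (suc to lsuc)
open import Algebra.Apartness.Bundles using (HeytingField)
open import Data.Fin.Base using (Fin; toℕ) renaming (_<_ to _<ᶠ_)
open import Data.Integer.Base using (+_; -[1+_])
open import Data.List.Base using (List; length)
open import Data.List.Membership.Propositional using (_∈_)
open import Data.List.Relation.Unary.All using (All)
open import Data.List.Relation.Unary.Unique.Propositional using (Unique)
open import Data.Nat.Base using (ℕ; suc; _≤_)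
open import Data.Nat.DivMod using (_mod_)
open import Data.Product.Base using (_×_; _,_; ∃-syntax)
open import Data.Rational.Base using (ℚ; 0ℚ; 1ℚ; ½; _/_)
open import Data.Sum.Base using (_⊎_)
open import Data.Vec.Base using (_∷_; []; lookup)
open import Function.Bundles using (_⇔_)
open import Relation.Binary.Core using (Rel)
open import Relation.Binary.PropositionalEquality.Core using (_≡_; _≢_)
open import Relation.Binary.Structures using (IsStrictPartialOrder)

-- The library has no real numbers, so the plane is taken over an arbitrary
-- ordered field.  Decidability of the order is not assumed: the apartness
-- x # y is required to mean x < y or y < x, which makes ℚ, the classical ℝ
-- and the constructive (Cauchy or Dedekind) ℝ all instances.

record OrderedField (c ℓ₁ ℓ₂ ℓ₃ : Level) : Set (lsuc (c ⊔ ℓ₁ ⊔ ℓ₂ ⊔ ℓ₃)) where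
  field
    heytingField : HeytingField c ℓ₁ ℓ₂

  open HeytingField heytingField public

  infix 4 _<_
  field
    _<_                  : Rel Carrier ℓ₃
    isStrictPartialOrder : IsStrictPartialOrder _≈_ _<_
    #⇔<⊎>                : ∀ x y → (x # y) ⇔ (x < y ⊎ y < x)
    +-monoˡ-<            : ∀ {x y} z → x < y → x + z < y + z
    *-pos                : ∀ {x y} → 0# < x → 0# < y → 0# < x * y

module Plane {c ℓ₁ ℓ₂ ℓ₃} (K : OrderedField c ℓ₁ ℓ₂ ℓ₃) where

  open OrderedField K

  Point : Set c
  Point = Carrier × Carrier

  -- Positive exactly when a, b, r make a left turn.
  orient : Point → Point → Point → Carrier
  orient (ax , ay) (bx , by) (rx , ry) =
    (bx - ax) * (ry - ay) - (by - ay) * (rx - ax)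

  -- x is a point of the segment ab other than its endpoints (when a ≠ b).
  InteriorTo : Point → Point → Point → Set (c ⊔ ℓ₁ ⊔ ℓ₃)
  InteriorTo (ax , ay) (bx , by) (x , y) =
    ∃[ t ] (0# < t) × (t < 1#)
         × (x ≈ (1# - t) * ax + t * bx)
         × (y ≈ (1# - t) * ay + t * by)

-- Cyclic successor.
next : ∀ {n} → Fin n → Fin n
next {suc n} i = suc (toℕ i) mod suc n

-- The vertices are listed counterclockwise: every vertex off a side lies
-- strictly to the left of the line through that side.

record ConvexPolygon {c ℓ₁ ℓ₂ ℓ₃} (K : OrderedField c ℓ₁ ℓ₂ ℓ₃) (n : ℕ)
       : Set (c ⊔ ℓ₃) where
  open OrderedField K
  open Plane K
  field
    vertex : Fin n → Point
    convex : ∀ i j → j ≢ i → j ≢ next i →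
             0# < orient (vertex i) (vertex (next i)) (vertex j)

-- An unordered pair of vertices is represented by its increasing listing.
Pair : ℕ → Set
Pair n = Fin n × Fin n

IsDiagonal : ∀ {n} → Pair n → Set
IsDiagonal (i , j) = (i <ᶠ j) × (j ≢ next i) × (i ≢ next j)

-- A subgraph of the graph of diagonals, given by its edge set.
record Subgraph (n : ℕ) : Set where
  field
    edges     : List (Pair n)
    unique    : Unique edges
    diagonals : All IsDiagonal edges

  size : ℕ
  size = length edges

open Subgraph public

module _ {c ℓ₁ ℓ₂ ℓ₃} {K : OrderedField c ℓ₁ ℓ₂ ℓ₃} {n : ℕ}
         (P : ConvexPolygon K n) where

  open Plane K
  open ConvexPolygon P

  Cross : Pair n → Pair n → Set (c ⊔ ℓ₁ ⊔ ℓ₃)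
  Cross (i , j) (k , l) =
    ∃[ x ] InteriorTo (vertex i) (vertex j) x
         × InteriorTo (vertex k) (vertex l) x

  -- "At most ℓ" bounds every duplicate-free list of crossing edges, since
  -- Cross need not be decidable a priori.
  CrossedAtMost : ℕ → Subgraph n → Pair n → Set (c ⊔ ℓ₁ ⊔ ℓ₃)
  CrossedAtMost ℓ G e =
    ∀ (fs : List (Pair n)) → Unique fs →
    All (λ f → (f ∈ edges G) × (f ≢ e) × Cross e f) fs →
    length fs ≤ ℓ

  Admissible : ℕ → Subgraph n → Set (c ⊔ ℓ₁ ⊔ ℓ₃)
  Admissible ℓ G = ∀ e → e ∈ edges G → CrossedAtMost ℓ G e

  IsMaxSize : ℕ → ℕ → Set (c ⊔ ℓ₁ ⊔ ℓ₃)
  IsMaxSize ℓ m = (∃[ G ] Admissible ℓ G × size G ≡ m)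
                × (∀ G → Admissible ℓ G → size G ≤ m)

-- The maximum e_ℓ of the polygon P exists and equals the rational q.
infix 4 e[_]_≐_
e[_]_≐_ : ∀ {c ℓ₁ ℓ₂ ℓ₃} {K : OrderedField c ℓ₁ ℓ₂ ℓ₃} {n : ℕ} →
          ℕ → ConvexPolygon K n → ℚ → Set (c ⊔ ℓ₁ ⊔ ℓ₃)
e[ ℓ ] P ≐ q = ∃[ m ] IsMaxSize P ℓ m × (+ m / 1 ≡ q)

δ₁ δ₂ δ₃ δ₄ : ℕ → ℚ
δ₁ n = lookup (½ ∷ 0ℚ ∷ []) (n mod 2)
δ₂ n = lookup (0ℚ ∷ 0ℚ ∷ 1ℚ ∷ []) (n mod 3)
δ₃ n = lookup (-[1+ 0 ] / 4 ∷ ½ ∷ + 5 / 4 ∷ 0ℚ ∷ []) (n mod 4)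
δ₄ n = lookup (½ ∷ 0ℚ ∷ + 3 / 2 ∷ 1ℚ ∷ []) (n mod 4)

{-# OPTIONS --safe #-}
module Submission where

-- Upper bounds.  Induct on the number N of vertices and suppose that a drawing
-- has more than E N edges, E being the claimed maximum.  Rotate it so that some
-- edge (0 , 1 + m) with at least M vertices 1, ..., m on one side has m minimal;
-- then all edges inside are short, and at most ℓ edges leave across it.  Merging
-- consecutive vertices never creates crossings, so by induction every way of
-- merging r vertices of 0, ..., 1 + m must identify or destroy more than
-- E N - E (N - r) edges.  These inequalities, linear in the indicators of the
-- inside edges and the numbers of edges leaving from each vertex, together with
-- the bounds on the numbers of crossings, have no solution, which a verified
-- exhaustive search establishes.  For large m the first few vertices already
-- suffice.  Only for ℓ = 4 and m = 5 some solutions survive; they are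
-- excluded by removing a vertex and inserting other inside edges.
--
-- Lower bounds.  Small optimal drawings are glued together along sides.
--
-- Geometry.  Convexity makes all triples i < j < k counterclockwise, hence two
-- diagonals cross exactly if their ends interleave.

open import Defs

-- The threshold is M = ℓ + 1. If every edge leaves fewer than M vertices on each side, then N ≤ 2M,
-- and in these finitely many cases counting the admissible diagonals gives the bound. The
-- exceptions are N = 6 for ℓ = 3 and N = 7 for ℓ = 4, where the threshold is lowered by one and the
-- decreases E N - E (N - r) are taken exactly. Otherwise they are replaced by their minimum over
-- all N, so that one linear system serves every N. Minimality of m keeps the system finite: inside
-- edges cut off fewer than M vertices, and beyond (0 , 1 + m) only the numbers of leaving edges are
-- recorded. The obstacle is that the far ends of leaving edges are unknown. Edges leaving from two
-- vertices that a contraction merges may share their far ends and be identified, so the contraction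
-- has to give up all edges leaving from one of the two.

module Counting where

  open import Data.Bool.Base using (Bool; true; false; T; _∧_; _∨_; not; if_then_else_)
  open import Data.Bool.ListAction using (all)
  open import Data.Bool.Properties using (T?)
  open import Data.Empty using (⊥; ⊥-elim)
  open import Data.Unit.Base using (⊤; tt)
  open import Data.List.Base using (List; []; _∷_; _++_; map; length; filterᵇ)
  open import Data.List.Membership.Propositional using (_∈_)
  open import Data.List.Membership.Propositional.Properties using (∈-filter⁺)
  open import Data.List.Relation.Unary.All as All using (All; []; _∷_)
  open import Data.List.Relation.Unary.All.Properties using (all⁺)
  open import Data.List.Relation.Unary.Any using (here; there)
  open import Data.List.Relation.Unary.AllPairs using ([]; _∷_)
  open import Data.List.Relation.Unary.Unique.Propositional using (Unique)
  open import Data.Nat.Base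
  open import Data.Nat.Properties
  open import Algebra.Properties.CommutativeSemigroup +-commutativeSemigroup using (interchange)
  open import Data.Product.Base using (_×_; _,_; proj₁; proj₂; ∃-syntax)
  open import Data.Sum.Base using (_⊎_; inj₁; inj₂)
  open import Function.Base using (_∘_)
  open import Relation.Binary.PropositionalEquality
  open import Relation.Nullary using (¬_)

  private variable
    A B : Set

  -- Counting in lists by Boolean predicates.

  𝟙 : Bool → ℕ
  𝟙 true  = 1
  𝟙 false = 0

  count : (A → Bool) → List A → ℕ
  count p []       = 0
  count p (x ∷ xs) = 𝟙 (p x) + count p xs

  𝟙-mono : ∀ {a b} → (T a → T b) → 𝟙 a ≤ 𝟙 b
  𝟙-mono {false}         h = z≤n
  𝟙-mono {true}  {true}  h = ≤-refl
  𝟙-mono {true}  {false} h = ⊥-elim (h tt)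

  count-mono : ∀ {p q : A → Bool} xs → (∀ {x} → x ∈ xs → T (p x) → T (q x)) →
               count p xs ≤ count q xs
  count-mono []       h = z≤n
  count-mono (x ∷ xs) h = +-mono-≤ (𝟙-mono (h (here refl))) (count-mono xs (h ∘ there))

  count-++ : ∀ (p : A → Bool) xs {ys} → count p (xs ++ ys) ≡ count p xs + count p ys
  count-++ p []       = refl
  count-++ p (x ∷ xs) = trans (cong (𝟙 (p x) +_) (count-++ p xs)) (sym (+-assoc (𝟙 (p x)) _ _))

  count-map : ∀ (p : B → Bool) (f : A → B) xs → count p (map f xs) ≡ count (p ∘ f) xs
  count-map p f []       = refl
  count-map p f (x ∷ xs) = cong (𝟙 (p (f x)) +_) (count-map p f xs)

  count-filter : ∀ (p q : A → Bool) xs → count q (filterᵇ p xs) ≡ count (λ x → p x ∧ q x) xs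
  count-filter p q []       = refl
  count-filter p q (x ∷ xs) with p x
  ... | true  = cong (𝟙 (q x) +_) (count-filter p q xs)
  ... | false = count-filter p q xs

  length-filter : ∀ (p : A → Bool) xs → length (filterᵇ p xs) ≡ count p xs
  length-filter p []       = refl
  length-filter p (x ∷ xs) with p x
  ... | true  = cong suc (length-filter p xs)
  ... | false = length-filter p xs

  𝟙-split : ∀ a b → 𝟙 b ≡ 𝟙 (a ∧ b) + 𝟙 (not a ∧ b)
  𝟙-split true  b = sym (+-identityʳ _)
  𝟙-split false b = refl

  count-split : ∀ (p q : A → Bool) xs →
                count q xs ≡ count (λ x → p x ∧ q x) xs + count (λ x → not (p x) ∧ q x) xs
  count-split p q []       = refl
  count-split p q (x ∷ xs) = begin
    𝟙 (q x) + count q xs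
      ≡⟨ cong₂ _+_ (𝟙-split (p x) (q x)) (count-split p q xs) ⟩
    (𝟙 (p x ∧ q x) + 𝟙 (not (p x) ∧ q x)) + (count p∧q xs + count ¬p∧q xs)
      ≡⟨ interchange (𝟙 (p x ∧ q x)) _ _ _ ⟩
    count p∧q (x ∷ xs) + count ¬p∧q (x ∷ xs) ∎
    where
    open ≡-Reasoning
    p∧q ¬p∧q : _ → Bool
    p∧q  y = p y ∧ q y
    ¬p∧q y = not (p y) ∧ q y

  length-split : ∀ (p : A → Bool) xs → length xs ≡ count p xs + count (not ∘ p) xs
  length-split p []       = refl
  length-split p (x ∷ xs) with p x
  ... | true  = cong suc (length-split p xs)
  ... | false = trans (cong suc (length-split p xs)) (sym (+-suc _ _))

  count-pos : ∀ (p : A → Bool) xs → 0 < count p xs → ∃[ x ] x ∈ xs × T (p x)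
  count-pos p (x ∷ xs) h with p x in eq
  ... | true  = x , here refl , subst T (sym eq) tt
  ... | false = let y , y∈ , py = count-pos p xs h in y , there y∈ , py

  ∈⇒count-pos : ∀ (p : A → Bool) {xs x} → x ∈ xs → T (p x) → 0 < count p xs
  ∈⇒count-pos p {y ∷ ys} (here refl) px with p y
  ... | true = s≤s z≤n
  ∈⇒count-pos p {y ∷ ys} (there x∈) px = ≤-trans (∈⇒count-pos p x∈ px) (m≤n+m _ (𝟙 (p y)))

  count-zero : ∀ (p : A → Bool) xs → (∀ {x} → x ∈ xs → ¬ T (p x)) → count p xs ≡ 0
  count-zero p []       h = refl
  count-zero p (x ∷ xs) h with p x in eq
  ... | true  = ⊥-elim (h (here refl) (subst T (sym eq) tt))
  ... | false = count-zero p xs (h ∘ there)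

  Σ[_]_ : List A → (A → ℕ) → ℕ
  Σ[ [] ]     h = 0
  Σ[ x ∷ xs ] h = h x + Σ[ xs ] h

  Σ-mono : ∀ {h h′ : A → ℕ} xs → (∀ {x} → x ∈ xs → h x ≤ h′ x) → Σ[ xs ] h ≤ Σ[ xs ] h′
  Σ-mono []       le = z≤n
  Σ-mono (x ∷ xs) le = +-mono-≤ (le (here refl)) (Σ-mono xs (le ∘ there))

  Σ-+ : ∀ (h h′ : A → ℕ) xs → Σ[ xs ] (λ x → h x + h′ x) ≡ Σ[ xs ] h + Σ[ xs ] h′
  Σ-+ h h′ []       = refl
  Σ-+ h h′ (x ∷ xs) = trans (cong (h x + h′ x +_) (Σ-+ h h′ xs)) (interchange (h x) _ _ _)

  Σ-cong : ∀ {h h′ : A → ℕ} xs → (∀ x → h x ≡ h′ x) → Σ[ xs ] h ≡ Σ[ xs ] h′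
  Σ-cong []       eq = refl
  Σ-cong (x ∷ xs) eq = cong₂ _+_ (eq x) (Σ-cong xs eq)

  Σ-zero : ∀ {h : A → ℕ} xs → (∀ {x} → x ∈ xs → h x ≡ 0) → Σ[ xs ] h ≡ 0
  Σ-zero []       eq = refl
  Σ-zero (x ∷ xs) eq = cong₂ _+_ (eq (here refl)) (Σ-zero xs (eq ∘ there))

  when : Bool → ℕ → ℕ
  when true  n = n
  when false n = 0

  Edge : Set
  Edge = ℕ × ℕ

  infix 4 _==_
  _==_ : Edge → Edge → Bool
  (a , b) == (c , d) = (a ≡ᵇ c) ∧ (b ≡ᵇ d)

  ∧-elim : ∀ {a b} → T (a ∧ b) → T a × T b
  ∧-elim {true} {true} _ = tt , tt

  ∧-intro : ∀ {a b} → T a → T b → T (a ∧ b)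
  ∧-intro {true} {true} _ _ = tt

  ∨-elim : ∀ {a b} → T (a ∨ b) → T a ⊎ T b
  ∨-elim {true}         _ = inj₁ tt
  ∨-elim {false} {true} _ = inj₂ tt

  ∨-introˡ : ∀ {a b} → T a → T (a ∨ b)
  ∨-introˡ {true} _ = tt

  ∨-introʳ : ∀ {a b} → T b → T (a ∨ b)
  ∨-introʳ {true}  _ = tt
  ∨-introʳ {false} h = h

  not-elim : ∀ {a} → T (not a) → ¬ T a
  not-elim {false} _ ()

  not-intro : ∀ {a} → ¬ T a → T (not a)
  not-intro {true}  h = h tt
  not-intro {false} h = tt

  ==⇒≡ : ∀ {e f} → T (e == f) → e ≡ f
  ==⇒≡ {a , b} {c , d} h = let p , q = ∧-elim h in cong₂ _,_ (≡ᵇ⇒≡ a c p) (≡ᵇ⇒≡ b d q)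

  ≡⇒== : ∀ {e f} → e ≡ f → T (e == f)
  ≡⇒== {a , b} refl = ∧-intro (≡⇒≡ᵇ a a refl) (≡⇒≡ᵇ b b refl)

  _∈ᵇ_ : Edge → List Edge → Bool
  e ∈ᵇ []       = false
  e ∈ᵇ (f ∷ fs) = (e == f) ∨ (e ∈ᵇ fs)

  ∈ᵇ⇒∈ : ∀ {e} fs → T (e ∈ᵇ fs) → e ∈ fs
  ∈ᵇ⇒∈ (f ∷ fs) h with ∨-elim h
  ... | inj₁ p = here (==⇒≡ p)
  ... | inj₂ p = there (∈ᵇ⇒∈ fs p)

  ∈⇒∈ᵇ : ∀ {e fs} → e ∈ fs → T (e ∈ᵇ fs)
  ∈⇒∈ᵇ (here eq)  = ∨-introˡ (≡⇒== eq)
  ∈⇒∈ᵇ {e} {f ∷ fs} (there h) = ∨-introʳ {e == f} (∈⇒∈ᵇ h)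

  uniqueᵇ : List Edge → Bool
  uniqueᵇ []       = true
  uniqueᵇ (e ∷ es) = not (e ∈ᵇ es) ∧ uniqueᵇ es

  uniqueᵇ⇒ : ∀ es → T (uniqueᵇ es) → Unique es
  uniqueᵇ⇒ []       _ = []
  uniqueᵇ⇒ (e ∷ es) h = let p , q = ∧-elim h in
    All.tabulate (λ {f} f∈ e≡f → not-elim p (∈⇒∈ᵇ (subst (_∈ es) (sym e≡f) f∈))) ∷ uniqueᵇ⇒ es q

  unique-count : ∀ {es} → Unique es → ∀ e → count (_== e) es ≤ 1
  unique-count []               e = z≤n
  unique-count {f ∷ es} (f∉ ∷ u) e with f == e in eq
  ... | false = unique-count u e
  ... | true  = ≤-reflexive (cong suc (count-zero (_== e) es λ {x} x∈ h →
    All.lookup f∉ x∈ (trans (==⇒≡ (subst T (sym eq) tt)) (sym (==⇒≡ h)))))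

  unique-⊆-length : ∀ {es fs} → Unique es → (∀ {e} → e ∈ es → e ∈ fs) → length es ≤ length fs
  unique-⊆-length {[]}     u         sub = z≤n
  unique-⊆-length {e ∷ es} {fs} (e∉ ∷ u) sub = begin
    suc (length es)                                        ≤⟨ s≤s (unique-⊆-length u sub′) ⟩
    suc (length (filterᵇ (not ∘ (_== e)) fs))              ≡⟨ cong suc (length-filter _ fs) ⟩
    1 + count (not ∘ (_== e)) fs                           ≤⟨ +-monoˡ-≤ _ (∈⇒count-pos (_== e) (sub (here refl)) (≡⇒== {e} refl)) ⟩
    count (_== e) fs + count (not ∘ (_== e)) fs            ≡⟨ sym (length-split (_== e) fs) ⟩
    length fs                                              ∎
    where
    open ≤-Reasoning
    sub′ : ∀ {x} → x ∈ es → x ∈ filterᵇ (not ∘ (_== e)) fs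
    sub′ x∈ = ∈-filter⁺ (T? ∘ (not ∘ (_== e))) (sub (there x∈))
      (not-intro λ h → All.lookup e∉ x∈ (sym (==⇒≡ h)))

  all⇒ : ∀ {p : A → Bool} xs → T (all p xs) → ∀ {x} → x ∈ xs → T (p x)
  all⇒ {p = p} xs h = All.lookup (all⁺ p xs h)

  -- Edges counted by their keys.

  module Weights (κ : Edge → Edge) where

    weight : List Edge → Edge → ℕ
    weight G k = count (λ f → κ f == k) G

    mass : (Edge → Bool) → List Edge → List Edge → ℕ
    mass P V G = Σ[ V ] λ k → when (P k) (weight G k)

    private
      hit : (Edge → Bool) → Edge → List Edge → ℕ
      hit P f V = Σ[ V ] λ k → when (P k) (𝟙 (κ f == k))

      mass-∷ : ∀ P V f G → mass P V (f ∷ G) ≡ hit P f V + mass P V G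
      mass-∷ P V f G = trans (Σ-cong V pw) (Σ-+ _ _ V)
        where
        pw : ∀ k → when (P k) (weight (f ∷ G) k) ≡ when (P k) (𝟙 (κ f == k)) + when (P k) (weight G k)
        pw k with P k
        ... | true  = refl
        ... | false = refl

      hit-≤ : ∀ P f V → Unique V → hit P f V ≤ 𝟙 (P (κ f))
      hit-≤ P f []      _        = z≤n
      hit-≤ P f (k ∷ V) (k∉ ∷ u) with κ f == k in eq
      ... | false = ≤-trans (+-monoˡ-≤ _ (≤-reflexive (when-0 (P k)))) (hit-≤ P f V u)
        where
        when-0 : ∀ b → when b 0 ≡ 0
        when-0 true = refl
        when-0 false = refl
      ... | true  rewrite ==⇒≡ {κ f} {k} (subst T (sym eq) tt) =
        ≤-reflexive (trans (cong₂ _+_ (lem (P k)) (Σ-zero V zer)) (+-identityʳ _))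
        where
        lem : ∀ b → when b 1 ≡ 𝟙 b
        lem true = refl
        lem false = refl
        zer : ∀ {k′} → k′ ∈ V → when (P k′) (𝟙 (k == k′)) ≡ 0
        zer {k′} k′∈ with k == k′ in eq′
        ... | true  = ⊥-elim (All.lookup k∉ k′∈ (==⇒≡ (subst T (sym eq′) tt)))
        ... | false with P k′
        ...   | true = refl
        ...   | false = refl

      hit-≥ : ∀ P f V → (T (P (κ f)) → κ f ∈ V) → 𝟙 (P (κ f)) ≤ hit P f V
      hit-≥ P f V h with P (κ f) in eq
      ... | false = z≤n
      ... | true  = go V (h tt)
        where
        go : ∀ V → κ f ∈ V → 1 ≤ hit P f V
        go (k ∷ V) (here refl) = ≤-trans (≤-reflexive (sym pw)) (m≤m+n _ _)
          where
          lem : ∀ b → T b → 𝟙 b ≡ 1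
          lem true _ = refl
          pw : when (P (κ f)) (𝟙 (κ f == κ f)) ≡ 1
          pw rewrite eq = lem _ (≡⇒== {κ f} refl)
        go (k ∷ V) (there k∈) = ≤-trans (go V k∈) (m≤n+m _ _)

    -- After exchanging the two summations, an edge is counted once for each occurrence of its key
    -- in `V`: at most once if `V` has no duplicates, and, for `mass-≥`, at least once if the key is
    -- listed.
    mass-≤ : ∀ P V G → Unique V → mass P V G ≤ count (P ∘ κ) G
    mass-≤ P V []      u = ≤-reflexive (Σ-zero V λ {k} _ → z (P k))
      where
      z : ∀ b → when b 0 ≡ 0
      z true = refl
      z false = refl
    mass-≤ P V (f ∷ G) u = ≤-trans (≤-reflexive (mass-∷ P V f G))
      (+-mono-≤ (hit-≤ P f V u) (mass-≤ P V G u))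

    mass-≥ : ∀ P V G → (∀ {f} → f ∈ G → T (P (κ f)) → κ f ∈ V) → count (P ∘ κ) G ≤ mass P V G
    mass-≥ P V []      h = z≤n
    mass-≥ P V (f ∷ G) h = ≤-trans (+-mono-≤ (hit-≥ P f V (h (here refl))) (mass-≥ P V G (h ∘ there)))
      (≤-reflexive (sym (mass-∷ P V f G)))

  -- The exhaustive search.  A constraint is a budget together with cells: the
  -- position of a variable, the most that the later variables can cost, and the
  -- table of costs of its values.  Lower constraints charge for small values and
  -- upper ones for large values, so extreme values leave one of the two lists as
  -- it is; the cells passed over in this way are discarded later.  Constraints
  -- whose budget can no longer be exceeded are dropped.

  data Cell : Set where
    cell : ℕ → ℕ → List ℕ → Cell

  data Constraint : Set where
    _for_ : ℕ → List Cell → Constraint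

  at : List ℕ → ℕ → ℕ
  at []       _       = 0
  at (c ∷ cs) zero    = c
  at (c ∷ cs) (suc a) = at cs a

  Search : Set
  Search = List Constraint → Bool

  -- Continuation passing lets an exceeded budget answer `true` at once; the remaining constraints
  -- and the subtree below are then never evaluated.
  spend : ℕ → ℕ → List Constraint → List Constraint → Search → Bool
  seek  : ℕ → ℕ → ℕ → List Cell → List Constraint → List Constraint → Search → Bool

  spend i a []                 done k = k done
  spend i a ((b for rs) ∷ cs) done k = seek i a b rs cs done k

  charge : ℕ → ℕ → ℕ → List Cell → List Constraint → (List Constraint → Bool) → Bool
  charge c b m rs done k =
    if c ≤ᵇ b then (if m ≤ᵇ (b ∸ c) then k done else k (((b ∸ c) for rs) ∷ done)) else true

  seek i a b []                done-cs done k = spend i a done-cs done k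
  seek i a b (cell j m r ∷ rs) cs done k =
    if i <ᵇ j then spend i a cs ((b for (cell j m r ∷ rs)) ∷ done) k
    else if i ≡ᵇ j then charge (at r a) b m rs done (λ done′ → spend i a cs done′ k)
    else if m ≤ᵇ b then spend i a cs done k
    else seek i a b rs cs done k

  refute      : ℕ → List ℕ → List Constraint → List Constraint → Bool
  refuteBelow : ℕ → ℕ → ℕ → List ℕ → List Constraint → List Constraint → Bool
  refuteAt    : ℕ → Bool → Bool → ℕ → List ℕ → List Constraint → List Constraint → Bool

  refute i []       ls us = false
  refute i (d ∷ ds) ls us = refuteBelow i d d ds ls us

  refuteBelow i d zero    ds ls us = refuteAt i (0 ≡ᵇ d) true 0 ds ls us
  refuteBelow i d (suc a) ds ls us =
    if refuteAt i (suc a ≡ᵇ d) false (suc a) ds ls us then refuteBelow i d a ds ls us else false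

  refuteAt i true  true  a ds ls us = refute (suc i) ds ls us
  refuteAt i true  false a ds ls us = spend i a us [] λ us′ → refute (suc i) ds ls us′
  refuteAt i false true  a ds ls us = spend i a ls [] λ ls′ → refute (suc i) ds ls′ us
  refuteAt i false false a ds ls us = spend i a ls [] λ ls′ → spend i a us [] λ us′ → refute (suc i) ds ls′ us′

  Bounded : (ℕ → ℕ) → ℕ → List ℕ → Set
  Bounded val i []       = ⊤
  Bounded val i (d ∷ ds) = val i ≤ d × Bounded val (suc i) ds

  cost : (ℕ → ℕ) → List Cell → ℕ
  cost val []                = 0
  cost val (cell j m r ∷ rs) = at r (val j) + cost val rs

  Satisfied : (ℕ → ℕ) → Constraint → Set
  Satisfied val (b for rs) = cost val rs ≤ b

  if-elim : ∀ {a b : Bool} → T (if a then b else false) → T a × T b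
  if-elim {true} h = tt , h

  module _ (val : ℕ → ℕ) where

    Refuting : Search → Set
    Refuting k = ∀ cs → T (k cs) → All (Satisfied val) cs → ⊥

    -- Each step only weakens the system: a constraint is forgotten, or the nonnegative cost of a
    -- passed cell is. The stored bounds on later costs merely decide when to forget, so soundness
    -- holds whatever they are.
    spend-sound : ∀ i cs done k → Refuting k → T (spend i (val i) cs done k) →
                  All (Satisfied val) cs → All (Satisfied val) done → ⊥
    seek-sound : ∀ i b rs cs done k → Refuting k → T (seek i (val i) b rs cs done k) →
                 cost val rs ≤ b → All (Satisfied val) cs → All (Satisfied val) done → ⊥

    spend-sound i []                 done k ref h []       ts = ref done h ts
    spend-sound i ((b for rs) ∷ cs) done k ref h (s ∷ ss) ts = seek-sound i b rs cs done k ref h s ss ts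

    seek-sound i b []                cs done k ref h s ss ts = spend-sound i cs done k ref h ss ts
    seek-sound i b (cell j m r ∷ rs) cs done k ref h s ss ts with i <ᵇ j
    ... | true  = spend-sound i cs (_ ∷ done) k ref h ss (s ∷ ts)
    ... | false with i ≡ᵇ j in i≡j
    ...   | false with m ≤ᵇ b
    ...     | true  = spend-sound i cs done k ref h ss ts
    ...     | false = seek-sound i b rs cs done k ref h (≤-trans (m≤n+m _ (at r (val j))) s) ss ts
    seek-sound i b (cell j m r ∷ rs) cs done k ref h s ss ts | false | true
      with refl ← ≡ᵇ⇒≡ i j (subst T (sym i≡j) tt)
      with at r (val i) ≤ᵇ b in c≤b
    ... | false = subst T c≤b (≤⇒≤ᵇ (≤-trans (m≤m+n (at r (val i)) (cost val rs)) s))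
    ... | true with m ≤ᵇ (b ∸ at r (val i))
    ...   | true  = spend-sound i cs done k ref h ss ts
    ...   | false = spend-sound i cs (_ ∷ done) k ref h ss
      (≤-trans (≤-reflexive (sym (m+n∸m≡n (at r (val i)) (cost val rs)))) (∸-monoˡ-≤ (at r (val i)) s) ∷ ts)

    refute-sound : ∀ i ds ls us → T (refute i ds ls us) → Bounded val i ds →
                   All (Satisfied val) ls → All (Satisfied val) us → ⊥
    refuteBelow-sound : ∀ i d a ds ls us → T (refuteBelow i d a ds ls us) → val i ≤ a → Bounded val (suc i) ds →
                        All (Satisfied val) ls → All (Satisfied val) us → ⊥
    refuteAt-sound : ∀ i p q ds ls us → T (refuteAt i p q (val i) ds ls us) → Bounded val (suc i) ds →
                     All (Satisfied val) ls → All (Satisfied val) us → ⊥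

    refute-sound i (d ∷ ds) ls us h (v≤ , bs) = refuteBelow-sound i d d ds ls us h v≤ bs

    refuteBelow-sound i d zero ds ls us h v≤ bs =
      refuteAt-sound i (0 ≡ᵇ d) true ds ls us
        (subst (λ v → T (refuteAt i (0 ≡ᵇ d) true v ds ls us)) (sym (n≤0⇒n≡0 v≤)) h) bs
    refuteBelow-sound i d (suc a) ds ls us h v≤ bs with m≤n⇒m<n∨m≡n v≤
    ... | inj₁ (s≤s v≤a) = refuteBelow-sound i d a ds ls us (proj₂ (if-elim h)) v≤a bs
    ... | inj₂ eq = refuteAt-sound i (suc a ≡ᵇ d) false ds ls us
      (subst (λ v → T (refuteAt i (suc a ≡ᵇ d) false v ds ls us)) (sym eq) (proj₁ (if-elim h))) bs

    refuteAt-sound i true  true  ds ls us h bs ss ts = refute-sound (suc i) ds ls us h bs ss ts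
    refuteAt-sound i true  false ds ls us h bs ss ts = spend-sound i us [] _
      (λ us′ h′ ts′ → refute-sound (suc i) ds ls us′ h′ bs ss ts′) h ts []
    refuteAt-sound i false true  ds ls us h bs ss ts = spend-sound i ls [] _
      (λ ls′ h′ ss′ → refute-sound (suc i) ds ls′ us h′ bs ss′ ts) h ss []
    refuteAt-sound i false false ds ls us h bs ss ts = spend-sound i ls [] _
      (λ ls′ h′ ss′ → spend-sound i us [] _
        (λ us′ h″ ts′ → refute-sound (suc i) ds ls′ us′ h″ bs ss′ ts′) h′ ts []) h ss []

-- Combinatorial drawings and their rotations.

module Drawings where

  open Counting
  open import Data.Bool.Base using (Bool; T; _∧_; _∨_)
  open import Data.Empty using (⊥-elim)
  open import Data.List.Base using (List; []; _∷_; map; length)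
  open import Data.List.Properties using (length-map)
  open import Data.List.Membership.Propositional using (_∈_)
  open import Data.List.Membership.Propositional.Properties using (∈-map⁻; ∈-map⁺)
  open import Data.List.Relation.Unary.All as All using (All; []; _∷_)
  open import Data.List.Relation.Unary.Any using (here; there)
  open import Data.List.Relation.Unary.AllPairs using ([]; _∷_)
  open import Data.List.Relation.Unary.Unique.Propositional using (Unique)
  open import Data.Nat.Base
  open import Data.Nat.Properties
  open import Data.Product.Base using (_×_; _,_; proj₁; proj₂)
  open import Data.Sum.Base using (_⊎_; inj₁; inj₂)
  open import Relation.Binary.PropositionalEquality
  open import Relation.Nullary using (¬_)

  cross : Edge → Edge → Bool
  cross (u , v) (x , y) = ((u <ᵇ x) ∧ ((x <ᵇ v) ∧ (v <ᵇ y))) ∨ ((x <ᵇ u) ∧ ((u <ᵇ y) ∧ (y <ᵇ v)))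

  data Interleaved : Edge → Edge → Set where
    after  : ∀ {u v x y} → u < x → x < v → v < y → Interleaved (u , v) (x , y)
    before : ∀ {u v x y} → x < u → u < y → y < v → Interleaved (u , v) (x , y)

  cross⇒ : ∀ e f → T (cross e f) → Interleaved e f
  cross⇒ (u , v) (x , y) h with ∨-elim {(u <ᵇ x) ∧ ((x <ᵇ v) ∧ (v <ᵇ y))} h
  ... | inj₁ p = let a , q = ∧-elim {u <ᵇ x} p ; b , c = ∧-elim {x <ᵇ v} q in
    after (<ᵇ⇒< _ _ a) (<ᵇ⇒< _ _ b) (<ᵇ⇒< _ _ c)
  ... | inj₂ p = let a , q = ∧-elim {x <ᵇ u} p ; b , c = ∧-elim {u <ᵇ y} q in
    before (<ᵇ⇒< _ _ a) (<ᵇ⇒< _ _ b) (<ᵇ⇒< _ _ c)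

  ⇒cross : ∀ {e f} → Interleaved e f → T (cross e f)
  ⇒cross (after a b c) = ∨-introˡ (∧-intro (<⇒<ᵇ a) (∧-intro (<⇒<ᵇ b) (<⇒<ᵇ c)))
  ⇒cross {u , v} {x , y} (before a b c) = ∨-introʳ {(u <ᵇ x) ∧ ((x <ᵇ v) ∧ (v <ᵇ y))}
    (∧-intro (<⇒<ᵇ a) (∧-intro (<⇒<ᵇ b) (<⇒<ᵇ c)))

  cross-sym : ∀ {e f} → Interleaved e f → Interleaved f e
  cross-sym (after a b c)  = before a b c
  cross-sym (before a b c) = after a b c

  cross-irrefl : ∀ {e} → ¬ Interleaved e e
  cross-irrefl (after a _ _)  = <-irrefl refl a
  cross-irrefl (before a _ _) = <-irrefl refl a

  Diagonal : ℕ → Edge → Set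
  Diagonal N (u , v) = 2 + u ≤ v × v < N × (0 < u ⊎ suc v < N)

  record Drawing (N ℓ : ℕ) (G : List Edge) : Set where
    field
      unique    : Unique G
      diagonals : ∀ {e} → e ∈ G → Diagonal N e
      light     : ∀ {e} → e ∈ G → count (cross e) G ≤ ℓ

  open Drawing public

  unique-map : ∀ {G} (f : Edge → Edge) → Unique G →
               (∀ {d e} → d ∈ G → e ∈ G → f d ≡ f e → d ≡ e) → Unique (map f G)
  unique-map {[]}    f _        _   = []
  unique-map {e ∷ G} f (e∉ ∷ u) inj =
    All.tabulate (λ x∈ fe≡x → let d , d∈ , x≡fd = ∈-map⁻ f x∈ in
      All.lookup e∉ d∈ (inj (here refl) (there d∈) (trans fe≡x x≡fd)))
    ∷ unique-map f u (λ d∈ e∈ → inj (there d∈) (there e∈))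

  -- One step of rotation, taking vertex 0 to vertex N - 1.
  turn : ℕ → Edge → Edge
  turn N (zero  , v) = pred v , pred N
  turn N (suc u , v) = u , pred v

  private
    pred-< : ∀ {x y} → 0 < x → x < y → pred x < pred y
    pred-< {suc x} {suc y} _ (s≤s h) = h

    -- A bound on the number of crossings passes to the image of a drawing as soon as the map
    -- reflects crossings. Contraction and gluing follow the same scheme.
    turn-cross : ∀ N {e f} → Diagonal N e → Diagonal N f → Interleaved (turn N e) (turn N f) → Interleaved e f
    turn-cross N {zero , v}  {zero , y}  _ _ (after _ _ r) = ⊥-elim (<-irrefl refl r)
    turn-cross N {zero , v}  {zero , y}  _ _ (before _ _ r) = ⊥-elim (<-irrefl refl r)
    turn-cross N {zero , v}  {suc x , suc y} _ (_ , y<N , _) (after p q r) =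
      ⊥-elim (<-asym r (pred-< (s≤s z≤n) y<N))
    turn-cross N {zero , suc v}  {suc x , suc y} _ _ (before p q r) = after (s≤s z≤n) (s≤s p) (s≤s q)
    turn-cross N {suc u , suc v} {zero , suc y}  _ _ (after p q r) = before (s≤s z≤n) (s≤s p) (s≤s q)
    turn-cross N {suc u , suc v} {zero , y}  (_ , v<N , _) _ (before p q r) =
      ⊥-elim (<-asym r (pred-< (s≤s z≤n) v<N))
    turn-cross N {suc u , suc v} {suc x , suc y} _ _ (after p q r) = after (s≤s p) (s≤s q) (s≤s r)
    turn-cross N {suc u , suc v} {suc x , suc y} _ _ (before p q r) = before (s≤s p) (s≤s q) (s≤s r)

    turn-diagonal : ∀ N {e} → Diagonal N e → Diagonal N (turn N e)
    turn-diagonal (suc N) {zero , suc v} (s≤s v≥1 , v<N , inj₂ (s≤s v+1<N)) = v+1<N , ≤-refl , inj₁ v≥1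
    turn-diagonal (suc N) {suc u , suc v} (s≤s g , s≤s v<N , _) = g , m≤n⇒m≤1+n v<N , inj₂ (s≤s v<N)

    turn-inj : ∀ N {d e} → Diagonal N d → Diagonal N e → turn N d ≡ turn N e → d ≡ e
    turn-inj N {zero , suc v} {zero , suc y} _ _ eq = cong (λ z → 0 , suc (proj₁ z)) eq
    turn-inj (suc N) {zero , suc v} {suc x , suc y} _ (_ , s≤s y<N , _) eq =
      ⊥-elim (<-irrefl (sym (cong proj₂ eq)) y<N)
    turn-inj (suc N) {suc u , suc v} {zero , suc y} (_ , s≤s v<N , _) _ eq =
      ⊥-elim (<-irrefl (cong proj₂ eq) v<N)
    turn-inj N {suc u , suc v} {suc x , suc y} _ _ eq =
      cong (λ z → suc (proj₁ z) , suc (proj₂ z)) eq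

  turn-drawing : ∀ {N ℓ G} → Drawing N ℓ G → Drawing N ℓ (map (turn N) G)
  turn-drawing {N} {ℓ} {G} D = record
    { unique    = unique-map (turn N) (unique D) λ d∈ e∈ → turn-inj N (diagonals D d∈) (diagonals D e∈)
    ; diagonals = λ x∈ → let e , e∈ , eq = ∈-map⁻ (turn N) x∈ in
        subst (Diagonal N) (sym eq) (turn-diagonal N (diagonals D e∈))
    ; light     = λ x∈ → let e , e∈ , eq = ∈-map⁻ (turn N) x∈ in
        subst (λ x → count (cross x) (map (turn N) G) ≤ ℓ) (sym eq) (lt e∈)
    }
    where
    lt : ∀ {e} → e ∈ G → count (cross (turn N e)) (map (turn N) G) ≤ ℓ
    lt {e} e∈ = ≤-trans (≤-reflexive (count-map (cross (turn N e)) (turn N) G)) (≤-trans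
      (count-mono G λ {f} f∈ h → ⇒cross (turn-cross N (diagonals D e∈) (diagonals D f∈) (cross⇒ (turn N e) (turn N f) h)))
      (light D e∈))

  -- Any edge of a drawing may be rotated so as to start at 0, and then to end at
  -- N - 1; the latter exchanges its two sides.
  record Rotated (N ℓ : ℕ) (G : List Edge) (e : Edge) : Set where
    constructor rotated
    field
      {graph} : List Edge
      drawing : Drawing N ℓ graph
      size-≡  : length graph ≡ length G
      member  : e ∈ graph

  rotate-down : ∀ {N ℓ G} u d → Drawing N ℓ G → (u , u + d) ∈ G → Rotated N ℓ G (0 , d)
  rotate-down zero    d D e∈ = rotated D refl e∈
  rotate-down {N} {ℓ} {G} (suc u) d D e∈ with rotate-down u d (turn-drawing D) (∈-map⁺ (turn N) e∈)
  ... | rotated D′ eq e∈′ = rotated D′ (trans eq (length-map (turn N) G)) e∈′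

  rotate-flip : ∀ {N ℓ G} d m → N ≡ d + m → Drawing N ℓ G → (0 , d) ∈ G → Rotated N ℓ G (0 , m)
  rotate-flip {N} {ℓ} {G} d m N≡ D e∈ with diagonals D e∈
  -- As N = suc d + m, the first turn sends (0 , suc d) to (d , d + m), and d further turns give (0
  -- , m).
  rotate-flip {N} {ℓ} {G} (suc d) m refl D e∈ | _ with
    rotate-down d m (turn-drawing D) (∈-map⁺ (turn N) e∈)
  ... | rotated D′ eq e∈′ = rotated D′ (trans eq (length-map (turn N) G)) e∈′

-- Contractions and the linear constraints that they yield.

module Windows where

  open Counting
  open Drawings
  open import Data.Bool.Base using (Bool; true; false; T; _∧_; _∨_; not; if_then_else_)
  open import Data.Bool.ListAction using (all; any)
  open import Data.Bool.Properties using (T?)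
  open import Data.Empty using (⊥; ⊥-elim)
  open import Data.Unit.Base using (tt)
  open import Data.List.Base using (List; []; _∷_; _++_; map; length; filterᵇ; applyUpTo; foldr)
  open import Data.List.Properties using (length-map; length-++)
  open import Data.List.Membership.Propositional using (_∈_)
  open import Data.List.Membership.Propositional.Properties using (∈-++⁻; ∈-map⁻; ∈-map⁺; ∈-filter⁺; ∈-filter⁻)
  open import Data.List.Relation.Unary.All as All using (All; []; _∷_)
  open import Data.List.Relation.Unary.All.Properties using () renaming (map⁺ to All-map⁺; ++⁺ to All-++⁺)
  open import Data.List.Relation.Unary.Any using (here; there)
  open import Data.List.Relation.Unary.AllPairs using ([]; _∷_)
  open import Data.List.Relation.Unary.Unique.Propositional using (Unique)
  open import Data.List.Relation.Unary.Unique.Propositional.Properties using () renaming (filter⁺ to unique-filter; ++⁺ to unique-++)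
  open import Data.Nat.Base
  open import Data.Nat.Properties
  open import Data.Product.Base using (_×_; _,_; proj₁; proj₂; ∃-syntax)
  open import Data.Sum.Base using (_⊎_; inj₁; inj₂)
  open import Function.Base using (_∘_)
  open import Relation.Binary.PropositionalEquality
  open import Relation.Nullary using (¬_; yes; no)

  -- Contraction maps: φ bs merges vertices i and i + 1 when the i-th entry is true.

  φ : List Bool → ℕ → ℕ
  φ []           v       = v
  φ (b ∷ bs)     zero    = 0
  φ (true ∷ bs)  (suc v) = φ bs v
  φ (false ∷ bs) (suc v) = suc (φ bs v)

  merged : List Bool → ℕ
  merged = count (λ b → b)

  φ-0 : ∀ bs → φ bs 0 ≡ 0
  φ-0 []       = refl
  φ-0 (b ∷ bs) = refl

  φ-mono : ∀ bs {u v} → u ≤ v → φ bs u ≤ φ bs v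
  φ-mono []           h       = h
  φ-mono (b ∷ bs)     z≤n     = z≤n
  φ-mono (true ∷ bs)  (s≤s h) = φ-mono bs h
  φ-mono (false ∷ bs) (s≤s h) = s≤s (φ-mono bs h)

  φ-shift : ∀ bs {v} → length bs ≤ v → φ bs v + merged bs ≡ v
  φ-shift []           {v}     h       = +-identityʳ v
  φ-shift (true ∷ bs)  {suc v} (s≤s h) = trans (+-suc _ _) (cong suc (φ-shift bs h))
  φ-shift (false ∷ bs) {suc v} (s≤s h) = cong suc (φ-shift bs h)

  φ-cancel-< : ∀ bs {u v} → φ bs u < φ bs v → u < v
  φ-cancel-< bs {u} {v} h with u <? v
  ... | yes p = p
  ... | no ¬p = ⊥-elim (<⇒≱ h (φ-mono bs (≮⇒≥ ¬p)))

  φ-strict : ∀ bs {u w v} → length bs ≤ w → u ≤ w → w < v → φ bs u < φ bs v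
  φ-strict bs {u} {w} {v} l u≤w w<v = ≤-<-trans (φ-mono bs u≤w)
    (+-cancelʳ-< (merged bs) _ _ (subst₂ _<_ (sym (φ-shift bs l)) (sym (φ-shift bs (≤-trans l (<⇒≤ w<v)))) w<v))

  φ-inj : ∀ bs {u v} → length bs ≤ u → length bs ≤ v → φ bs u ≡ φ bs v → u ≡ v
  φ-inj bs l l′ eq = trans (sym (φ-shift bs l)) (trans (cong (_+ merged bs) eq) (φ-shift bs l′))

  φ² : List Bool → Edge → Edge
  φ² bs (u , v) = φ bs u , φ bs v

  -- Crossing is a chain of strict inequalities between ends, and a monotone map reflects strict
  -- inequalities. Hence an image is crossed at most as often as its original, whichever vertices
  -- are merged.
  φ-cross : ∀ bs {e f} → Interleaved (φ² bs e) (φ² bs f) → Interleaved e f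
  φ-cross bs {u , v} {x , y} (after a b c)  = after (φ-cancel-< bs a) (φ-cancel-< bs b) (φ-cancel-< bs c)
  φ-cross bs {u , v} {x , y} (before a b c) = before (φ-cancel-< bs a) (φ-cancel-< bs b) (φ-cancel-< bs c)

  unique-map-inj : ∀ {X : Set} (f : X → Edge) {L} → Unique (map f L) → ∀ {d e} → d ∈ L → e ∈ L → f d ≡ f e → d ≡ e
  unique-map-inj f {x ∷ L} (x∉ ∷ u) (here refl) (here refl) eq = refl
  unique-map-inj f {x ∷ L} (x∉ ∷ u) (here refl) (there e∈)  eq = ⊥-elim (All.lookup x∉ (∈-map⁺ f e∈) eq)
  unique-map-inj f {x ∷ L} (x∉ ∷ u) (there d∈)  (here refl) eq = ⊥-elim (All.lookup x∉ (∈-map⁺ f d∈) (sym eq))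
  unique-map-inj f {x ∷ L} (x∉ ∷ u) (there d∈)  (there e∈)  eq = unique-map-inj f u d∈ e∈ eq

  -- The edges of a drawing as seen from an edge (0 , 1 + m): this edge has the
  -- key (0 , 1), the edges on its side with the vertices 1, ..., m are their own
  -- keys, an edge crossing it has the key (i , 0) of its end i among 1, ..., m,
  -- and all other edges have the key (0 , 0).

  Key : Set
  Key = Edge

  module _ (m : ℕ) where

    key : Edge → Key
    key (u , v) with v ≤ᵇ suc m
    ... | true  = if (u , v) == (0 , suc m) then (0 , 1) else (u , v)
    ... | false = if (0 <ᵇ u) ∧ (u ≤ᵇ m) then (u , 0) else (0 , 0)

    data View : Edge → Key → Set where
      base   : View (0 , suc m) (0 , 1)
      inside : ∀ {u v} → v ≤ suc m → (u , v) ≢ (0 , suc m) → View (u , v) (u , v)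
      out    : ∀ {u v} → 0 < u → u ≤ m → suc m < v → View (u , v) (u , 0)
      far    : ∀ {u v} → suc m < v → u ≡ 0 ⊎ m < u → View (u , v) (0 , 0)

    view : ∀ e → View e (key e)
    view (u , v) with v ≤ᵇ suc m in eq
    ... | true with (u , v) == (0 , suc m) in eq₂
    ...   | true with refl ← ==⇒≡ {u , v} {0 , suc m} (subst T (sym eq₂) tt) = base
    ...   | false = inside (≤ᵇ⇒≤ v (suc m) (subst T (sym eq) tt))
                      (λ p → subst T eq₂ (≡⇒== {u , v} p))
    view (u , v) | false with (0 <ᵇ u) ∧ (u ≤ᵇ m) in eq₂
    ...   | true  = let p , q = ∧-elim {0 <ᵇ u} (subst T (sym eq₂) tt) in
                    out (<ᵇ⇒< 0 u p) (≤ᵇ⇒≤ u m q) v>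
      where v> = ≰⇒> λ h → subst T eq (≤⇒≤ᵇ h)
    ...   | false = far v> (side u refl)
      where
      v> = ≰⇒> λ h → subst T eq (≤⇒≤ᵇ h)
      side : ∀ u′ → u ≡ u′ → u ≡ 0 ⊎ m < u
      side zero     p = inj₁ p
      side (suc u′) p = inj₂ (≰⇒> λ h → subst T eq₂ (∧-intro {0 <ᵇ u} (<⇒<ᵇ (subst (0 <_) (sym p) (s≤s z≤n))) (≤⇒≤ᵇ h)))

  isOut isEdge : Key → Bool
  isOut (a , b)  = (0 <ᵇ a) ∧ (b ≡ᵇ 0)
  isEdge (a , b) = 2 ≤ᵇ b

  -- Crossings that can be read off the keys: an edge leaving from a vertex strictly between `u` and
  -- `v` crosses (u , v) wherever it ends, while the base and the far edges never do.
  crossed : Edge → Key → Bool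
  crossed (u , v) (a , b) = if b ≡ᵇ 0 then (u <ᵇ a) ∧ (a <ᵇ v) else cross (u , v) (a , b)

  over : ℕ → Key → Bool
  over i (a , b) = (b ≡ᵇ 1) ∨ ((a <ᵇ i) ∧ (i <ᵇ b))

  -- In a window, m₀ is the number m of vertices cut off by the edge (0 , 1 + m) or
  -- a lower bound for it, contractions only merge vertices up to W, V lists the
  -- keys of all edges that these may affect, and the r-th entry of drops is a lower
  -- bound for the decrease of the maximum when r vertices are removed.

  record Window : Set where
    field
      ℓ m₀ W : ℕ
      V      : List Key
      drops  : List ℕ

  -- The edges with keys in `lost` are deleted before merging, so that the remaining edges have
  -- distinct diagonals as images.
  record Contraction : Set where
    constructor contraction
    field
      merge : List Bool
      lost  : List Key

  module Machine (Wd : Window) where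
    open Window Wd
    open Contraction

    dom : Key → ℕ
    dom (a , zero)  = ℓ
    dom (a , suc b) = 1

    capacity : (Key → Bool) → ℕ
    capacity P = Σ[ V ] λ k → when (P k) (dom k)

    potential : List Cell → ℕ
    potential []               = 0
    potential (cell i m r ∷ _) = foldr _⊔_ 0 r + m

    cells : (Key → Bool) → (Key → ℕ → ℕ) → ℕ → List Key → List Cell
    cells rel price i []       = []
    cells rel price i (k ∷ ks) = if rel k then cell i (potential rest) (applyUpTo (price k) (suc (dom k))) ∷ rest else rest
      where rest = cells rel price (suc i) ks

    compile : ℕ → (Key → Bool) → (Key → ℕ → ℕ) → Constraint
    compile b rel price = b for cells rel price 0 V

    -- The capacities are passed as arguments so that they are computed only once.
    atMost-price : (Key → Bool) → Key → ℕ → Key → ℕ → ℕ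
    atMost-price P g c k a = when (P k) a + when (k == g) (when (0 <ᵇ a) c)

    -- The implication "if some edge has the key `g`, then at most ℓ edges have keys in `P`" made
    -- linear: a positive value of `g` costs the whole capacity of `P`, and the budget is raised by
    -- the same amount, so nothing is demanded when `g` is absent.
    atMostℓ : Key → (Key → Bool) → Constraint
    atMostℓ g P = go (capacity P)
      where
      go : ℕ → Constraint
      go c = compile (ℓ + c) (λ k → P k ∨ (k == g)) (atMost-price P g c)

    -- A lower bound on values becomes an upper bound on their deficits from `dom`. For an
    -- unattainable `n` the truncated budget is 0, which the maximal values still meet; `hopeless`
    -- catches this case for contractions.
    atLeast : (Key → Bool) → ℕ → Constraint
    atLeast P n = compile (capacity P ∸ n) P (λ k a → dom k ∸ a)

    contractionConstraint : Contraction → Constraint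
    contractionConstraint c = atLeast (_∈ᵇ lost c) (suc (at drops (merged (merge c))))

    edgeKeys outKeys : List Key
    edgeKeys = filterᵇ isEdge V
    outKeys  = filterᵇ isOut V

    -- Even losing everything that it may lose, the contraction loses too little.
    hopeless : Contraction → Bool
    hopeless c = capacity (_∈ᵇ lost c) ≤ᵇ at drops (merged (merge c))

    lowers : List Contraction → List Constraint
    lowers cs = atLeast (_== (0 , 1)) 1 ∷ map contractionConstraint cs

    uppers : List Constraint
    uppers =
      atMostℓ (0 , 1) isOut
      ∷ map (λ k → atMostℓ k (crossed k)) edgeKeys
      ++ map (λ k → atMostℓ k (over (proj₁ k))) outKeys

    keptEdges keptOuts : Contraction → List Key
    keptEdges c = filterᵇ (λ k → isEdge k ∧ not (k ∈ᵇ lost c)) V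
    keptOuts  c = filterᵇ (λ k → isOut k ∧ not (k ∈ᵇ lost c)) V

    -- An inside image starting at 0 must end before the image of `suc m₀`, lest it coincide with
    -- the image of the base. A leaving edge may share its far end with an edge from 0 or from
    -- beyond `m₀`, so the image of its start must lie strictly between theirs.
    okEdge okOut : List Bool → Key → Bool
    okEdge bs (u , v) = (2 + φ bs u ≤ᵇ φ bs v) ∧ ((1 ≤ᵇ φ bs u) ∨ (φ bs v <ᵇ φ bs (suc m₀)))
    okOut  bs (i , _) = (0 <ᵇ φ bs i) ∧ (φ bs i <ᵇ φ bs (suc m₀))

    valid : Contraction → Bool
    valid c = (0 <ᵇ merged (merge c)) ∧ ((length (merge c) ≤ᵇ W) ∧ ((merged (merge c) ≤ᵇ m₀)
      ∧ (all (_∈ᵇ V) (lost c)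
      ∧ (all (okEdge (merge c)) (keptEdges c)
      ∧ (all (okOut (merge c)) (keptOuts c)
      ∧ (uniqueᵇ (map (φ² (merge c)) (keptEdges c))
      ∧ (uniqueᵇ (map (φ² (merge c)) (keptOuts c))
      ∧ (((0 , 1) ∈ᵇ lost c) ∨ (2 ≤ᵇ φ (merge c) (suc m₀))))))))))

    wellFormed : Bool
    wellFormed = uniqueᵇ V ∧ (all (λ (a , b) → (0 <ᵇ a) ∨ (0 <ᵇ b)) V ∧ ((W ≤ᵇ suc m₀) ∧ ((0 , 1) ∈ᵇ V)))

    -- A replacement removes all inside edges from a drawing in which these, and
    -- the numbers of edges leaving the window, are as given by a set of keys, then
    -- contracts and inserts new inside edges.
    record Replacement : Set where
      constructor replacement
      field
        present  : List Key
        shrink   : Contraction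
        inserted : List Edge

    open Replacement public

    pattern-value : List Key → Key → ℕ
    pattern-value ps k = 𝟙 (k ∈ᵇ ps)

    spans : List Bool → Key → Edge → Bool
    spans bs (i , _) (a , b) = (a <ᵇ φ bs i) ∧ (φ bs i <ᵇ b)

    valid-insert : List Bool → Edge → Bool
    valid-insert bs (a , b) = (2 + a ≤ᵇ b) ∧ ((b ≤ᵇ φ bs (suc m₀)) ∧ not ((a , b) == (0 , φ bs (suc m₀))))

    -- The test on `keptOuts c` ensures that a surviving leaving edge is crossed by no more inserted
    -- edges than inside edges removed. The next test makes the net loss of edges too small for a
    -- counterexample. The last one makes `whole` demand as many edges as the pattern has, so a
    -- solution bounded by the pattern equals it.
    replaceable : Replacement → Contraction → Bool
    replaceable (replacement ps c as) whole =
      valid c ∧ (valid whole ∧ (uniqueᵇ as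
      ∧ (all (valid-insert (merge c)) as
      ∧ (all (_∈ᵇ lost c) edgeKeys
      ∧ (all (λ a → count (cross a) as + Σ[ V ] (λ k → when ((k ∈ᵇ keptOuts c) ∧ spans (merge c) k a) (pattern-value ps k)) ≤ᵇ ℓ) as
      ∧ (all (λ k → (pattern-value ps k ≡ᵇ 0)
           ∨ (count (spans (merge c) k) as ≤ᵇ Σ[ V ] (λ x → when (isEdge x ∧ over (proj₁ k) x) (pattern-value ps x)))) (keptOuts c)
      ∧ ((Σ[ V ] (λ k → when (k ∈ᵇ lost c) (pattern-value ps k)) ≤ᵇ length as + at drops (merged (merge c)))
      ∧ (Σ[ V ] (pattern-value ps) ≤ᵇ suc (at drops (merged (merge whole)))))))))))

    -- Edges in the pattern cannot exceed their value and are not charged for.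
    exceeds : List Key → Constraint
    exceeds ps = compile (capacity′ ∸ 1) rel λ k a → 𝟙 (a ≤ᵇ pattern-value ps k)
      where
      rel : Key → Bool
      rel k = not ((k ∈ᵇ ps) ∧ not (isOut k))
      capacity′ = count rel V

    doms : List ℕ
    doms = map dom V

    module Sound
      (E : ℕ → ℕ) {N m : ℕ} {G : List Edge} (D : Drawing N ℓ G)
      (e∈ : (0 , suc m) ∈ G) (m₀≤m : m₀ ≤ m) (wf : T wellFormed)
      (complete : ∀ {u v} → (u , v) ∈ G → v ≤ suc m → (u , v) ≢ (0 , suc m) → u ≤ W → (u , v) ∈ V)
      (complete-out : ∀ {i} → 0 < i → i ≤ m₀ → (i , 0) ∈ V)
      (smaller : ∀ {N′ G′} → 3 ≤ N′ → N′ < N → Drawing N′ ℓ G′ → length G′ ≤ E N′)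
      (drop : ∀ N′ r → 3 ≤ N′ → N ≡ N′ + r → r ≤ m₀ → E N′ + at drops r ≤ E N)
      (large : E N < length G)
      where

      open Weights (key m) public

      V-unique : Unique V
      V-unique = uniqueᵇ⇒ V (proj₁ (∧-elim wf))

      private
        wf₁ = proj₂ (∧-elim {uniqueᵇ V} wf)
        wf₂ = ∧-elim {all (λ (a , b) → (0 <ᵇ a) ∨ (0 <ᵇ b)) V} wf₁
        wf₃ = ∧-elim {W ≤ᵇ suc m₀} (proj₂ wf₂)

      W≤ : W ≤ suc m₀
      W≤ = ≤ᵇ⇒≤ W (suc m₀) (proj₁ wf₃)

      base∈V : (0 , 1) ∈ V
      base∈V = ∈ᵇ⇒∈ V (proj₂ wf₃)

      m+2<N : suc (suc m) < N
      m+2<N with proj₂ (proj₂ (diagonals D e∈))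
      ... | inj₂ h = h

      val : Key → ℕ
      val = weight G

      gap : ∀ {u v} → (u , v) ∈ G → 2 + u ≤ v
      gap f∈ = proj₁ (diagonals D f∈)

      private
        -- Diagonals end at 2 or later, which frees the second components 0 and 1 for leaving edges
        -- and the base. A positive second component therefore names a single edge.
        key-det : ∀ {a b f g} → f ∈ G → g ∈ G → key m f ≡ (a , suc b) → key m g ≡ (a , suc b) → f ≡ g
        key-det {f = f} {g} f∈ g∈ p q with key m f | view m f | key m g | view m g
        key-det f∈ g∈ refl refl | _ | base       | _ | base       = refl
        key-det f∈ g∈ refl refl | _ | base       | _ | inside _ _ with s≤s () ← gap g∈
        key-det f∈ g∈ refl refl | _ | inside _ _ | _ | base       with s≤s () ← gap f∈
        key-det f∈ g∈ refl refl | _ | inside _ _ | _ | inside _ _ = refl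

      out-crosses-base : ∀ {f} → f ∈ G → T (isOut (key m f)) → Interleaved (0 , suc m) f
      out-crosses-base {f} f∈ h with key m f | view m f
      ... | _ | base                   = ⊥-elim h
      ... | _ | out p q r              = after p (s≤s q) r
      ... | _ | far _ _                = ⊥-elim h
      ... | _ | inside {u} {suc v} _ _ = ⊥-elim (proj₂ (∧-elim {0 <ᵇ u} h))
      ... | _ | inside {u} {zero} _ _ with () ← gap f∈

      val≤dom : ∀ {k} → k ∈ V → val k ≤ dom k
      val≤dom {a , suc b} _ = go (count-pos (λ f → key m f == (a , suc b)) G)
        where
        go : (0 < val (a , suc b) → ∃[ f ] f ∈ G × T (key m f == (a , suc b))) → val (a , suc b) ≤ 1
        go h with val (a , suc b) in eq
        ... | zero  = z≤n
        ... | suc n with f , f∈ , kf ← h (s≤s z≤n) = ≤-trans (≤-reflexive (sym eq)) (≤-trans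
          (count-mono G λ {g} g∈ kg → ≡⇒== {g} (key-det g∈ f∈ (==⇒≡ kg) (==⇒≡ kf)))
          (unique-count (unique D) f))
      val≤dom {zero , zero} k∈ = ⊥-elim (all⇒ V (proj₁ wf₂) k∈)
      -- All edges leaving from this vertex cross the base, which is crossed at most ℓ times.
      val≤dom {suc a , zero} _ = ≤-trans
        (count-mono G λ {f} f∈ kf → ⇒cross (out-crosses-base f∈ (subst (T ∘ isOut) (sym (==⇒≡ {key m f} kf)) tt)))
        (light D e∈)

      private
        at-applyUpTo : ∀ (f : ℕ → ℕ) n a → at (applyUpTo f n) a ≤ f a
        at-applyUpTo f zero    a       = z≤n
        at-applyUpTo f (suc n) zero    = ≤-refl
        at-applyUpTo f (suc n) (suc a) = at-applyUpTo (f ∘ suc) n a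

      valAt : ℕ → ℕ
      valAt = at (map val V)

      compile-sat : ∀ b rel price → Σ[ V ] (λ k → when (rel k) (price k (val k))) ≤ b →
                    Satisfied valAt (compile b rel price)
      compile-sat b rel price = ≤-trans (go V (map val V) 0 λ j → cong (at (map val V)) (+-identityʳ j))
        where
        go : ∀ V′ vs i → (∀ j → at vs (j + i) ≡ at (map val V′) j) →
             cost (at vs) (cells rel price i V′) ≤ Σ[ V′ ] (λ k → when (rel k) (price k (val k)))
        go []       vs i eq = z≤n
        go (k ∷ V′) vs i eq with rel k | go V′ vs (suc i) (λ j → trans (cong (at vs) (+-suc j i)) (eq (suc j)))
        ... | false | ih = ih
        ... | true  | ih = +-mono-≤ (≤-trans (≤-reflexive (cong (at (applyUpTo (price k) (suc (dom k)))) (eq 0)))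
                                      (at-applyUpTo (price k) (suc (dom k)) (val k))) ih

      mass-≤-capacity : ∀ P → mass P V G ≤ capacity P
      mass-≤-capacity P = Σ-mono V λ {k} k∈ → mono (P k) (val≤dom k∈)
        where
        mono : ∀ b {x y} → x ≤ y → when b x ≤ when b y
        mono true  h = h
        mono false h = z≤n

      atMostℓ-sat : ∀ g P →
        (∀ {e f} → e ∈ G → f ∈ G → key m e ≡ g → T (P (key m f)) → Interleaved e f) →
        Satisfied valAt (atMostℓ g P)
      atMostℓ-sat g P cr = compile-sat (ℓ + capacity P) _ (atMost-price P g (capacity P)) (begin
        Σ[ V ] (λ k → when (P k ∨ (k == g)) (when (P k) (val k) + when (k == g) (C k)))
          ≤⟨ Σ-mono V (λ {k} _ → when-≤ (P k ∨ (k == g)) _) ⟩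
        Σ[ V ] (λ k → when (P k) (val k) + when (k == g) (C k))
          ≡⟨ Σ-+ (λ k → when (P k) (val k)) _ V ⟩
        mass P V G + Σ[ V ] (λ k → when (k == g) (C k))
          ≤⟨ guarded ⟩
        ℓ + capacity P ∎)
        where
        open ≤-Reasoning
        C : Key → ℕ
        C k = when (0 <ᵇ val k) (capacity P)
        when-≤ : ∀ b x → when b x ≤ x
        when-≤ true  x = ≤-refl
        when-≤ false x = z≤n
        once : ∀ c V′ → Unique V′ → (∀ k → C k ≤ c) → Σ[ V′ ] (λ k → when (k == g) (C k)) ≤ c
        once c []       _         h = z≤n
        once c (k ∷ V′) (k∉ ∷ u) h with k == g in eq
        ... | false = once c V′ u h
        ... | true  = ≤-trans (≤-reflexive (trans (cong (C k +_) (Σ-zero V′ zer)) (+-identityʳ _))) (h k)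
          where
          zer : ∀ {k′} → k′ ∈ V′ → when (k′ == g) (C k′) ≡ 0
          zer {k′} k′∈ with k′ == g in eq′
          ... | false = refl
          ... | true  = ⊥-elim (All.lookup k∉ k′∈ (trans (==⇒≡ {k} (subst T (sym eq) tt))
                          (sym (==⇒≡ {k′} (subst T (sym eq′) tt)))))
        idle : val g ≡ 0 → Σ[ V ] (λ k → when (k == g) (C k)) ≡ 0
        idle v0 = Σ-zero V λ {k} _ → zer k
          where
          zer : ∀ k → when (k == g) (C k) ≡ 0
          zer k with k == g in eq
          ... | false = refl
          ... | true rewrite ==⇒≡ {k} {g} (subst T (sym eq) tt) | v0 = refl
        guarded : mass P V G + Σ[ V ] (λ k → when (k == g) (C k)) ≤ ℓ + capacity P
        -- Without an edge of key `g` the capacity alone pays for the mass. With one, its crossings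
        -- bound the mass by ℓ, and the capacity pays for the guard.
        guarded with val g in eq
        ... | zero  = ≤-trans (≤-reflexive (trans (cong (mass P V G +_) (idle eq)) (+-identityʳ _)))
                        (≤-trans (mass-≤-capacity P) (m≤n+m _ ℓ))
        ... | suc n with e , e∈′ , ke ← count-pos (λ f → key m f == g) G (subst (0 <_) (sym eq) (s≤s z≤n)) =
          +-mono-≤ (≤-trans (mass-≤ P V G V-unique) (≤-trans
                     (count-mono G λ f∈ Pf → ⇒cross (cr e∈′ f∈ (==⇒≡ ke) Pf)) (light D e∈′)))
                   (once (capacity P) V V-unique λ k → when-≤ (0 <ᵇ val k) _)

      atLeast-sat : ∀ P n → n ≤ mass P V G → Satisfied valAt (atLeast P n)
      atLeast-sat P n h = compile-sat (capacity P ∸ n) P (λ k a → dom k ∸ a) (begin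
        Σ[ V ] slack                    ≡⟨ sym (m+n∸n≡m _ (mass P V G)) ⟩
        Σ[ V ] slack + mass P V G ∸ mass P V G ≡⟨ cong (_∸ mass P V G) (sym (Σ-+ slack _ V)) ⟩
        Σ[ V ] (λ k → slack k + when (P k) (val k)) ∸ mass P V G
          ≤⟨ ∸-monoˡ-≤ (mass P V G) (Σ-mono V λ {k} k∈ → lem (P k) (val≤dom k∈)) ⟩
        capacity P ∸ mass P V G         ≤⟨ ∸-monoʳ-≤ (capacity P) h ⟩
        capacity P ∸ n                  ∎)
        where
        open ≤-Reasoning
        slack : Key → ℕ
        slack k = when (P k) (dom k ∸ val k)
        lem : ∀ b {x y} → x ≤ y → when b (y ∸ x) + when b x ≤ when b y
        lem true  h = ≤-reflexive (m∸n+n≡m h)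
        lem false h = z≤n

      module Contract (c : Contraction) (ok : T (valid c)) where
        bs = merge c
        r  = merged bs
        private
          ok₀ = ∧-elim {0 <ᵇ r} ok
          ok₁ = ∧-elim {length bs ≤ᵇ W} (proj₂ ok₀)
          ok₂ = ∧-elim {r ≤ᵇ m₀} (proj₂ ok₁)
          ok₃ = ∧-elim {all (_∈ᵇ V) (lost c)} (proj₂ ok₂)
          ok₄ = ∧-elim {all (okEdge bs) (keptEdges c)} (proj₂ ok₃)
          ok₅ = ∧-elim {all (okOut bs) (keptOuts c)} (proj₂ ok₄)
          ok₆ = ∧-elim {uniqueᵇ (map (φ² bs) (keptEdges c))} (proj₂ ok₅)
          ok₇ = ∧-elim {uniqueᵇ (map (φ² bs) (keptOuts c))} (proj₂ ok₆)

        len : length bs ≤ W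
        len = ≤ᵇ⇒≤ _ _ (proj₁ ok₁)
        r≤m₀ : r ≤ m₀
        r≤m₀ = ≤ᵇ⇒≤ _ _ (proj₁ ok₂)
        len′ : length bs ≤ suc m₀
        len′ = ≤-trans len W≤
        len″ : length bs ≤ suc m
        len″ = ≤-trans len′ (s≤s m₀≤m)

        keep : Edge → Bool
        keep f = not (key m f ∈ᵇ lost c)

        K : List Edge
        K = filterᵇ keep G

        K⁻ : ∀ {f} → f ∈ K → f ∈ G × T (keep f)
        K⁻ = ∈-filter⁻ (T? ∘ keep)

        N′ : ℕ
        N′ = N ∸ r

        N≡ : N ≡ N′ + r
        N≡ = sym (m∸n+n≡m (≤-trans r≤m₀ (≤-trans m₀≤m (≤-trans (n≤1+n m) (≤-trans (n≤1+n _) (<⇒≤ m+2<N))))))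

        cancel-r : ∀ {x y} → x + r < y + r → x < y
        cancel-r = +-cancelʳ-< r _ _

        φ-<N′ : ∀ {v} → length bs ≤ v → v < N → φ bs v < N′
        φ-<N′ l v<N = cancel-r (subst₂ _<_ (sym (φ-shift bs l)) N≡ v<N)

        φ-top : suc (φ bs (suc m)) < N′
        φ-top = cancel-r (subst₂ _<_ (cong suc (sym (φ-shift bs len″))) N≡ m+2<N)

        φ-beyond : ∀ {u} → m₀ < u → 0 < φ bs u
        φ-beyond {u} h = cancel-r (subst (r <_) (sym (φ-shift bs (≤-trans len′ h))) (≤-<-trans r≤m₀ h))

        kept-edge : ∀ {u v} → (u , v) ∈ G → v ≤ suc m → (u , v) ≢ (0 , suc m) → u ≤ W → T (not ((u , v) ∈ᵇ lost c)) →
                    (u , v) ∈ keptEdges c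
        kept-edge {u} {v} f∈ v≤ ne u≤ k = ∈-filter⁺ (T? ∘ (λ k → isEdge k ∧ not (k ∈ᵇ lost c)))
          (complete f∈ v≤ ne u≤) (∧-intro (≤⇒≤ᵇ (≤-trans (s≤s (s≤s z≤n)) (gap f∈))) k)

        kept-out : ∀ {u} → 0 < u → u ≤ m₀ → T (not ((u , 0) ∈ᵇ lost c)) → (u , 0) ∈ keptOuts c
        kept-out p q k = ∈-filter⁺ (T? ∘ (λ k → isOut k ∧ not (k ∈ᵇ lost c)))
          (complete-out p q) (∧-intro (∧-intro (<⇒<ᵇ p) tt) k)

        edge-ok : ∀ {u v} → (u , v) ∈ keptEdges c →
                  2 + φ bs u ≤ φ bs v × (0 < φ bs u ⊎ φ bs v < φ bs (suc m₀))
        edge-ok {u} {v} k∈ = let p , q = ∧-elim {2 + φ bs u ≤ᵇ φ bs v} (all⇒ (keptEdges c) (proj₁ ok₄) k∈) in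
          ≤ᵇ⇒≤ _ _ p , (case (∨-elim {1 ≤ᵇ φ bs u} q))
          where
          case : T (1 ≤ᵇ φ bs u) ⊎ T (φ bs v <ᵇ φ bs (suc m₀)) → 0 < φ bs u ⊎ φ bs v < φ bs (suc m₀)
          case (inj₁ h) = inj₁ (≤ᵇ⇒≤ _ _ h)
          case (inj₂ h) = inj₂ (<ᵇ⇒< _ _ h)

        out-ok : ∀ {u} → (u , 0) ∈ keptOuts c → 0 < φ bs u × φ bs u < φ bs (suc m₀)
        out-ok {u} k∈ = let p , q = ∧-elim {0 <ᵇ φ bs u} (all⇒ (keptOuts c) (proj₁ ok₅) k∈) in
          <ᵇ⇒< _ _ p , <ᵇ⇒< _ _ q

        base-ok : T (not ((0 , 1) ∈ᵇ lost c)) → 2 ≤ φ bs (suc m₀)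
        base-ok k with ∨-elim {(0 , 1) ∈ᵇ lost c} (proj₂ ok₇)
        ... | inj₁ h = ⊥-elim (not-elim k h)
        ... | inj₂ h = ≤ᵇ⇒≤ _ _ h

        φm₀≤φm : φ bs (suc m₀) ≤ φ bs (suc m)
        φm₀≤φm = φ-mono bs (s≤s m₀≤m)

        shifted-gap : ∀ {u v} → length bs ≤ u → 2 + u ≤ v → 2 + φ bs u ≤ φ bs v
        shifted-gap {u} {v} l g = +-cancelʳ-≤ r _ _ (subst₂ _≤_ (cong (2 +_) (sym (φ-shift bs l)))
          (sym (φ-shift bs (≤-trans l (≤-trans (n≤1+n _) (≤-trans (n≤1+n _) g))))) g)

        image-diagonal : ∀ {f} → f ∈ K → Diagonal N′ (φ² bs f)
        image-diagonal {f} f∈ with K⁻ f∈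
        ... | f∈G , kp with key m f | view m f
        ... | _ | base = subst (λ z → 2 + z ≤ φ bs (suc m)) (sym (φ-0 bs)) (≤-trans (base-ok kp) φm₀≤φm)
                       , <⇒≤ φ-top , inj₂ φ-top
        ... | _ | inside {u} {v} v≤ ne with u ≤? W
        ...   | yes u≤ = proj₁ (edge-ok (kept-edge f∈G v≤ ne u≤ kp))
                       , ≤-<-trans (φ-mono bs v≤) (<⇒≤ φ-top) , inj₂ (≤-<-trans (s≤s (φ-mono bs v≤)) φ-top)
        ...   | no ¬u≤ = shifted-gap (≤-trans len (<⇒≤ (≰⇒> ¬u≤))) (gap f∈G)
                       , ≤-<-trans (φ-mono bs v≤) (<⇒≤ φ-top) , inj₂ (≤-<-trans (s≤s (φ-mono bs v≤)) φ-top)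
        image-diagonal {f} f∈ | f∈G , kp | _ | out {u} {v} p q m<v with u ≤? m₀
        ...   | yes u≤ = let a , b = out-ok (kept-out p u≤ kp) in
                         ≤-trans (s≤s (≤-trans b φm₀≤φm)) (φ-strict bs len″ ≤-refl m<v)
                       , φ-<N′ (≤-trans len″ (<⇒≤ m<v)) (proj₁ (proj₂ (diagonals D f∈G))) , inj₁ a
        ...   | no ¬u≤ = shifted-gap (≤-trans len′ (≰⇒> ¬u≤)) (gap f∈G)
                       , φ-<N′ (≤-trans len″ (<⇒≤ m<v)) (proj₁ (proj₂ (diagonals D f∈G))) , inj₁ (φ-beyond (≰⇒> ¬u≤))
        image-diagonal {f} f∈ | f∈G , kp | _ | far {u} {v} m<v (inj₂ m<u) =
          shifted-gap (≤-trans len″ m<u) (gap f∈G)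
          , φ-<N′ (≤-trans len″ (<⇒≤ m<v)) (proj₁ (proj₂ (diagonals D f∈G)))
          , inj₁ (φ-beyond (≤-<-trans m₀≤m m<u))
        image-diagonal {f} f∈ | f∈G , kp | _ | far {u} {v} m<v (inj₁ refl) =
          subst (λ z → 2 + z ≤ φ bs v) (sym (φ-0 bs))
            (≤-trans (s≤s (φ-beyond (s≤s m₀≤m))) (φ-strict bs len″ ≤-refl m<v))
          , φ-<N′ (≤-trans len″ (<⇒≤ m<v)) (proj₁ (proj₂ (diagonals D f∈G)))
          , inj₂ (right (proj₂ (proj₂ (diagonals D f∈G))))
          where
          right : 0 < 0 ⊎ suc v < N → suc (φ bs v) < N′
          right (inj₂ h) = cancel-r (subst₂ _<_ (cong suc (sym (φ-shift bs (≤-trans len″ (<⇒≤ m<v))))) N≡ h)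

        private
          inj-edge : ∀ {e f} → e ∈ keptEdges c → f ∈ keptEdges c → φ² bs e ≡ φ² bs f → e ≡ f
          inj-edge = unique-map-inj (φ² bs) (uniqueᵇ⇒ _ (proj₁ ok₆))

          inj-out : ∀ {i j} → (i , 0) ∈ keptOuts c → (j , 0) ∈ keptOuts c → φ bs i ≡ φ bs j → i ≡ j
          inj-out i∈ j∈ eq = cong proj₁ (unique-map-inj (φ² bs) (uniqueᵇ⇒ _ (proj₁ ok₇)) i∈ j∈ (cong (_, φ bs 0) eq))

          W<φ : ∀ {u w} → u ≤ W → W < w → φ bs u < φ bs w
          W<φ = φ-strict bs len

          -- Inside edges whose image starts at 0 end before the image of 1 + m.
          not-base : ∀ {u v} → (u , v) ∈ G → v ≤ suc m → (u , v) ≢ (0 , suc m) → T (keep (u , v)) →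
                     key m (u , v) ≡ (u , v) → φ² bs (u , v) ≢ φ² bs (0 , suc m)
          not-base {u} {v} f∈ v≤ ne kp eq eqφ with u ≤? W
          ... | no ¬u≤ = <-irrefl (sym (cong proj₁ eqφ)) (W<φ z≤n (≰⇒> ¬u≤))
          ... | yes u≤ with proj₂ (edge-ok (kept-edge f∈ v≤ ne u≤ (subst (λ k → T (not (k ∈ᵇ lost c))) eq kp)))
          ...   | inj₁ h = <-irrefl (trans (sym (φ-0 bs)) (sym (cong proj₁ eqφ))) h
          ...   | inj₂ h = <-irrefl (cong proj₂ eqφ) (<-≤-trans h φm₀≤φm)

          -- The first ends of edges leaving across (0 , 1 + m).
          data Start : ℕ → Set where
            zero  : Start 0
            local : ∀ {i} → (i , 0) ∈ keptOuts c → Start i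
            deep  : ∀ {u} → m₀ < u → Start u

          -- Far ends lie beyond all merged vertices and keep distinct images, so two edges leaving
          -- across the base can be identified only if their starts are.
          start-inj : ∀ {u x} → Start u → Start x → φ bs u ≡ φ bs x → u ≡ x
          start-inj zero      zero      eq = refl
          start-inj zero      (local q) eq = ⊥-elim (<-irrefl (trans (sym (φ-0 bs)) eq) (proj₁ (out-ok q)))
          start-inj zero      (deep q)  eq = ⊥-elim (<-irrefl (trans (sym (φ-0 bs)) eq) (φ-beyond q))
          start-inj (local p) zero      eq = ⊥-elim (<-irrefl (trans (sym (φ-0 bs)) (sym eq)) (proj₁ (out-ok p)))
          start-inj (local p) (local q) eq = inj-out p q eq
          start-inj (local p) (deep q)  eq = ⊥-elim (<-irrefl eq (<-≤-trans (proj₂ (out-ok p)) (φ-mono bs q)))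
          start-inj (deep p)  zero      eq = ⊥-elim (<-irrefl (trans (sym (φ-0 bs)) (sym eq)) (φ-beyond p))
          start-inj (deep p)  (local q) eq = ⊥-elim (<-irrefl (sym eq) (<-≤-trans (proj₂ (out-ok q)) (φ-mono bs p)))
          start-inj (deep p)  (deep q)  eq = φ-inj bs (≤-trans len′ p) (≤-trans len′ q) eq

          data Shape : Edge → Set where
            base   : Shape (0 , suc m)
            inside : ∀ {u v} → v ≤ suc m → (u , v) ≢ (0 , suc m) → key m (u , v) ≡ (u , v) → Shape (u , v)
            cut    : ∀ {u v} → suc m < v → Start u → Shape (u , v)

          shape : ∀ {f} → f ∈ G → T (keep f) → Shape f
          shape {f} f∈ kp with key m f in eq | view m f
          ... | _ | base                  = base
          ... | _ | inside v≤ ne          = inside v≤ ne eq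
          ... | _ | far m<v (inj₁ refl)   = cut m<v zero
          ... | _ | far m<v (inj₂ m<u)    = cut m<v (deep (≤-<-trans m₀≤m m<u))
          ... | _ | out {u} p q m<v with u ≤? m₀
          ...   | yes u≤ = cut m<v (local (kept-out p u≤ kp))
          ...   | no ¬u≤ = cut m<v (deep (≰⇒> ¬u≤))

          top : ∀ {v y} → v ≤ suc m → suc m < y → φ bs v ≢ φ bs y
          top v≤ y> eq = <-irrefl eq (φ-strict bs len″ v≤ y>)

          inj : ∀ {e f} → e ∈ G → T (keep e) → f ∈ G → T (keep f) → Shape e → Shape f → φ² bs e ≡ φ² bs f → e ≡ f
          inj e∈ ke f∈ kf base           base          eq = refl
          inj e∈ ke f∈ kf base           (inside a b k) eq = ⊥-elim (not-base f∈ a b kf k (sym eq))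
          inj e∈ ke f∈ kf (inside a b k) base          eq = ⊥-elim (not-base e∈ a b ke k eq)
          inj e∈ ke f∈ kf base           (cut y> _)    eq = ⊥-elim (top ≤-refl y> (cong proj₂ eq))
          inj e∈ ke f∈ kf (cut v> _)     base          eq = ⊥-elim (top ≤-refl v> (sym (cong proj₂ eq)))
          inj e∈ ke f∈ kf (inside a _ _) (cut y> _)    eq = ⊥-elim (top a y> (cong proj₂ eq))
          inj e∈ ke f∈ kf (cut v> _)     (inside a _ _) eq = ⊥-elim (top a v> (sym (cong proj₂ eq)))
          inj e∈ ke f∈ kf (cut v> s)     (cut y> t)    eq = cong₂ _,_ (start-inj s t (cong proj₁ eq))
            (φ-inj bs (≤-trans len″ (<⇒≤ v>)) (≤-trans len″ (<⇒≤ y>)) (cong proj₂ eq))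
          inj {u , v} {x , y} e∈ ke f∈ kf (inside a ne k) (inside b ne′ k′) eq with u ≤? W | x ≤? W
          ... | yes p | yes q = inj-edge (kept-edge e∈ a ne p (subst (λ k → T (not (k ∈ᵇ lost c))) k ke))
                                         (kept-edge f∈ b ne′ q (subst (λ k → T (not (k ∈ᵇ lost c))) k′ kf)) eq
          ... | yes p | no q  = ⊥-elim (<-irrefl (cong proj₁ eq) (W<φ p (≰⇒> q)))
          ... | no p  | yes q = ⊥-elim (<-irrefl (sym (cong proj₁ eq)) (W<φ q (≰⇒> p)))
          ... | no p  | no q  = cong₂ _,_ (φ-inj bs lu lx (cong proj₁ eq))
            (φ-inj bs (≤-trans lu (above e∈)) (≤-trans lx (above f∈)) (cong proj₂ eq))
            where
            lu = ≤-trans len (<⇒≤ (≰⇒> p))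
            lx = ≤-trans len (<⇒≤ (≰⇒> q))
            above : ∀ {i j} → (i , j) ∈ G → i ≤ j
            above h = ≤-trans (n≤1+n _) (≤-trans (n≤1+n _) (gap h))

        image-unique : Unique (map (φ² bs) K)
        image-unique = unique-map (φ² bs) (unique-filter (T? ∘ keep) (unique D)) λ d∈ e∈ eq →
          let d∈G , kd = K⁻ d∈ ; e∈G , ke = K⁻ e∈ in
          inj d∈G kd e∈G ke (shape d∈G kd) (shape e∈G ke) eq

        image-count : ∀ {f} → f ∈ G → count (cross (φ² bs f)) (map (φ² bs) K) ≤ count (λ g → keep g ∧ cross f g) G
        image-count {f} f∈ = ≤-trans (≤-reflexive (trans (count-map (cross (φ² bs f)) (φ² bs) K)
                                       (count-filter keep (cross (φ² bs f) ∘ φ² bs) G)))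
          (count-mono G λ {g} _ h → let a , b = ∧-elim {keep g} h in
            ∧-intro a (⇒cross (φ-cross bs (cross⇒ (φ² bs f) (φ² bs g) b))))

        image-drawing : Drawing N′ ℓ (map (φ² bs) K)
        image-drawing = record
          { unique    = image-unique
          ; diagonals = λ x∈ → let f , f∈ , eq = ∈-map⁻ (φ² bs) x∈ in subst (Diagonal N′) (sym eq) (image-diagonal f∈)
          ; light     = λ x∈ → let f , f∈ , eq = ∈-map⁻ (φ² bs) x∈ ; f∈G , _ = K⁻ f∈ in
              subst (λ x → count (cross x) (map (φ² bs) K) ≤ ℓ) (sym eq) (≤-trans (image-count f∈G)
                (≤-trans (count-mono G λ {g} _ h → proj₂ (∧-elim {keep g} h)) (light D f∈G)))
          }

        3≤N′ : 3 ≤ N′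
        3≤N′ = cancel-r (subst₂ _<_ refl N≡ (≤-<-trans (s≤s (s≤s (≤-trans r≤m₀ m₀≤m))) m+2<N))

        lost≤mass : count (not ∘ keep) G ≤ mass (_∈ᵇ lost c) V G
        lost≤mass = ≤-trans (count-mono G λ {g} _ → nn (key m g ∈ᵇ lost c))
          (mass-≥ (_∈ᵇ lost c) V G λ {f} f∈ h → ∈ᵇ⇒∈ V (all⇒ (lost c) (proj₁ ok₃) (∈ᵇ⇒∈ (lost c) h)))
          where
          nn : ∀ b → T (not (not b)) → T b
          nn true _ = tt

        0<r : 0 < r
        0<r = <ᵇ⇒< 0 r (proj₁ ok₀)

        lost-mass : at drops r < mass (_∈ᵇ lost c) V G
        lost-mass = +-cancelˡ-< (E N′) _ _ (begin-strict
          E N′ + at drops r             ≤⟨ drop N′ r 3≤N′ N≡ r≤m₀ ⟩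
          E N                           <⟨ large ⟩
          length G                      ≡⟨ length-split keep G ⟩
          count keep G + count (not ∘ keep) G
            ≡⟨ cong (_+ count (not ∘ keep) G) (trans (sym (length-filter keep G)) (sym (length-map (φ² bs) K))) ⟩
          length (map (φ² bs) K) + count (not ∘ keep) G
            ≤⟨ +-mono-≤ (smaller 3≤N′ (subst (N′ <_) (sym N≡) (m<m+n N′ 0<r)) image-drawing) lost≤mass ⟩
          E N′ + mass (_∈ᵇ lost c) V G  ∎)
          where open ≤-Reasoning

        contraction-sat : Satisfied valAt (contractionConstraint c)
        contraction-sat = atLeast-sat (_∈ᵇ lost c) _ lost-mass

      private
        edge-sat : ∀ {k} → k ∈ edgeKeys → Satisfied valAt (atMostℓ k (crossed k))
        edge-sat {k} k∈ = atMostℓ-sat k (crossed k) (go (proj₂ (∈-filter⁻ (T? ∘ isEdge) {xs = V} k∈)))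
          where
          go : T (isEdge k) → ∀ {e f} → e ∈ G → f ∈ G → key m e ≡ k → T (crossed k (key m f)) → Interleaved e f
          go h {e} {f} e∈′ f∈ refl cr with key m e | view m e
          ... | _ | base = ⊥-elim h
          ... | _ | out _ _ _ = ⊥-elim h
          ... | _ | far _ _ = ⊥-elim h
          ... | _ | inside {u} {v} v≤ ne with key m f | view m f
          ...   | _ | base with cross⇒ (u , v) (0 , 1) cr
          ...     | after () _ _
          ...     | before a (s≤s b) _ = ⊥-elim (<⇒≱ a b)
          go h {e} {f} e∈′ f∈ refl cr | _ | inside v≤ ne | _ | inside {v = zero} _ _ with () ← gap f∈
          go h {e} {f} e∈′ f∈ refl cr | _ | inside {u} {v} v≤ ne | _ | inside {x} {suc y} _ _ = cross⇒ (u , v) (x , suc y) cr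
          go h {e} {f} e∈′ f∈ refl cr | _ | inside {u} v≤ ne | _ | out {x} p q m<y =
            let a , b = ∧-elim {u <ᵇ x} cr in after (<ᵇ⇒< _ _ a) (<ᵇ⇒< _ _ b) (≤-<-trans v≤ m<y)
          go h {e} {f} e∈′ f∈ refl cr | _ | inside {u} v≤ ne | _ | far _ _ = ⊥-elim cr

        out-sat : ∀ {k} → k ∈ outKeys → Satisfied valAt (atMostℓ k (over (proj₁ k)))
        out-sat {k} k∈ = atMostℓ-sat k (over (proj₁ k)) (go (proj₂ (∈-filter⁻ (T? ∘ isOut) {xs = V} k∈)))
          where
          go : T (isOut k) → ∀ {e f} → e ∈ G → f ∈ G → key m e ≡ k → T (over (proj₁ k) (key m f)) → Interleaved e f
          go h {e} {f} e∈′ f∈ refl cr with key m e | view m e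
          ... | _ | base = ⊥-elim h
          ... | _ | far _ _ = ⊥-elim h
          ... | _ | inside {u} {suc v} _ _ = ⊥-elim (proj₂ (∧-elim {0 <ᵇ u} h))
          ... | _ | inside {u} {zero} _ _ with () ← gap e∈′
          go h {e} {f} e∈′ f∈ refl cr | _ | out {u} p q m<v with key m f | view m f
          ...   | _ | base = before p (s≤s q) m<v
          ...   | _ | out {x} _ _ _ with () ← proj₂ (∧-elim {x <ᵇ u} cr)
          ...   | _ | far _ _ with () ← proj₂ (∧-elim {0 <ᵇ u} cr)
          go h {e} {f} e∈′ f∈ refl cr | _ | out {u} p q m<v | _ | inside {x} {y} y≤ _
            with ∨-elim {y ≡ᵇ 1} cr
          ... | inj₂ c = let a , b = ∧-elim {x <ᵇ u} c in before (<ᵇ⇒< _ _ a) (<ᵇ⇒< _ _ b) (≤-<-trans y≤ m<v)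
          ... | inj₁ c with refl ← ≡ᵇ⇒≡ y 1 c with s≤s () ← gap f∈

        total-sat : Satisfied valAt (atMostℓ (0 , 1) isOut)
        total-sat = atMostℓ-sat (0 , 1) isOut go
          where
          go : ∀ {e f} → e ∈ G → f ∈ G → key m e ≡ (0 , 1) → T (isOut (key m f)) → Interleaved e f
          go {e} e∈′ f∈ eq h with key m e | view m e
          go e∈′ f∈ refl h | _ | base = out-crosses-base f∈ h
          go e∈′ f∈ refl h | _ | inside _ _ with s≤s () ← gap e∈′

        key-base : key m (0 , suc m) ≡ (0 , 1)
        key-base with key m (0 , suc m) | view m (0 , suc m)
        ... | _ | base          = refl
        ... | _ | inside _ ne   = ⊥-elim (ne refl)
        ... | _ | out () _ _
        ... | _ | far p _       = ⊥-elim (<-irrefl refl p)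

        base-sat : Satisfied valAt (atLeast (_== (0 , 1)) 1)
        base-sat = atLeast-sat (_== (0 , 1)) 1 (≤-trans
          (∈⇒count-pos (λ f → key m f == (0 , 1)) e∈ (≡⇒== {key m (0 , suc m)} key-base))
          (mass-≥ (_== (0 , 1)) V G λ {f} _ h → subst (_∈ V) (sym (==⇒≡ {key m f} h)) base∈V))

        contractions-sat : ∀ cs → T (all valid cs) → All (Satisfied valAt) (map contractionConstraint cs)
        contractions-sat []       _ = []
        contractions-sat (c ∷ cs) h = let a , b = ∧-elim {valid c} h in
          Contract.contraction-sat c a ∷ contractions-sat cs b

        bounded : ∀ V′ i → (∀ {k} → k ∈ V′ → k ∈ V) → (∀ j → valAt (j + i) ≡ at (map val V′) j) →
                  Bounded valAt i (map dom V′)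
        bounded []       i h eq = tt
        bounded (k ∷ V′) i h eq = ≤-trans (≤-reflexive (eq 0)) (val≤dom (h (here refl)))
          , bounded V′ (suc i) (h ∘ there) (λ j → trans (cong valAt (+-suc j i)) (eq (suc j)))

        not-hopeless : ∀ cs → T (all valid cs) → ¬ T (any hopeless cs)
        not-hopeless (c ∷ cs) ok h with ∧-elim {valid c} ok | ∨-elim {hopeless c} h
        ... | a , b | inj₁ p = <⇒≱ (Contract.lost-mass c a) (≤-trans (mass-≤-capacity (_∈ᵇ lost c)) (≤ᵇ⇒≤ _ _ p))
        ... | a , b | inj₂ p = not-hopeless cs b p

      impossible : ∀ cs extra → T (all valid cs) → All (Satisfied valAt) extra →
                   T (any hopeless cs ∨ refute 0 doms (lowers cs ++ extra) uppers) → ⊥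
      impossible cs extra ok ex h with ∨-elim {any hopeless cs} h
      ... | inj₁ p = not-hopeless cs ok p
      ... | inj₂ p = refute-sound valAt 0 doms (lowers cs ++ extra) uppers p
        (bounded V 0 (λ z → z) λ j → cong valAt (+-identityʳ j))
        (All-++⁺ (base-sat ∷ contractions-sat cs ok) ex)
        (total-sat ∷ All-++⁺ (All-map⁺ (All.tabulate edge-sat)) (All-map⁺ (All.tabulate out-sat)))

      module Replace (m≡m₀ : m ≡ m₀) (W≡ : W ≡ suc m₀) (ρ : Replacement) (whole : Contraction)
                     (ok : T (replaceable ρ whole)) where
        ps = present ρ
        c  = shrink ρ
        A  = inserted ρ
        pat = pattern-value ps
        private
          ok₁ = ∧-elim {valid c} ok
          ok₂ = ∧-elim {valid whole} (proj₂ ok₁)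
          ok₃ = ∧-elim {uniqueᵇ A} (proj₂ ok₂)
          ok₄ = ∧-elim {all (valid-insert (merge c)) A} (proj₂ ok₃)
          ok₅ = ∧-elim {all (_∈ᵇ lost c) edgeKeys} (proj₂ ok₄)
          ok₆ = ∧-elim {all (λ a → count (cross a) A + Σ[ V ] (λ k → when ((k ∈ᵇ keptOuts c) ∧ spans (merge c) k a) (pat k)) ≤ᵇ ℓ) A} (proj₂ ok₅)
          ok₇ = ∧-elim {all (λ k → (pat k ≡ᵇ 0)
           ∨ (count (spans (merge c) k) A ≤ᵇ Σ[ V ] (λ x → when (isEdge x ∧ over (proj₁ k) x) (pat x)))) (keptOuts c)} (proj₂ ok₆)
          ok₈ = ∧-elim {Σ[ V ] (λ k → when (k ∈ᵇ lost c) (pat k)) ≤ᵇ length A + at drops (merged (merge c))} (proj₂ ok₇)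

        open Contract c (proj₁ ok₁)

        module _ (below : ∀ {k} → k ∈ V → val k ≤ pat k) where

          Σ-tight : ∀ {f g : Key → ℕ} V′ → (∀ {k} → k ∈ V′ → f k ≤ g k) → Σ[ V′ ] g ≤ Σ[ V′ ] f →
                    ∀ {k} → k ∈ V′ → f k ≡ g k
          Σ-tight {f} {g} (k ∷ V′) le h k′∈ = pick k′∈
            where
            rest : Σ[ V′ ] g ≤ Σ[ V′ ] f
            rest = +-cancelˡ-≤ (g k) _ _ (≤-trans h (+-monoˡ-≤ _ (le (here refl))))
            head : g k ≤ f k
            head = +-cancelʳ-≤ (Σ[ V′ ] g) _ _ (≤-trans h (+-monoʳ-≤ (f k) (Σ-mono V′ (le ∘ there))))
            pick : ∀ {k′} → k′ ∈ k ∷ V′ → f k′ ≡ g k′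
            pick (here refl) = ≤-antisym (le (here refl)) head
            pick (there k∈)  = Σ-tight V′ (le ∘ there) rest k∈

          when-≤ : ∀ b x → when b x ≤ x
          when-≤ true  x = ≤-refl
          when-≤ false x = z≤n

          -- The contraction `whole` has to lose at least as many edges as the pattern has
          -- altogether, so values bounded by the pattern fall short of it nowhere.
          exact : ∀ {k} → k ∈ V → val k ≡ pat k
          exact = Σ-tight V below (≤-trans (≤ᵇ⇒≤ _ _ (proj₂ ok₈)) (≤-trans
            (Contract.lost-mass whole (proj₁ ok₂)) (Σ-mono V λ {k} _ → when-≤ (k ∈ᵇ lost whole) (val k))))

          mass-exact : ∀ P → mass P V G ≡ Σ[ V ] (λ k → when (P k) (pat k))
          mass-exact P = ≤-antisym (Σ-mono V λ k∈ → ≤-reflexive (cong (when (P _)) (exact k∈)))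
                                   (Σ-mono V λ k∈ → ≤-reflexive (cong (when (P _)) (sym (exact k∈))))

          φm : φ bs (suc m₀) ≡ φ bs (suc m)
          φm = cong (λ z → φ bs (suc z)) (sym m≡m₀)

          no-inside : ∀ {u v} → (u , v) ∈ G → v ≤ suc m → (u , v) ≢ (0 , suc m) → T ((u , v) ∈ᵇ lost c)
          no-inside {u} {v} f∈ v≤ ne = all⇒ edgeKeys (proj₁ ok₅) (∈-filter⁺ (T? ∘ isEdge)
            (complete f∈ v≤ ne (≤-trans (≤-trans (n≤1+n u) (≤-trans (n≤1+n _) (gap f∈)))
              (≤-trans v≤ (≤-reflexive (trans (cong suc m≡m₀) (sym W≡))))))
            (≤⇒≤ᵇ (≤-trans (s≤s (s≤s z≤n)) (gap f∈))))

          insert-ok : ∀ {a b} → (a , b) ∈ A → 2 + a ≤ b × b ≤ φ bs (suc m) × (a , b) ≢ (0 , φ bs (suc m))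
          insert-ok {a} {b} a∈ = let p , q = ∧-elim {2 + a ≤ᵇ b} (all⇒ A (proj₁ ok₄) a∈)
                                     r , s = ∧-elim {b ≤ᵇ φ bs (suc m₀)} q in
            ≤ᵇ⇒≤ _ _ p , subst (b ≤_) φm (≤ᵇ⇒≤ _ _ r)
            , λ eq → not-elim s (≡⇒== {a , b} (trans eq (cong (0 ,_) (sym φm))))

          above : ∀ {v} → suc m < v → φ bs (suc m) < φ bs v
          above = φ-strict bs len″ ≤-refl

          disjoint : ∀ {x} → ¬ (x ∈ A × x ∈ map (φ² bs) K)
          disjoint {x} (x∈A , x∈K) with ∈-map⁻ (φ² bs) x∈K
          ... | f , f∈ , refl with K⁻ f∈
          ... | f∈G , kp with key m f | view m f
          ... | _ | base = proj₂ (proj₂ (insert-ok x∈A)) (cong (_, φ bs (suc m)) (φ-0 bs))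
          ... | _ | inside v≤ ne = not-elim kp (no-inside f∈G v≤ ne)
          ... | _ | out _ _ m<v = <⇒≱ (above m<v) (proj₁ (proj₂ (insert-ok x∈A)))
          ... | _ | far m<v _ = <⇒≱ (above m<v) (proj₁ (proj₂ (insert-ok x∈A)))

          -- Inserted edges stay within the image of the base, and the old inside edges are gone, so
          -- only edges leaving across the base can cross them.
          inserted-cross : ∀ {a f} → a ∈ A → f ∈ G → T (keep f) → Interleaved a (φ² bs f) →
                           T ((key m f ∈ᵇ keptOuts c) ∧ spans bs (key m f) a)
          inserted-cross {a , b} {f} a∈ f∈G kp cr with key m f | view m f | insert-ok a∈
          ... | _ | inside v≤ ne | _ = ⊥-elim (not-elim kp (no-inside f∈G v≤ ne))
          inserted-cross a∈ f∈G kp (after p _ _) | _ | base | _ = ⊥-elim (<⇒≱ p (subst (_≤ _) (sym (φ-0 bs)) z≤n))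
          inserted-cross a∈ f∈G kp (before _ _ p) | _ | base | _ , b≤ , _ = ⊥-elim (<⇒≱ p b≤)
          inserted-cross a∈ f∈G kp (before _ _ p) | _ | out _ _ m<v | _ , b≤ , _ = ⊥-elim (<⇒≱ (above m<v) (≤-trans (<⇒≤ p) b≤))
          inserted-cross a∈ f∈G kp (before _ _ p) | _ | far m<v _ | _ , b≤ , _ = ⊥-elim (<⇒≱ (above m<v) (≤-trans (<⇒≤ p) b≤))
          inserted-cross a∈ f∈G kp (after p _ _) | _ | far _ (inj₁ refl) | _ = ⊥-elim (<⇒≱ p (subst (_≤ _) (sym (φ-0 bs)) z≤n))
          inserted-cross a∈ f∈G kp (after _ p _) | _ | far _ (inj₂ m<u) | _ , b≤ , _ = ⊥-elim (<⇒≱ p (≤-trans b≤ (φ-mono bs m<u)))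
          inserted-cross a∈ f∈G kp (after p q _) | _ | out 0<u u≤m _ | _ =
            ∧-intro (∈⇒∈ᵇ (kept-out 0<u (subst (_ ≤_) m≡m₀ u≤m) kp)) (∧-intro (<⇒<ᵇ p) (<⇒<ᵇ q))

          light-inserted : ∀ {a} → a ∈ A → count (cross a) (A ++ map (φ² bs) K) ≤ ℓ
          light-inserted {a} a∈ = begin
            count (cross a) (A ++ map (φ² bs) K)
              ≡⟨ count-++ (cross a) A ⟩
            count (cross a) A + count (cross a) (map (φ² bs) K)
              ≡⟨ cong (count (cross a) A +_) (trans (count-map (cross a) (φ² bs) K) (count-filter keep (cross a ∘ φ² bs) G)) ⟩
            count (cross a) A + count (λ f → keep f ∧ cross a (φ² bs f)) G
              ≤⟨ +-monoʳ-≤ (count (cross a) A) (count-mono G λ {f} f∈ h → let p , q = ∧-elim {keep f} h in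
                   inserted-cross a∈ f∈ p (cross⇒ a (φ² bs f) q)) ⟩
            count (cross a) A + count (P ∘ key m) G
              ≤⟨ +-monoʳ-≤ (count (cross a) A) (mass-≥ P V G λ {f} _ h →
                   proj₁ (∈-filter⁻ (T? ∘ (λ k → isOut k ∧ not (k ∈ᵇ lost c))) {xs = V}
                     (∈ᵇ⇒∈ (keptOuts c) (proj₁ (∧-elim {key m f ∈ᵇ keptOuts c} h))))) ⟩
            count (cross a) A + mass P V G
              ≡⟨ cong (count (cross a) A +_) (mass-exact P) ⟩
            count (cross a) A + Σ[ V ] (λ k → when (P k) (pat k))
              ≤⟨ ≤ᵇ⇒≤ _ _ (all⇒ A (proj₁ ok₆) a∈) ⟩
            ℓ ∎
            where
            open ≤-Reasoning
            P : Key → Bool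
            P k = (k ∈ᵇ keptOuts c) ∧ spans bs k a

          -- The removed inside edges made room for the inserted ones.
          room : ∀ {f} → f ∈ G → T (keep f) →
                 count (cross (φ² bs f)) A ≤ count (λ g → not (keep g) ∧ cross f g) G
          room {f} f∈ kp with key m f in eq | view m f
          ... | _ | inside v≤ ne = ⊥-elim (not-elim kp (no-inside f∈ v≤ ne))
          ... | _ | base = ≤-trans (≤-reflexive (count-zero _ A λ {a} a∈ h →
                  miss (proj₁ (proj₂ (insert-ok a∈))) (cross⇒ (φ² bs (0 , suc m)) a h))) z≤n
            where
            miss : ∀ {a} → proj₂ a ≤ φ bs (suc m) → ¬ Interleaved (φ² bs (0 , suc m)) a
            miss b≤ (after _ _ p)  = <⇒≱ p b≤
            miss b≤ (before p _ _) = <⇒≱ p (subst (_≤ _) (sym (φ-0 bs)) z≤n)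
          ... | _ | far {u} {v} m<v side = ≤-trans (≤-reflexive (count-zero _ A λ {a} a∈ h →
                  miss side (proj₁ (proj₂ (insert-ok a∈))) (cross⇒ (φ² bs (u , v)) a h))) z≤n
            where
            miss : ∀ {a} → u ≡ 0 ⊎ m < u → proj₂ a ≤ φ bs (suc m) → ¬ Interleaved (φ² bs (u , v)) a
            miss _           b≤ (after _ _ p)  = <⇒≱ (above m<v) (≤-trans (<⇒≤ p) b≤)
            miss (inj₁ refl) b≤ (before p _ _) = <⇒≱ p (subst (_≤ _) (sym (φ-0 bs)) z≤n)
            miss (inj₂ m<u)  b≤ (before _ p _) = <⇒≱ p (≤-trans b≤ (φ-mono bs m<u))
          ... | _ | out {u} {v} 0<u u≤m m<v = begin
            count (cross (φ² bs (u , v))) A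
              ≤⟨ count-mono A (λ {a} a∈ h → under (proj₁ (proj₂ (insert-ok a∈))) (cross⇒ (φ² bs (u , v)) a h)) ⟩
            count (spans bs (u , 0)) A
              ≤⟨ enough ⟩
            Σ[ V ] (λ x → when (Q x) (pat x))
              ≡⟨ sym (mass-exact Q) ⟩
            mass Q V G
              ≤⟨ mass-≤ Q V G V-unique ⟩
            count (Q ∘ key m) G
              ≤⟨ count-mono G (λ {g} g∈ h → gone g g∈ h) ⟩
            count (λ g → not (keep g) ∧ cross (u , v) g) G ∎
            where
            open ≤-Reasoning
            Q : Key → Bool
            Q x = isEdge x ∧ over u x
            u∈ : (u , 0) ∈ keptOuts c
            u∈ = kept-out 0<u (subst (u ≤_) m≡m₀ u≤m) kp
            under : ∀ {a} → proj₂ a ≤ φ bs (suc m) → Interleaved (φ² bs (u , v)) a → T (spans bs (u , 0) a)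
            under b≤ (after _ _ p)  = ⊥-elim (<⇒≱ (above m<v) (≤-trans (<⇒≤ p) b≤))
            under b≤ (before p q _) = ∧-intro (<⇒<ᵇ p) (<⇒<ᵇ q)
            u∈V : (u , 0) ∈ V
            u∈V = complete-out 0<u (subst (u ≤_) m≡m₀ u≤m)
            enough : count (spans bs (u , 0)) A ≤ Σ[ V ] (λ x → when (Q x) (pat x))
            enough with ∨-elim {pat (u , 0) ≡ᵇ 0} (all⇒ (keptOuts c) (proj₁ ok₇) u∈)
            ... | inj₂ h = ≤ᵇ⇒≤ _ _ h
            ... | inj₁ h = ⊥-elim (<-irrefl (sym (trans (exact u∈V) (≡ᵇ⇒≡ _ 0 h)))
                             (∈⇒count-pos (λ g → key m g == (u , 0)) f∈ (≡⇒== {key m (u , v)} eq)))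
            gone : ∀ g → g ∈ G → T (Q (key m g)) → T (not (keep g) ∧ cross (u , v) g)
            gone g g∈ h with key m g | view m g
            ... | _ | base      = ⊥-elim h
            ... | _ | out _ _ _ = ⊥-elim h
            ... | _ | far _ _   = ⊥-elim h
            ... | _ | inside {x} {y} y≤ ne with ∧-elim {isEdge (x , y)} h
            ...   | h₁ , h₂ with ∨-elim {y ≡ᵇ 1} h₂
            ...     | inj₁ y1 with refl ← ≡ᵇ⇒≡ y 1 y1 = ⊥-elim h₁
            ...     | inj₂ z = let a , b = ∧-elim {x <ᵇ u} z in
              ∧-intro (not-intro λ k → not-elim k (no-inside g∈ y≤ ne))
                      (⇒cross (before (<ᵇ⇒< _ _ a) (<ᵇ⇒< _ _ b) (≤-<-trans y≤ m<v)))

          replaced : Drawing N′ ℓ (A ++ map (φ² bs) K)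
          replaced = record
            { unique    = unique-++ (uniqueᵇ⇒ A (proj₁ ok₃)) image-unique disjoint
            ; diagonals = diag
            ; light     = lt
            }
            where
            diag : ∀ {x} → x ∈ A ++ map (φ² bs) K → Diagonal N′ x
            diag x∈ with ∈-++⁻ A x∈
            ... | inj₁ a∈ = let p , q , _ = insert-ok a∈ in
                  p , ≤-<-trans q (<⇒≤ φ-top) , inj₂ (≤-<-trans (s≤s q) φ-top)
            ... | inj₂ i∈ = diagonals image-drawing i∈
            lt : ∀ {x} → x ∈ A ++ map (φ² bs) K → count (cross x) (A ++ map (φ² bs) K) ≤ ℓ
            lt x∈ with ∈-++⁻ A x∈
            ... | inj₁ a∈ = light-inserted a∈
            ... | inj₂ i∈ with f , f∈ , refl ← ∈-map⁻ (φ² bs) i∈ with f∈G , kp ← K⁻ f∈ = begin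
              count (cross (φ² bs f)) (A ++ map (φ² bs) K)
                ≡⟨ count-++ (cross (φ² bs f)) A ⟩
              count (cross (φ² bs f)) A + count (cross (φ² bs f)) (map (φ² bs) K)
                ≤⟨ +-mono-≤ (room f∈G kp) (image-count f∈G) ⟩
              count (λ g → not (keep g) ∧ cross f g) G + count (λ g → keep g ∧ cross f g) G
                ≡⟨ +-comm (count (λ g → not (keep g) ∧ cross f g) G) _ ⟩
              count (λ g → keep g ∧ cross f g) G + count (λ g → not (keep g) ∧ cross f g) G
                ≡⟨ sym (count-split keep (cross f) G) ⟩
              count (cross f) G
                ≤⟨ light D f∈G ⟩
              ℓ ∎
              where open ≤-Reasoning

          -- The replaced drawing has r vertices fewer but at most `at drops r` edges fewer, so it
          -- violates the induction hypothesis.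
          absurd : ⊥
          absurd = <-irrefl refl (begin-strict
            E N                                    <⟨ large ⟩
            length G                               ≡⟨ length-split keep G ⟩
            count keep G + count (not ∘ keep) G
              ≤⟨ +-mono-≤ (≤-reflexive (trans (sym (length-filter keep G)) (sym (length-map (φ² bs) K))))
                   (≤-trans lost≤mass (≤-trans (≤-reflexive (mass-exact (_∈ᵇ lost c))) (≤ᵇ⇒≤ _ _ (proj₁ ok₈)))) ⟩
            length (map (φ² bs) K) + (length A + at drops r)
              ≡⟨ trans (sym (+-assoc (length (map (φ² bs) K)) _ _)) (cong (_+ at drops r) (trans (+-comm (length (map (φ² bs) K)) _) (sym (length-++ A)))) ⟩
            length (A ++ map (φ² bs) K) + at drops r
              ≤⟨ +-monoˡ-≤ (at drops r) (smaller 3≤N′ (subst (N′ <_) (sym N≡) (m<m+n N′ 0<r)) replaced) ⟩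
            E N′ + at drops r                      ≤⟨ drop N′ r 3≤N′ N≡ r≤m₀ ⟩
            E N                                    ∎)
            where open ≤-Reasoning

        -- Since `absurd` excludes all values bounded by the pattern, some value exceeds it. This
        -- charges for small values, so in the search it joins the constraints of `lowers`.
        exceeds-sat : Satisfied valAt (exceeds ps)
        exceeds-sat = compile-sat _ _ _ (go (all (λ k → val k ≤ᵇ pat k) V) refl)
          where
          rel : Key → Bool
          rel k = not ((k ∈ᵇ ps) ∧ not (isOut k))
          fee : Key → ℕ
          fee k = when (rel k) (𝟙 (val k ≤ᵇ pat k))
          fee-≤ : ∀ b n → n ≤ 1 → when b n ≤ 𝟙 b
          fee-≤ true  n h = h
          fee-≤ false n h = z≤n
          𝟙-≤ : ∀ b → 𝟙 b ≤ 1
          𝟙-≤ true  = ≤-refl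
          𝟙-≤ false = z≤n
          Σ-≤ : ∀ V′ → Σ[ V′ ] fee ≤ count rel V′
          Σ-≤ []       = z≤n
          Σ-≤ (k ∷ V′) = +-mono-≤ (fee-≤ (rel k) _ (𝟙-≤ _)) (Σ-≤ V′)
          -- A key that is not charged for has its value at most 1, as in the pattern.
          free-≤ : ∀ {k} → k ∈ V → T (not (rel k)) → val k ≤ pat k
          free-≤ {zero , zero} k∈ h = ⊥-elim (all⇒ V (proj₁ wf₂) k∈)
          free-≤ {suc a , zero} k∈ h with (suc a , 0) ∈ᵇ ps
          ... | true  = ⊥-elim h
          ... | false = ⊥-elim h
          free-≤ {a , suc b} k∈ h with (a , suc b) ∈ᵇ ps
          ... | true  = val≤dom k∈
          ... | false = ⊥-elim h
          strict : ∀ V′ → (∀ {k} → k ∈ V′ → k ∈ V) → ¬ T (all (λ k → val k ≤ᵇ pat k) V′) → Σ[ V′ ] fee < count rel V′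
          strict []       _  h = ⊥-elim (h tt)
          strict (k ∷ V′) in-V h with val k ≤ᵇ pat k in eq
          ... | true  = ≤-trans (≤-reflexive (sym (+-suc (when (rel k) 1) _)))
                          (+-mono-≤ (fee-≤ (rel k) 1 ≤-refl) (strict V′ (in-V ∘ there) h))
          ... | false with rel k in eq′
          ...   | true  = s≤s (Σ-≤ V′)
          ...   | false = ⊥-elim (subst T eq (≤⇒≤ᵇ (free-≤ (in-V (here refl)) (subst (T ∘ not) (sym eq′) tt))))
          go : ∀ b → all (λ k → val k ≤ᵇ pat k) V ≡ b → Σ[ V ] fee ≤ count rel V ∸ 1
          go true  eq = ⊥-elim (absurd λ {k} k∈ → ≤ᵇ⇒≤ (val k) (pat k) (all⇒ V (subst T (sym eq) tt) k∈))
          go false eq = <⇒≤pred′ (strict V (λ z → z) λ h → subst T eq h)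
            where
            <⇒≤pred′ : ∀ {x y} → x < y → x ≤ y ∸ 1
            <⇒≤pred′ (s≤s h) = h

      replacements-sat : m ≡ m₀ → W ≡ suc m₀ → ∀ ρs whole → T (all (λ ρ → replaceable ρ whole) ρs) →
                         All (Satisfied valAt) (map (exceeds ∘ present) ρs)
      replacements-sat m≡ W≡ []       whole h = []
      replacements-sat m≡ W≡ (ρ ∷ ρs) whole h = let a , b = ∧-elim {replaceable ρ whole} h in
        Replace.exceeds-sat m≡ W≡ ρ whole a ∷ replacements-sat m≡ W≡ ρs whole b

-- Compact certificates for windows.

module Certificates where

  open Counting
  open Drawings
  open Windows
  open import Data.Bool.Base using (Bool; true; false; T; _∧_; _∨_; not; if_then_else_)
  open import Data.List.Base using (List; []; _∷_; _++_; map; length; filterᵇ; applyDownFrom; concatMap; upTo; replicate)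
  open import Data.Nat.Base
  open import Data.Product.Base using (_×_; _,_; proj₁; proj₂)
  open import Data.Bool.ListAction using (all; any)
  open import Data.Unit.Base using (tt)
  open import Data.Nat.Properties
  open import Data.Sum.Base using (inj₁; inj₂)
  open import Data.Empty using (⊥; ⊥-elim)
  open import Function.Base using (_∘_)
  open import Data.List.Membership.Propositional using (_∈_)
  open import Data.List.Relation.Unary.All using ([])
  open import Relation.Binary.PropositionalEquality

  -- The decimal digits of n, at most ten of them.
  digits : ℕ → List ℕ
  digits n = go 10 n []
    where
    go : ℕ → ℕ → List ℕ → List ℕ
    go zero    _       ds = ds
    go (suc _) zero    ds = ds
    go (suc f) (suc n) ds = go f (suc n / 10) (suc n % 10 ∷ ds)

  mergeBlocks : List ℕ → List Bool
  mergeBlocks []           = []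
  mergeBlocks (s ∷ [])     = replicate (s ∸ 1) true
  mergeBlocks (s ∷ ss)     = replicate (s ∸ 1) true ++ false ∷ mergeBlocks ss

  module _ (Wd : Window) where
    open Window Wd

    -- The edges whose images are not diagonals or are also images of later keys.
    clashes : List Bool → List Key → List Key
    clashes bs []       = []
    clashes bs (k ∷ ks) =
      if isEdge k ∧ ((proj₂ (φ² bs k) <ᵇ 2 + proj₁ (φ² bs k)) ∨ (φ² bs k ∈ᵇ ((0 , φ bs (suc m₀)) ∷ map (φ² bs) (filterᵇ isEdge ks))))
      then k ∷ clashes bs ks else clashes bs ks

    -- The digits of blocks are the sizes of the blocks of vertices merged, those of
    -- outs the vertices whose edges leaving the window are given up.
    fromBlocks : ℕ × ℕ → Contraction
    fromBlocks (blocks , outs) = contraction bs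
      (map (_, 0) (digits outs) ++ (if φ bs (suc m₀) <ᵇ 2 then (0 , 1) ∷ [] else []) ++ clashes bs V)
      where bs = mergeBlocks (digits blocks)

  -- Keys are ordered by first vertex, so that the constraints near vertex 0 are decided early in
  -- the search. An open window also lists the edges that start in it and may end beyond, since a
  -- contraction can move their starts.
  closedKeys openKeys : ℕ → ℕ → List Key
  openKeys g m = (0 , 1) ∷ concatMap (λ u →
    (if u <ᵇ m then (suc u , 0) ∷ [] else []) ++ applyDownFrom (λ d → u , 2 + d + u) (g ∸ 1)) (upTo (suc m))
  closedKeys g m = filterᵇ (λ k → proj₂ k ≤ᵇ suc m) (openKeys g m)

  closedWindow openWindow : ℕ → ℕ → List ℕ → ℕ → Window
  closedWindow ℓ g ds m = record { ℓ = ℓ ; m₀ = m ; W = suc m ; V = closedKeys g m ; drops = ds }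
  openWindow   ℓ g ds m = record { ℓ = ℓ ; m₀ = m ; W = m ; V = openKeys g m ; drops = ds }

  below : ℕ → (ℕ → Bool) → Bool
  below zero    p = true
  below (suc n) p = p n ∧ below n p

  below⇒ : ∀ n p → T (below n p) → ∀ {i} → i < n → T (p i)
  below⇒ (suc n) p h {i} (s≤s i≤n) with m≤n⇒m<n∨m≡n i≤n
  ... | inj₁ i<n  = below⇒ n p (proj₂ (∧-elim {p n} h)) i<n
  ... | inj₂ refl = proj₁ (∧-elim {p n} h)

  T⇒≡ : ∀ {b} → T b → b ≡ true
  T⇒≡ {true} _ = refl

  -- A two-digit number ab stands for the pair (a , b).
  pair : ℕ → Edge
  pair n = n / 10 , n % 10

  module Certificate (Wd : Window) (g : ℕ) (isClosed : Bool) where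
    open Window Wd
    open Machine Wd

    -- The replacement removing the vertex i.
    toReplacement : List ℕ × ℕ × List ℕ → Replacement
    toReplacement (ps , i , as) = replacement (map pair ps)
      (contraction (replicate (i ∸ 1) false ++ true ∷ []) ((i , 0) ∷ edgeKeys)) (map pair as)

    -- The second alternative covers edges ending beyond a closed window; no inside edge does so.
    listed : ℕ → ℕ → Bool
    listed u d = ((u , 2 + d + u) ∈ᵇ V) ∨ (isClosed ∧ (suc m₀ <ᵇ 2 + d + u))

    allListed : ℕ → Bool
    allListed u = below (g ∸ 1) (listed u)

    hasAll : Bool
    hasAll = below (suc W) allListed ∧ below m₀ λ i → (suc i , 0) ∈ᵇ V

    certified : List (ℕ × ℕ) → List (List ℕ × ℕ × List ℕ) → ℕ × ℕ → Bool
    certified bs rs whole = wellFormed ∧ (hasAll ∧ (all valid cs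
      ∧ (all (λ ρ → replaceable ρ (fromBlocks Wd whole)) ρs
      ∧ (any hopeless cs ∨ refute 0 doms (lowers cs ++ map (exceeds ∘ present) ρs) uppers))))
      where
      cs = map (fromBlocks Wd) bs
      ρs = map toReplacement rs

    module _
      (E : ℕ → ℕ) {N m : ℕ} {G : List Edge} (D : Drawing N ℓ G)
      (e∈ : (0 , suc m) ∈ G) (m₀≤m : m₀ ≤ m) (if-closed : isClosed ≡ true → m ≡ m₀ × W ≡ suc m₀)
      (1≤g : 1 ≤ g)
      (short : ∀ {u v} → (u , v) ∈ G → v ≤ suc m → (u , v) ≢ (0 , suc m) → v ≤ g + u)
      (smaller : ∀ {N′ G′} → 3 ≤ N′ → N′ < N → Drawing N′ ℓ G′ → length G′ ≤ E N′)
      (drop : ∀ N′ r → 3 ≤ N′ → N ≡ N′ + r → r ≤ m₀ → E N′ + at drops r ≤ E N)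
      (large : E N < length G)
      where

      private
        complete : T hasAll → ∀ {u v} → (u , v) ∈ G → v ≤ suc m → (u , v) ≢ (0 , suc m) → u ≤ W → (u , v) ∈ V
        complete h {u} {v} f∈ v≤ ne u≤ = subst (λ z → (u , z) ∈ V) v≡ found
          where
          d : ℕ
          d = v ∸ (2 + u)
          v≡ : 2 + d + u ≡ v
          v≡ = trans (cong (2 +_) (+-comm d u)) (m+[n∸m]≡n (proj₁ (diagonals D f∈)))
          d< : d < g ∸ 1
          d< = +-cancelʳ-≤ u _ _ (s≤s⁻¹ (≤-trans (≤-reflexive v≡) (≤-trans (short f∈ v≤ ne)
                 (≤-reflexive (cong (_+ u) (sym (m+[n∸m]≡n 1≤g)))))))
          found : (u , 2 + d + u) ∈ V
          found with ∨-elim {(u , 2 + d + u) ∈ᵇ V} (below⇒ (g ∸ 1) (listed u) (below⇒ (suc W) allListed (proj₁ (∧-elim h)) (s≤s u≤)) d<)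
          ... | inj₁ p = ∈ᵇ⇒∈ V p
          ... | inj₂ p = ⊥-elim (<⇒≱ (<ᵇ⇒< (suc m₀) _ (proj₂ (∧-elim {isClosed} p)))
                    (subst₂ _≤_ (sym v≡) (cong suc (proj₁ (if-closed (T⇒≡ (proj₁ (∧-elim {isClosed} p)))))) v≤))

        complete-out : T hasAll → ∀ {i} → 0 < i → i ≤ m₀ → (i , 0) ∈ V
        complete-out h {suc i} _ i< = ∈ᵇ⇒∈ V (below⇒ m₀ _
          (proj₂ (∧-elim {below (suc W) allListed} h)) i<)

      excluded-closed : isClosed ≡ true → ∀ bs rs whole → certified bs rs whole ≡ true → ⊥
      excluded-closed c bs rs whole eq = impossible cs _ ok₃
        (replacements-sat (proj₁ (if-closed c)) (proj₂ (if-closed c)) ρs (fromBlocks Wd whole) (proj₁ ok₄)) (proj₂ ok₄)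
        where
        cs = map (fromBlocks Wd) bs
        ρs = map toReplacement rs
        ok₁ = ∧-elim {wellFormed} (subst T (sym eq) tt)
        ok₂ = ∧-elim {hasAll} (proj₂ ok₁)
        ok₃ = proj₁ (∧-elim {all valid cs} (proj₂ ok₂))
        ok₄ = ∧-elim {all (λ ρ → replaceable ρ (fromBlocks Wd whole)) ρs} (proj₂ (∧-elim {all valid cs} (proj₂ ok₂)))
        open Sound E D e∈ m₀≤m (proj₁ ok₁) (complete (proj₁ ok₂)) (complete-out (proj₁ ok₂)) smaller drop large

      excluded : ∀ bs whole → certified bs [] whole ≡ true → ⊥
      excluded bs whole eq = impossible cs [] ok₃ [] (proj₂ ok₄)
        where
        cs = map (fromBlocks Wd) bs
        ok₁ = ∧-elim {wellFormed} (subst T (sym eq) tt)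
        ok₂ = ∧-elim {hasAll} (proj₂ ok₁)
        ok₃ = proj₁ (∧-elim {all valid cs} (proj₂ ok₂))
        ok₄ = ∧-elim {true} (proj₂ (∧-elim {all valid cs} (proj₂ ok₂)))
        open Sound E D e∈ m₀≤m (proj₁ ok₁) (complete (proj₁ ok₂)) (complete-out (proj₁ ok₂)) smaller drop large

  -- Entry r is the minimum of e (k + r) - e k over all k, where e is the corresponding maximum for
  -- 3 + k vertices.
  drops₀ drops₁ drops₂ drops₃ drops₄ : List ℕ
  drops₀ = 0 ∷ 1 ∷ 2 ∷ 3 ∷ 4 ∷ 5 ∷ 6 ∷ 7 ∷ 8 ∷ []
  drops₁ = 0 ∷ 1 ∷ 3 ∷ 4 ∷ 6 ∷ 7 ∷ 9 ∷ []
  drops₂ = 0 ∷ 1 ∷ 3 ∷ 6 ∷ 7 ∷ 9 ∷ 12 ∷ []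
  drops₃ = 0 ∷ 1 ∷ 3 ∷ 6 ∷ 9 ∷ 10 ∷ 12 ∷ 15 ∷ 18 ∷ []
  drops₄ = 0 ∷ 2 ∷ 4 ∷ 6 ∷ 10 ∷ 12 ∷ 14 ∷ 16 ∷ 20 ∷ 22 ∷ []

-- Induction on the number of vertices, and the small cases.

module Reduction where

  open Counting
  open Drawings
  open Windows
  open Certificates
  open import Data.Bool.Base using (Bool; true; false; T; _∧_; _∨_)
  open import Data.Bool.Properties using (T?)
  open import Data.Empty using (⊥; ⊥-elim)
  open import Data.Unit.Base using (tt)
  open import Data.List.Base using (List; []; _∷_; length; filterᵇ; upTo; cartesianProduct)
  open import Data.List.Membership.Propositional using (_∈_)
  open import Data.List.Relation.Unary.Any using (here)
  open import Data.List.Membership.Propositional.Properties using (∈-filter⁺; ∈-upTo⁺; ∈-cartesianProduct⁺)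
  open import Data.Nat.Base
  open import Data.Nat.Induction using (<-rec)
  open import Data.Nat.Properties
  open import Data.Product.Base using (_×_; _,_; proj₁; proj₂)
  open import Data.Sum.Base using (_⊎_; inj₁; inj₂)
  open import Function.Base using (_∘_)
  open import Relation.Binary.PropositionalEquality
  open import Relation.Nullary using (yes; no)

  -- The maximum for N = 3 + k vertices.

  e₀ e₁ e₂ e₃ e₄ : ℕ → ℕ
  e₀ k = k
  e₁ 0 = 0
  e₁ 1 = 2
  e₁ (suc (suc k)) = 3 + e₁ k
  e₂ 0 = 0
  e₂ 1 = 2
  e₂ 2 = 5
  e₂ (suc (suc (suc k))) = 6 + e₂ k
  e₃ 0 = 0
  e₃ 1 = 2
  e₃ 2 = 5
  e₃ 3 = 8
  e₃ (suc (suc (suc (suc k)))) = 9 + e₃ k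
  e₄ 0 = 0
  e₄ 1 = 2
  e₄ 2 = 5
  e₄ 3 = 9
  e₄ 4 = 11
  e₄ 5 = 13
  e₄ (suc (suc (suc (suc (suc (suc k)))))) = 10 + e₄ (suc (suc k))

  -- No window needs r above 9. Entries past the end of `ds` read as 0 and demand only monotonicity.
  DropsBy : (ℕ → ℕ) → List ℕ → ℕ → Set
  DropsBy e ds k = ∀ r → r < 10 → e k + at ds r ≤ e (k + r)

  private
    drops-base : ∀ e ds k → T (below 10 λ r → e k + at ds r ≤ᵇ e (k + r)) → DropsBy e ds k
    drops-base e ds k h r r< = ≤ᵇ⇒≤ _ _ (below⇒ 10 (λ r → e k + at ds r ≤ᵇ e (k + r)) h r<)

  dropsBy₀ : ∀ k → DropsBy e₀ drops₀ k
  dropsBy₀ zero    = drops-base e₀ drops₀ 0 tt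
  dropsBy₀ (suc k) r r< = +-monoʳ-≤ 1 (dropsBy₀ k r r<)

  dropsBy₁ : ∀ k → DropsBy e₁ drops₁ k
  dropsBy₁ 0 = drops-base e₁ drops₁ 0 tt
  dropsBy₁ 1 = drops-base e₁ drops₁ 1 tt
  dropsBy₁ (suc (suc k)) r r< = +-monoʳ-≤ 3 (dropsBy₁ k r r<)

  dropsBy₂ : ∀ k → DropsBy e₂ drops₂ k
  dropsBy₂ 0 = drops-base e₂ drops₂ 0 tt
  dropsBy₂ 1 = drops-base e₂ drops₂ 1 tt
  dropsBy₂ 2 = drops-base e₂ drops₂ 2 tt
  dropsBy₂ (suc (suc (suc k))) r r< = +-monoʳ-≤ 6 (dropsBy₂ k r r<)

  dropsBy₃ : ∀ k → DropsBy e₃ drops₃ k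
  dropsBy₃ 0 = drops-base e₃ drops₃ 0 tt
  dropsBy₃ 1 = drops-base e₃ drops₃ 1 tt
  dropsBy₃ 2 = drops-base e₃ drops₃ 2 tt
  dropsBy₃ 3 = drops-base e₃ drops₃ 3 tt
  dropsBy₃ (suc (suc (suc (suc k)))) r r< = +-monoʳ-≤ 9 (dropsBy₃ k r r<)

  dropsBy₄ : ∀ k → DropsBy e₄ drops₄ k
  dropsBy₄ 0 = drops-base e₄ drops₄ 0 tt
  dropsBy₄ 1 = drops-base e₄ drops₄ 1 tt
  dropsBy₄ 2 = drops-base e₄ drops₄ 2 tt
  dropsBy₄ 3 = drops-base e₄ drops₄ 3 tt
  dropsBy₄ 4 = drops-base e₄ drops₄ 4 tt
  dropsBy₄ 5 = drops-base e₄ drops₄ 5 tt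
  dropsBy₄ (suc (suc (suc (suc (suc (suc k)))))) r r< = +-monoʳ-≤ 10 (dropsBy₄ (suc (suc k)) r r<)

  AtMost : ℕ → (ℕ → ℕ) → ℕ → Set
  AtMost ℓ e N = ∀ {G} → Drawing N ℓ G → length G ≤ e (N ∸ 3)

  Smaller : ℕ → (ℕ → ℕ) → ℕ → Set
  Smaller ℓ e N = ∀ {N′} → 3 ≤ N′ → N′ < N → AtMost ℓ e N′

  Short : ℕ → ℕ → List Edge → Set
  Short M m G = ∀ {u v} → (u , v) ∈ G → v ≤ suc m → (u , v) ≢ (0 , suc m) → v ≤ M + u

  Excludes : ℕ → (ℕ → ℕ) → ℕ → ℕ → Set
  Excludes ℓ e M N = ∀ {m G} → M ≤ m → Drawing N ℓ G → (0 , suc m) ∈ G → Short M m G →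
                     e (N ∸ 3) < length G → ⊥

  central : ℕ → ℕ → Edge → Bool
  central N M (u , v) = (2 + u ≤ᵇ v) ∧ (((0 <ᵇ u) ∨ (suc v <ᵇ N)) ∧ ((v ≤ᵇ M + u) ∧ (N + u ≤ᵇ M + v)))

  -- The diagonals with at most M - 1 vertices on either side.
  candidates : ℕ → ℕ → List Edge
  candidates N M = filterᵇ (central N M) (cartesianProduct (upTo N) (upTo N))

  drop-from : ∀ {e ds N} → (∀ k → DropsBy e ds k) → ∀ {m₀} → m₀ < 10 →
              ∀ N′ r → 3 ≤ N′ → N ≡ N′ + r → r ≤ m₀ → e (N′ ∸ 3) + at ds r ≤ e (N ∸ 3)
  drop-from db m₀< (suc (suc (suc k))) r (s≤s (s≤s (s≤s _))) refl r≤ = db k r (≤-<-trans r≤ m₀<)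

  module _ {ℓ : ℕ} {e : ℕ → ℕ} {N : ℕ} where

    exclude-closed : ∀ M ds {m G} →
      (∀ N′ r → 3 ≤ N′ → N ≡ N′ + r → r ≤ m → e (N′ ∸ 3) + at ds r ≤ e (N ∸ 3)) → 1 ≤ M →
      ∀ bs rs whole → Certificate.certified (closedWindow ℓ M ds m) M true bs rs whole ≡ true →
      Smaller ℓ e N → Drawing N ℓ G → (0 , suc m) ∈ G → Short M m G → e (N ∸ 3) < length G → ⊥
    exclude-closed M ds drop 1≤M bs rs whole eq smaller D e∈ short large =
      Certificate.excluded-closed (closedWindow ℓ M ds _) M true (λ n → e (n ∸ 3)) D e∈ ≤-refl (λ _ → refl , refl)
        1≤M short (λ a b → smaller a b) drop large refl bs rs whole eq

    exclude-open : ∀ M ds m₀ {m G} → m₀ ≤ m →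
      (∀ N′ r → 3 ≤ N′ → N ≡ N′ + r → r ≤ m₀ → e (N′ ∸ 3) + at ds r ≤ e (N ∸ 3)) → 1 ≤ M →
      ∀ bs → Certificate.certified (openWindow ℓ M ds m₀) M false bs [] (0 , 0) ≡ true →
      Smaller ℓ e N → Drawing N ℓ G → (0 , suc m) ∈ G → Short M m G → e (N ∸ 3) < length G → ⊥
    exclude-open M ds m₀ m₀≤m drop 1≤M bs eq smaller D e∈ short large =
      Certificate.excluded (openWindow ℓ M ds m₀) M false (λ n → e (n ∸ 3)) D e∈ m₀≤m (λ ())
        1≤M short (λ a b → smaller a b) drop large bs (0 , 0) eq

    module _ (M : ℕ) (excludes : Excludes ℓ e M N) where

      -- A long edge inside (0 , 1 + m) is rotated into its place.
      side-bound : ∀ m {G} → M ≤ m → Drawing N ℓ G → (0 , suc m) ∈ G → e (N ∸ 3) < length G → ⊥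
      side-bound = <-rec _ λ m rec {G} M≤m D e∈ large → excludes M≤m D e∈
        (λ {u} {v} f∈ v≤ ne → short m rec D large f∈ v≤ ne) large
        where
        short : ∀ m → (∀ {m′} → m′ < m → ∀ {G} → M ≤ m′ → Drawing N ℓ G → (0 , suc m′) ∈ G → e (N ∸ 3) < length G → ⊥) →
                ∀ {G} → Drawing N ℓ G → e (N ∸ 3) < length G → Short M m G
        short m rec {G} D large {u} {v} f∈ v≤ ne with v ≤? M + u
        ... | yes p = p
        ... | no ¬p = ⊥-elim (rec m′<m M≤m′ (Rotated.drawing R) (Rotated.member R)
                        (subst (_ <_) (sym (Rotated.size-≡ R)) large))
          where
          m′ : ℕ
          m′ = v ∸ suc u
          u<v : u < v
          u<v = <⇒≤ (proj₁ (diagonals D f∈))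
          v≡ : v ≡ u + suc m′
          v≡ = trans (sym (m+[n∸m]≡n u<v)) (sym (+-suc u m′))
          M≤m′ : M ≤ m′
          M≤m′ = +-cancelʳ-≤ u _ _ (s≤s⁻¹ (≤-trans (≰⇒> ¬p)
                   (≤-reflexive (trans v≡ (trans (+-suc u m′) (cong suc (+-comm u m′)))))))
          m′≤m : m′ ≤ m
          m′≤m = ≤-trans (m≤n+m m′ u) (s≤s⁻¹ (≤-trans (≤-reflexive (sym (trans v≡ (+-suc u m′)))) v≤))
          m′<m : m′ < m
          m′<m with m≤n⇒m<n∨m≡n m′≤m
          ... | inj₁ h = h
          ... | inj₂ h = ⊥-elim (ne (cong₂ _,_ u≡0 (trans v≡ (trans (cong (_+ suc m′) u≡0) (cong suc h)))))
            where
            u≡0 : u ≡ 0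
            u≡0 = n≤0⇒n≡0 (+-cancelʳ-≤ m u 0 (s≤s⁻¹ (≤-trans (≤-reflexive
                    (trans (cong (λ z → suc (u + z)) (sym h)) (sym (trans v≡ (+-suc u m′))))) v≤)))
          R = rotate-down u (suc m′) D (subst (λ z → (u , z) ∈ G) v≡ f∈)

      -- Rotating the edge to start at 0 exposes one of its sides to `side-bound`, and flipping it
      -- exposes the other.
      both-sides : ∀ {G} → Drawing N ℓ G → e (N ∸ 3) < length G → ∀ {u v} → (u , v) ∈ G →
                   v ≤ M + u × N + u ≤ M + v
      both-sides {G} D large {u} {v} f∈ = one , two
        where
        d : ℕ
        d = v ∸ suc u
        u<v : u < v
        u<v = <⇒≤ (proj₁ (diagonals D f∈))
        v<N : v < N
        v<N = proj₁ (proj₂ (diagonals D f∈))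
        v≡ : v ≡ u + suc d
        v≡ = trans (sym (m+[n∸m]≡n u<v)) (sym (+-suc u d))
        R = rotate-down u (suc d) D (subst (λ z → (u , z) ∈ G) v≡ f∈)
        large′ = subst (e (N ∸ 3) <_) (sym (Rotated.size-≡ R)) large
        one : v ≤ M + u
        one with v ≤? M + u
        ... | yes p = p
        ... | no ¬p = ⊥-elim (side-bound d M≤d (Rotated.drawing R) (Rotated.member R) large′)
          where
          M≤d : M ≤ d
          M≤d = +-cancelʳ-≤ u _ _ (s≤s⁻¹ (≤-trans (≰⇒> ¬p)
                  (≤-reflexive (trans v≡ (trans (+-suc u d) (cong suc (+-comm u d)))))))
        d<N : suc d < N
        d<N = ≤-<-trans (≤-trans (m≤n+m (suc d) u) (≤-reflexive (sym v≡))) v<N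
        c : ℕ
        c = N ∸ suc (suc d)
        N≡ : N ≡ suc d + suc c
        N≡ = trans (sym (m+[n∸m]≡n d<N)) (cong suc (sym (+-suc d c)))
        R′ = rotate-flip (suc d) (suc c) N≡ (Rotated.drawing R) (Rotated.member R)
        two : N + u ≤ M + v
        two with M ≤? c
        ... | yes M≤c = ⊥-elim (side-bound c M≤c (Rotated.drawing R′) (Rotated.member R′)
                          (subst (e (N ∸ 3) <_) (sym (Rotated.size-≡ R′)) large′))
        ... | no ¬p = begin
          N + u                 ≡⟨ cong (_+ u) N≡ ⟩
          suc d + suc c + u     ≤⟨ +-monoˡ-≤ u (+-monoʳ-≤ (suc d) (≰⇒> ¬p)) ⟩
          suc d + M + u         ≡⟨ cong (_+ u) (+-comm (suc d) M) ⟩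
          M + suc d + u         ≡⟨ +-assoc M (suc d) u ⟩
          M + (suc d + u)       ≡⟨ cong (M +_) (trans (+-comm (suc d) u) (sym v≡)) ⟩
          M + v                 ∎
          where open ≤-Reasoning

      at-most : length (candidates N M) ≤ e (N ∸ 3) → AtMost ℓ e N
      at-most few {G} D with length G ≤? e (N ∸ 3)
      ... | yes p = p
      ... | no ¬p = ≤-trans (unique-⊆-length (unique D) sub) few
        where
        sub : ∀ {f} → f ∈ G → f ∈ candidates N M
        sub {u , v} f∈ with diagonals D f∈ | both-sides D (≰⇒> ¬p) f∈
        ... | gap , v<N , side | a , b = ∈-filter⁺ (T? ∘ central N M)
          (∈-cartesianProduct⁺ (∈-upTo⁺ (<-trans (<⇒≤ gap) v<N)) (∈-upTo⁺ v<N))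
          (∧-intro (≤⇒≤ᵇ gap) (∧-intro (sd side) (∧-intro (≤⇒≤ᵇ a) (≤⇒≤ᵇ b))))
          where
          sd : 0 < u ⊎ suc v < N → T ((0 <ᵇ u) ∨ (suc v <ᵇ N))
          sd (inj₁ h) = ∨-introˡ (<⇒<ᵇ h)
          sd (inj₂ h) = ∨-introʳ {0 <ᵇ u} (<⇒<ᵇ h)

      -- The two inequalities of `both-sides` add up to N ≤ 2M, so a drawing above the bound could
      -- have no edge at all.
      at-most-long : M + M < N → AtMost ℓ e N
      at-most-long M+M<N {[]}          D = z≤n
      at-most-long M+M<N {(u , v) ∷ G} D with length ((u , v) ∷ G) ≤? e (N ∸ 3)
      ... | yes p = p
      ... | no ¬p with both-sides D (≰⇒> ¬p) (here refl)
      ...   | a , b = ⊥-elim (<⇒≱ M+M<N (+-cancelʳ-≤ u N (M + M) (≤-trans b (≤-trans (+-monoʳ-≤ M a)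
                (≤-reflexive (sym (+-assoc M M u)))))))

  few : ℕ → (ℕ → ℕ) → ℕ → ℕ → Bool
  few M e exception N = (N ≡ᵇ exception) ∨ (length (candidates N M) ≤ᵇ e (N ∸ 3))

  -- For N up to 2M the candidates are counted. The exception is the one N at which they outnumber
  -- the maximum; the value 0 means that there is none and is settled by `none`.
  bound : ∀ {ℓ e} M exception → T (below (suc (M + M)) (few M e exception)) →
          (∀ {N} → Smaller ℓ e N → Excludes ℓ e M N) → (Smaller ℓ e exception → AtMost ℓ e exception) →
          ∀ N → AtMost ℓ e N
  bound {ℓ} {e} M exception few-ok excludes special = <-rec _ go
    where
    go : ∀ N → (∀ {N′} → N′ < N → AtMost ℓ e N′) → AtMost ℓ e N
    go N rec with N ≤? M + M
    ... | no ¬p = at-most-long {e = e} M (excludes λ _ → rec) (≰⇒> ¬p)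
    ... | yes p with ∨-elim {N ≡ᵇ exception} (below⇒ (suc (M + M)) (few M e exception) few-ok (s≤s p))
    ...   | inj₂ h = at-most {e = e} M (excludes λ _ → rec) (≤ᵇ⇒≤ _ _ h)
    ...   | inj₁ h with refl ← ≡ᵇ⇒≡ N exception h = special λ _ → rec

  base-fits : ∀ {N ℓ G m} → Drawing N ℓ G → (0 , suc m) ∈ G → suc (suc m) < N
  base-fits D e∈ with proj₂ (proj₂ (diagonals D e∈))
  ... | inj₂ h = h

-- The upper bounds for each ℓ, by certificates.

module UpperBounds where

  open Counting
  open Drawings
  open Windows
  open Certificates
  open Reduction
  open import Data.Bool.Base using (true; false)
  open import Data.Empty using (⊥-elim)
  open import Data.Unit.Base using (tt)
  open import Data.List.Base using (List; []; _∷_)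
  open import Data.Nat.Base
  open import Data.Nat.Properties
  open import Data.Product.Base using (_×_; _,_; proj₁; proj₂)
  open import Relation.Binary.PropositionalEquality
  open import Data.List.Relation.Unary.Any using (here)

  -- The contractions and replacements were found by a computer search.

  merges₀₋₁ : List (ℕ × ℕ)
  merges₀₋₁ =
    (21 , 1) ∷ []

  merges₀₋₂ : List (ℕ × ℕ)
  merges₀₋₂ =
    (21 , 1) ∷ []

  abstract
    certified₀₋₁ : Certificate.certified (closedWindow 0 1 drops₀ 1) 1 true merges₀₋₁ [] (0 , 0) ≡ true
    certified₀₋₁ = refl

    certified₀₋₂ : Certificate.certified (openWindow 0 1 drops₀ 2) 1 false merges₀₋₂ [] (0 , 0) ≡ true
    certified₀₋₂ = refl

  excludes₀ : ∀ {N} → Smaller 0 e₀ N → Excludes 0 e₀ 1 N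
  excludes₀ smaller {1} _ = exclude-closed {e = e₀} 1 drops₀ (drop-from {e₀} {drops₀} dropsBy₀ (≤ᵇ⇒≤ 2 10 tt)) (≤ᵇ⇒≤ 1 1 tt)
    merges₀₋₁ [] (0 , 0) certified₀₋₁ smaller
  excludes₀ smaller {m@(suc (suc m′))} _ = exclude-open {e = e₀} 1 drops₀ 2 (≤ᵇ⇒≤ 2 m tt) (drop-from {e₀} {drops₀} dropsBy₀ (≤ᵇ⇒≤ 3 10 tt)) (≤ᵇ⇒≤ 1 1 tt)
    merges₀₋₂ certified₀₋₂ smaller
  excludes₀ smaller {0} M≤m = ⊥-elim (<⇒≱ (≤ᵇ⇒≤ 1 1 tt) M≤m)

  -- As an example, `13` keeps 0 apart and merges 1, 2, 3, and `12` gives up the edges leaving from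
  -- 1 and 2. The whole window is lost, so it must hold more than 3 edges. But the base allows one
  -- leaving edge only, and that edge, already crossing the base, excludes (0 , 2) or (1 , 3); in
  -- either case at most 3 edges remain.
  merges₁₋₂ : List (ℕ × ℕ)
  merges₁₋₂ =
    (13 , 12) ∷ []

  merges₁₋₃ : List (ℕ × ℕ)
  merges₁₋₃ =
    (211 , 1) ∷ []

  abstract
    certified₁₋₂ : Certificate.certified (closedWindow 1 2 drops₁ 2) 2 true merges₁₋₂ [] (0 , 0) ≡ true
    certified₁₋₂ = refl

    certified₁₋₃ : Certificate.certified (openWindow 1 2 drops₁ 3) 2 false merges₁₋₃ [] (0 , 0) ≡ true
    certified₁₋₃ = refl

  excludes₁ : ∀ {N} → Smaller 1 e₁ N → Excludes 1 e₁ 2 N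
  excludes₁ smaller {2} _ = exclude-closed {e = e₁} 2 drops₁ (drop-from {e₁} {drops₁} dropsBy₁ (≤ᵇ⇒≤ 3 10 tt)) (≤ᵇ⇒≤ 1 2 tt)
    merges₁₋₂ [] (0 , 0) certified₁₋₂ smaller
  excludes₁ smaller {m@(suc (suc (suc m′)))} _ = exclude-open {e = e₁} 2 drops₁ 3 (≤ᵇ⇒≤ 3 m tt) (drop-from {e₁} {drops₁} dropsBy₁ (≤ᵇ⇒≤ 4 10 tt)) (≤ᵇ⇒≤ 1 2 tt)
    merges₁₋₃ certified₁₋₃ smaller
  excludes₁ smaller {0} M≤m = ⊥-elim (<⇒≱ (≤ᵇ⇒≤ 1 2 tt) M≤m)
  excludes₁ smaller {1} M≤m = ⊥-elim (<⇒≱ (≤ᵇ⇒≤ 2 2 tt) M≤m)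

  merges₂₋₃ : List (ℕ × ℕ)
  merges₂₋₃ =
    (14 , 123) ∷ (1211 , 2) ∷ (2111 , 1) ∷ []

  merges₂₋₄ : List (ℕ × ℕ)
  merges₂₋₄ =
    (141 , 123) ∷ (12111 , 2) ∷ (21111 , 1) ∷ (114 , 234) ∷ (12111 , 1) ∷ []

  merges₂₋₅ : List (ℕ × ℕ)
  merges₂₋₅ =
    (121111 , 2) ∷ (4111 , 123) ∷ (31111 , 12) ∷ (211111 , 1) ∷ []

  merges₂₋₆ : List (ℕ × ℕ)
  merges₂₋₆ =
    (121111 , 2) ∷ (4111 , 123) ∷ (31111 , 12) ∷ (211111 , 1) ∷ []

  abstract
    certified₂₋₃ : Certificate.certified (closedWindow 2 3 drops₂ 3) 3 true merges₂₋₃ [] (0 , 0) ≡ true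
    certified₂₋₃ = refl

    certified₂₋₄ : Certificate.certified (closedWindow 2 3 drops₂ 4) 3 true merges₂₋₄ [] (0 , 0) ≡ true
    certified₂₋₄ = refl

    certified₂₋₅ : Certificate.certified (closedWindow 2 3 drops₂ 5) 3 true merges₂₋₅ [] (0 , 0) ≡ true
    certified₂₋₅ = refl

    certified₂₋₆ : Certificate.certified (openWindow 2 3 drops₂ 6) 3 false merges₂₋₆ [] (0 , 0) ≡ true
    certified₂₋₆ = refl

  excludes₂ : ∀ {N} → Smaller 2 e₂ N → Excludes 2 e₂ 3 N
  excludes₂ smaller {3} _ = exclude-closed {e = e₂} 3 drops₂ (drop-from {e₂} {drops₂} dropsBy₂ (≤ᵇ⇒≤ 4 10 tt)) (≤ᵇ⇒≤ 1 3 tt)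
    merges₂₋₃ [] (0 , 0) certified₂₋₃ smaller
  excludes₂ smaller {4} _ = exclude-closed {e = e₂} 3 drops₂ (drop-from {e₂} {drops₂} dropsBy₂ (≤ᵇ⇒≤ 5 10 tt)) (≤ᵇ⇒≤ 1 3 tt)
    merges₂₋₄ [] (0 , 0) certified₂₋₄ smaller
  excludes₂ smaller {5} _ = exclude-closed {e = e₂} 3 drops₂ (drop-from {e₂} {drops₂} dropsBy₂ (≤ᵇ⇒≤ 6 10 tt)) (≤ᵇ⇒≤ 1 3 tt)
    merges₂₋₅ [] (0 , 0) certified₂₋₅ smaller
  excludes₂ smaller {m@(suc (suc (suc (suc (suc (suc m′))))))} _ = exclude-open {e = e₂} 3 drops₂ 6 (≤ᵇ⇒≤ 6 m tt) (drop-from {e₂} {drops₂} dropsBy₂ (≤ᵇ⇒≤ 7 10 tt)) (≤ᵇ⇒≤ 1 3 tt)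
    merges₂₋₆ certified₂₋₆ smaller
  excludes₂ smaller {0} M≤m = ⊥-elim (<⇒≱ (≤ᵇ⇒≤ 1 3 tt) M≤m)
  excludes₂ smaller {1} M≤m = ⊥-elim (<⇒≱ (≤ᵇ⇒≤ 2 3 tt) M≤m)
  excludes₂ smaller {2} M≤m = ⊥-elim (<⇒≱ (≤ᵇ⇒≤ 3 3 tt) M≤m)

  merges₃₋₄ : List (ℕ × ℕ)
  merges₃₋₄ =
    (15 , 1234) ∷ (141 , 123) ∷ (12111 , 2) ∷ (11211 , 3) ∷ (12111 , 1) ∷ (21111 , 1) ∷ (114 , 234) ∷ []

  merges₃₋₅ : List (ℕ × ℕ)
  merges₃₋₅ =
    (151 , 1234) ∷ (4111 , 123) ∷ (112111 , 3) ∷ (121111 , 2) ∷ (115 , 2345) ∷ (31111 , 12) ∷ (121111 , 1) ∷ (211111 , 1) ∷ []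

  merges₃₋₆ : List (ℕ × ℕ)
  merges₃₋₆ =
    (41111 , 123) ∷ (5111 , 1234) ∷ (1211111 , 2) ∷ (1121111 , 3) ∷ (1121111 , 2) ∷ (1151 , 2345) ∷ (1211111 , 1) ∷ (311111 , 12) ∷ (1331 , 1345) ∷ (2111111 , 1) ∷ (11114 , 456) ∷ []

  merges₃₋₇ : List (ℕ × ℕ)
  merges₃₋₇ =
    (411111 , 123) ∷ (141111 , 234) ∷ (51111 , 1234) ∷ (12111111 , 2) ∷ (15111 , 2345) ∷ (12111111 , 1) ∷ (3111111 , 12) ∷ (21111111 , 1) ∷ (15111 , 1345) ∷ []

  merges₃₋₈ : List (ℕ × ℕ)
  merges₃₋₈ =
    (411111 , 123) ∷ (51111 , 1234) ∷ (12111111 , 2) ∷ (12111111 , 1) ∷ (3111111 , 12) ∷ (15111 , 2345) ∷ (21111111 , 1) ∷ (15111 , 1345) ∷ []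

  abstract
    certified₃₋₄ : Certificate.certified (closedWindow 3 4 drops₃ 4) 4 true merges₃₋₄ [] (0 , 0) ≡ true
    certified₃₋₄ = refl

    certified₃₋₅ : Certificate.certified (closedWindow 3 4 drops₃ 5) 4 true merges₃₋₅ [] (0 , 0) ≡ true
    certified₃₋₅ = refl

    certified₃₋₆ : Certificate.certified (closedWindow 3 4 drops₃ 6) 4 true merges₃₋₆ [] (0 , 0) ≡ true
    certified₃₋₆ = refl

    certified₃₋₇ : Certificate.certified (closedWindow 3 4 drops₃ 7) 4 true merges₃₋₇ [] (0 , 0) ≡ true
    certified₃₋₇ = refl

    certified₃₋₈ : Certificate.certified (openWindow 3 4 drops₃ 8) 4 false merges₃₋₈ [] (0 , 0) ≡ true
    certified₃₋₈ = refl

  excludes₃ : ∀ {N} → Smaller 3 e₃ N → Excludes 3 e₃ 4 N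
  excludes₃ smaller {4} _ = exclude-closed {e = e₃} 4 drops₃ (drop-from {e₃} {drops₃} dropsBy₃ (≤ᵇ⇒≤ 5 10 tt)) (≤ᵇ⇒≤ 1 4 tt)
    merges₃₋₄ [] (0 , 0) certified₃₋₄ smaller
  excludes₃ smaller {5} _ = exclude-closed {e = e₃} 4 drops₃ (drop-from {e₃} {drops₃} dropsBy₃ (≤ᵇ⇒≤ 6 10 tt)) (≤ᵇ⇒≤ 1 4 tt)
    merges₃₋₅ [] (0 , 0) certified₃₋₅ smaller
  excludes₃ smaller {6} _ = exclude-closed {e = e₃} 4 drops₃ (drop-from {e₃} {drops₃} dropsBy₃ (≤ᵇ⇒≤ 7 10 tt)) (≤ᵇ⇒≤ 1 4 tt)
    merges₃₋₆ [] (0 , 0) certified₃₋₆ smaller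
  excludes₃ smaller {7} _ = exclude-closed {e = e₃} 4 drops₃ (drop-from {e₃} {drops₃} dropsBy₃ (≤ᵇ⇒≤ 8 10 tt)) (≤ᵇ⇒≤ 1 4 tt)
    merges₃₋₇ [] (0 , 0) certified₃₋₇ smaller
  excludes₃ smaller {m@(suc (suc (suc (suc (suc (suc (suc (suc m′))))))))} _ = exclude-open {e = e₃} 4 drops₃ 8 (≤ᵇ⇒≤ 8 m tt) (drop-from {e₃} {drops₃} dropsBy₃ (≤ᵇ⇒≤ 9 10 tt)) (≤ᵇ⇒≤ 1 4 tt)
    merges₃₋₈ certified₃₋₈ smaller
  excludes₃ smaller {0} M≤m = ⊥-elim (<⇒≱ (≤ᵇ⇒≤ 1 4 tt) M≤m)
  excludes₃ smaller {1} M≤m = ⊥-elim (<⇒≱ (≤ᵇ⇒≤ 2 4 tt) M≤m)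
  excludes₃ smaller {2} M≤m = ⊥-elim (<⇒≱ (≤ᵇ⇒≤ 3 4 tt) M≤m)
  excludes₃ smaller {3} M≤m = ⊥-elim (<⇒≱ (≤ᵇ⇒≤ 4 4 tt) M≤m)

  merges₄₋₅ : List (ℕ × ℕ)
  merges₄₋₅ =
    (151 , 1234) ∷ (112111 , 3) ∷ (115 , 2345) ∷ (112111 , 2) ∷ (111211 , 3) ∷ (121111 , 2) ∷ (111121 , 4) ∷ (111211 , 4) ∷ (121111 , 1) ∷ (211111 , 1) ∷ (142 , 5123) ∷ (16 , 12345) ∷ (124 , 3451) ∷ []

  merges₄₋₆ : List (ℕ × ℕ)
  merges₄₋₆ =
    (1112111 , 4) ∷ (1121111 , 3) ∷ (5111 , 1234) ∷ (1151 , 2345) ∷ (1121111 , 2) ∷ (1211111 , 2) ∷ (1111121 , 5) ∷ (1211111 , 1) ∷ (1115 , 3456) ∷ (2111111 , 1) ∷ []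

  merges₄₋₇ : List (ℕ × ℕ)
  merges₄₋₇ =
    (51111 , 1234) ∷ (11121111 , 4) ∷ (15111 , 2345) ∷ (11211111 , 3) ∷ (11211111 , 2) ∷ (12111111 , 2) ∷ (11121111 , 3) ∷ (42111 , 1235) ∷ (12111111 , 1) ∷ (11115 , 4567) ∷ (21111111 , 1) ∷ []

  merges₄₋₈ : List (ℕ × ℕ)
  merges₄₋₈ =
    (511111 , 1234) ∷ (151111 , 2345) ∷ (112111111 , 3) ∷ (111211111 , 4) ∷ (112111111 , 2) ∷ (121111111 , 2) ∷ (111211111 , 3) ∷ (421111 , 1235) ∷ (412111 , 1236) ∷ (121111111 , 1) ∷ (111115 , 5678) ∷ (4111111 , 123) ∷ (211111111 , 1) ∷ []

  merges₄₋₉ : List (ℕ × ℕ)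
  merges₄₋₉ =
    (511111 , 1234) ∷ (112111111 , 3) ∷ (151111 , 2345) ∷ (112111111 , 2) ∷ (121111111 , 2) ∷ (111211111 , 4) ∷ (421111 , 1235) ∷ (115111 , 3456) ∷ (121111111 , 1) ∷ (4111111 , 123) ∷ (111511 , 4567) ∷ (211111111 , 1) ∷ (112411 , 2567) ∷ []

  -- The keys present in a solution that contractions do not exclude, the vertex to
  -- be removed, and the inside edges to be inserted.
  replacements : List (List ℕ × ℕ × List ℕ)
  replacements =
    (1 ∷ 10 ∷ 20 ∷ 30 ∷ 50 ∷ 2 ∷ 13 ∷ 16 ∷ 24 ∷ 25 ∷ 35 ∷ 36 ∷ 46 ∷ [] , 4 , 2 ∷ 13 ∷ 15 ∷ 24 ∷ 25 ∷ 35 ∷ []) ∷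
    (1 ∷ 10 ∷ 20 ∷ 40 ∷ 50 ∷ 2 ∷ 13 ∷ 14 ∷ 16 ∷ 24 ∷ 25 ∷ 35 ∷ 46 ∷ [] , 3 , 2 ∷ 13 ∷ 14 ∷ 15 ∷ 24 ∷ 35 ∷ []) ∷
    (1 ∷ 10 ∷ 20 ∷ 40 ∷ 50 ∷ 2 ∷ 13 ∷ 14 ∷ 16 ∷ 24 ∷ 26 ∷ 35 ∷ 46 ∷ [] , 3 , 2 ∷ 13 ∷ 14 ∷ 15 ∷ 24 ∷ 35 ∷ []) ∷
    (1 ∷ 10 ∷ 20 ∷ 50 ∷ 2 ∷ 13 ∷ 15 ∷ 16 ∷ 24 ∷ 25 ∷ 35 ∷ 36 ∷ 46 ∷ [] , 3 , 2 ∷ 13 ∷ 14 ∷ 15 ∷ 24 ∷ 25 ∷ 35 ∷ []) ∷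
    (1 ∷ 10 ∷ 40 ∷ 50 ∷ 2 ∷ 3 ∷ 13 ∷ 14 ∷ 16 ∷ 24 ∷ 35 ∷ 36 ∷ 46 ∷ [] , 2 , 2 ∷ 3 ∷ 13 ∷ 14 ∷ 15 ∷ 24 ∷ 35 ∷ []) ∷
    (1 ∷ 10 ∷ 20 ∷ 40 ∷ 50 ∷ 2 ∷ 3 ∷ 13 ∷ 24 ∷ 26 ∷ 35 ∷ 36 ∷ 46 ∷ [] , 3 , 2 ∷ 3 ∷ 13 ∷ 24 ∷ 25 ∷ 35 ∷ []) ∷
    (1 ∷ 10 ∷ 20 ∷ 40 ∷ 50 ∷ 2 ∷ 3 ∷ 4 ∷ 13 ∷ 24 ∷ 35 ∷ 36 ∷ 46 ∷ [] , 3 , 2 ∷ 3 ∷ 4 ∷ 13 ∷ 24 ∷ 35 ∷ []) ∷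
    (1 ∷ 10 ∷ 50 ∷ 2 ∷ 5 ∷ 13 ∷ 14 ∷ 16 ∷ 24 ∷ 25 ∷ 26 ∷ 35 ∷ 46 ∷ [] , 2 , 2 ∷ 4 ∷ 13 ∷ 14 ∷ 15 ∷ 24 ∷ 25 ∷ 35 ∷ []) ∷
    (1 ∷ 10 ∷ 20 ∷ 40 ∷ 50 ∷ 2 ∷ 5 ∷ 13 ∷ 14 ∷ 24 ∷ 25 ∷ 35 ∷ 46 ∷ [] , 3 , 2 ∷ 4 ∷ 13 ∷ 14 ∷ 24 ∷ 35 ∷ []) ∷
    (1 ∷ 10 ∷ 30 ∷ 40 ∷ 50 ∷ 2 ∷ 3 ∷ 5 ∷ 13 ∷ 14 ∷ 24 ∷ 35 ∷ 46 ∷ [] , 2 , 2 ∷ 3 ∷ 4 ∷ 13 ∷ 24 ∷ 35 ∷ []) ∷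
    (1 ∷ 10 ∷ 40 ∷ 50 ∷ 2 ∷ 3 ∷ 5 ∷ 13 ∷ 14 ∷ 15 ∷ 24 ∷ 35 ∷ 46 ∷ [] , 2 , 2 ∷ 3 ∷ 4 ∷ 13 ∷ 14 ∷ 24 ∷ 35 ∷ []) ∷
    (1 ∷ 10 ∷ 50 ∷ 2 ∷ 3 ∷ 5 ∷ 13 ∷ 16 ∷ 24 ∷ 25 ∷ 35 ∷ 36 ∷ 46 ∷ [] , 2 , 2 ∷ 3 ∷ 4 ∷ 13 ∷ 14 ∷ 15 ∷ 24 ∷ 35 ∷ []) ∷
    (1 ∷ 10 ∷ 50 ∷ 2 ∷ 3 ∷ 5 ∷ 13 ∷ 14 ∷ 16 ∷ 24 ∷ 35 ∷ 36 ∷ 46 ∷ [] , 2 , 2 ∷ 3 ∷ 4 ∷ 13 ∷ 14 ∷ 15 ∷ 24 ∷ 35 ∷ []) ∷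
    (1 ∷ 10 ∷ 50 ∷ 2 ∷ 3 ∷ 5 ∷ 13 ∷ 15 ∷ 16 ∷ 24 ∷ 35 ∷ 36 ∷ 46 ∷ [] , 2 , 2 ∷ 3 ∷ 4 ∷ 13 ∷ 14 ∷ 15 ∷ 24 ∷ 35 ∷ []) ∷
    (1 ∷ 10 ∷ 20 ∷ 50 ∷ 2 ∷ 3 ∷ 5 ∷ 13 ∷ 24 ∷ 25 ∷ 35 ∷ 36 ∷ 46 ∷ [] , 3 , 2 ∷ 3 ∷ 4 ∷ 13 ∷ 24 ∷ 25 ∷ 35 ∷ []) ∷
    (1 ∷ 10 ∷ 50 ∷ 2 ∷ 4 ∷ 5 ∷ 13 ∷ 14 ∷ 16 ∷ 24 ∷ 25 ∷ 35 ∷ 46 ∷ [] , 2 , 2 ∷ 3 ∷ 4 ∷ 13 ∷ 14 ∷ 15 ∷ 24 ∷ 35 ∷ []) ∷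
    (1 ∷ 10 ∷ 20 ∷ 40 ∷ 50 ∷ 2 ∷ 4 ∷ 5 ∷ 13 ∷ 24 ∷ 25 ∷ 35 ∷ 46 ∷ [] , 3 , 2 ∷ 3 ∷ 4 ∷ 13 ∷ 24 ∷ 35 ∷ []) ∷ []

  abstract
    -- The contraction `(16 , 12345)` merges 1, ..., 6 and loses every edge of the window. Five
    -- vertices disappear, so at least 12 + 1 = 13 edges must, and 13 is the size of each pattern in
    -- `replacements`.
    certified₄₋₅ : Certificate.certified (closedWindow 4 5 drops₄ 5) 5 true merges₄₋₅ replacements (16 , 12345) ≡ true
    certified₄₋₅ = refl

    certified₄₋₆ : Certificate.certified (closedWindow 4 5 drops₄ 6) 5 true merges₄₋₆ [] (0 , 0) ≡ true
    certified₄₋₆ = refl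

    certified₄₋₇ : Certificate.certified (closedWindow 4 5 drops₄ 7) 5 true merges₄₋₇ [] (0 , 0) ≡ true
    certified₄₋₇ = refl

    certified₄₋₈ : Certificate.certified (closedWindow 4 5 drops₄ 8) 5 true merges₄₋₈ [] (0 , 0) ≡ true
    certified₄₋₈ = refl

    certified₄₋₉ : Certificate.certified (openWindow 4 5 drops₄ 9) 5 false merges₄₋₉ [] (0 , 0) ≡ true
    certified₄₋₉ = refl

  excludes₄ : ∀ {N} → Smaller 4 e₄ N → Excludes 4 e₄ 5 N
  excludes₄ smaller {5} _ = exclude-closed {e = e₄} 5 drops₄ (drop-from {e₄} {drops₄} dropsBy₄ (≤ᵇ⇒≤ 6 10 tt)) (≤ᵇ⇒≤ 1 5 tt)
    merges₄₋₅ replacements (16 , 12345) certified₄₋₅ smaller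
  excludes₄ smaller {6} _ = exclude-closed {e = e₄} 5 drops₄ (drop-from {e₄} {drops₄} dropsBy₄ (≤ᵇ⇒≤ 7 10 tt)) (≤ᵇ⇒≤ 1 5 tt)
    merges₄₋₆ [] (0 , 0) certified₄₋₆ smaller
  excludes₄ smaller {7} _ = exclude-closed {e = e₄} 5 drops₄ (drop-from {e₄} {drops₄} dropsBy₄ (≤ᵇ⇒≤ 8 10 tt)) (≤ᵇ⇒≤ 1 5 tt)
    merges₄₋₇ [] (0 , 0) certified₄₋₇ smaller
  excludes₄ smaller {8} _ = exclude-closed {e = e₄} 5 drops₄ (drop-from {e₄} {drops₄} dropsBy₄ (≤ᵇ⇒≤ 9 10 tt)) (≤ᵇ⇒≤ 1 5 tt)
    merges₄₋₈ [] (0 , 0) certified₄₋₈ smaller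
  excludes₄ smaller {m@(suc (suc (suc (suc (suc (suc (suc (suc (suc m′)))))))))} _ = exclude-open {e = e₄} 5 drops₄ 9 (≤ᵇ⇒≤ 9 m tt) (drop-from {e₄} {drops₄} dropsBy₄ (≤ᵇ⇒≤ 10 10 tt)) (≤ᵇ⇒≤ 1 5 tt)
    merges₄₋₉ certified₄₋₉ smaller
  excludes₄ smaller {0} M≤m = ⊥-elim (<⇒≱ (≤ᵇ⇒≤ 1 5 tt) M≤m)
  excludes₄ smaller {1} M≤m = ⊥-elim (<⇒≱ (≤ᵇ⇒≤ 2 5 tt) M≤m)
  excludes₄ smaller {2} M≤m = ⊥-elim (<⇒≱ (≤ᵇ⇒≤ 3 5 tt) M≤m)
  excludes₄ smaller {3} M≤m = ⊥-elim (<⇒≱ (≤ᵇ⇒≤ 4 5 tt) M≤m)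
  excludes₄ smaller {4} M≤m = ⊥-elim (<⇒≱ (≤ᵇ⇒≤ 5 5 tt) M≤m)

  merges₃₋₃ : List (ℕ × ℕ)
  merges₃₋₃ =
    (1211 , 2) ∷ (2111 , 1) ∷ []

  abstract
    certified₃₋₃ : Certificate.certified (closedWindow 3 3 (0 ∷ 3 ∷ 6 ∷ 8 ∷ []) 3) 3 true merges₃₋₃ [] (0 , 0) ≡ true
    certified₃₋₃ = refl

  -- With threshold 4 all nine diagonals of the hexagon are candidates, one more than the maximum 8.
  -- Threshold 3 leaves the three long ones, and a short diagonal then cuts off exactly m = 3
  -- vertices on its larger side. As N = 6 is fixed, the decreases 8 - 5, 8 - 2 and 8 - 0 are exact.
  special₃ : Smaller 3 e₃ 6 → AtMost 3 e₃ 6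
  special₃ smaller = at-most {e = e₃} 3 excludes (≤ᵇ⇒≤ _ _ tt)
    where
    drop : ∀ N′ r → 3 ≤ N′ → 6 ≡ N′ + r → r ≤ 3 → e₃ (N′ ∸ 3) + at (0 ∷ 3 ∷ 6 ∷ 8 ∷ []) r ≤ e₃ 3
    drop N′ 0 _ eq _ with refl ← +-cancelʳ-≡ 0 6 N′ eq = ≤ᵇ⇒≤ _ _ tt
    drop N′ 1 _ eq _ with refl ← +-cancelʳ-≡ 1 5 N′ eq = ≤ᵇ⇒≤ _ _ tt
    drop N′ 2 _ eq _ with refl ← +-cancelʳ-≡ 2 4 N′ eq = ≤ᵇ⇒≤ _ _ tt
    drop N′ 3 _ eq _ with refl ← +-cancelʳ-≡ 3 3 N′ eq = ≤ᵇ⇒≤ _ _ tt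
    drop N′ (suc (suc (suc (suc r)))) _ _ r≤ = ⊥-elim (<⇒≱ (m≤m+n 4 r) r≤)
    excludes : Excludes 3 e₃ 3 6
    excludes {m} M≤m D e∈ short large
      with refl ← ≤-antisym (s≤s⁻¹ (s≤s⁻¹ (s≤s⁻¹ (base-fits D e∈)))) M≤m =
      exclude-closed {e = e₃} 3 (0 ∷ 3 ∷ 6 ∷ 8 ∷ []) drop (≤ᵇ⇒≤ 1 3 tt) merges₃₋₃ [] (0 , 0) certified₃₋₃ smaller D e∈ short large

  merges₄₋₄ : List (ℕ × ℕ)
  merges₄₋₄ =
    (1131 , 23) ∷ (12111 , 2) ∷ (12111 , 1) ∷ (1311 , 23) ∷ (21111 , 1) ∷ (3111 , 12) ∷ (2121 , 13) ∷ (11112 , 4) ∷ (141 , 123) ∷ []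

  abstract
    certified₄₋₄ : Certificate.certified (closedWindow 4 4 (0 ∷ 2 ∷ 6 ∷ 9 ∷ 11 ∷ []) 4) 4 true merges₄₋₄ [] (0 , 0) ≡ true
    certified₄₋₄ = refl

  -- With threshold 5 all 14 diagonals of the heptagon are candidates, against the maximum 11.
  -- Threshold 4 leaves the seven long ones, and a short diagonal has m = 4. The exact decreases are
  -- 11 - 9, 11 - 5, 11 - 2 and 11 - 0.
  special₄ : Smaller 4 e₄ 7 → AtMost 4 e₄ 7
  special₄ smaller = at-most {e = e₄} 4 excludes (≤ᵇ⇒≤ _ _ tt)
    where
    drop : ∀ N′ r → 3 ≤ N′ → 7 ≡ N′ + r → r ≤ 4 → e₄ (N′ ∸ 3) + at (0 ∷ 2 ∷ 6 ∷ 9 ∷ 11 ∷ []) r ≤ e₄ 4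
    drop N′ 0 _ eq _ with refl ← +-cancelʳ-≡ 0 7 N′ eq = ≤ᵇ⇒≤ _ _ tt
    drop N′ 1 _ eq _ with refl ← +-cancelʳ-≡ 1 6 N′ eq = ≤ᵇ⇒≤ _ _ tt
    drop N′ 2 _ eq _ with refl ← +-cancelʳ-≡ 2 5 N′ eq = ≤ᵇ⇒≤ _ _ tt
    drop N′ 3 _ eq _ with refl ← +-cancelʳ-≡ 3 4 N′ eq = ≤ᵇ⇒≤ _ _ tt
    drop N′ 4 _ eq _ with refl ← +-cancelʳ-≡ 4 3 N′ eq = ≤ᵇ⇒≤ _ _ tt
    drop N′ (suc (suc (suc (suc (suc r))))) _ _ r≤ = ⊥-elim (<⇒≱ (m≤m+n 5 r) r≤)
    excludes : Excludes 4 e₄ 4 7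
    excludes {m} M≤m D e∈ short large
      with refl ← ≤-antisym (s≤s⁻¹ (s≤s⁻¹ (s≤s⁻¹ (base-fits D e∈)))) M≤m =
      exclude-closed {e = e₄} 4 (0 ∷ 2 ∷ 6 ∷ 9 ∷ 11 ∷ []) drop (≤ᵇ⇒≤ 1 4 tt) merges₄₋₄ [] (0 , 0) certified₄₋₄ smaller D e∈ short large

  none : ∀ {ℓ e} → AtMost ℓ e 0
  none {G = []}    D = z≤n
  none {G = f ∷ G} D with () ← proj₁ (proj₂ (diagonals D (here refl)))

  at-most₀ : ∀ N → AtMost 0 e₀ N
  at-most₀ = bound {e = e₀} 1 0 tt excludes₀ (λ _ {G} → none {e = e₀} {G})

  at-most₁ : ∀ N → AtMost 1 e₁ N
  at-most₁ = bound {e = e₁} 2 0 tt excludes₁ (λ _ {G} → none {e = e₁} {G})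

  at-most₂ : ∀ N → AtMost 2 e₂ N
  at-most₂ = bound {e = e₂} 3 0 tt excludes₂ (λ _ {G} → none {e = e₂} {G})

  at-most₃ : ∀ N → AtMost 3 e₃ N
  at-most₃ = bound {e = e₃} 4 6 tt excludes₃ special₃

  at-most₄ : ∀ N → AtMost 4 e₄ N
  at-most₄ = bound {e = e₄} 5 7 tt excludes₄ special₄

-- Optimal drawings by gluing.

module LowerBounds where

  open Counting
  open Drawings
  open Reduction using (e₀; e₁; e₂; e₃; e₄)
  open Certificates using (pair)
  open import Data.Bool.Base using (Bool; true; false; T; _∧_; _∨_; not)
  open import Data.Bool.ListAction using (all)
  open import Data.Empty using (⊥-elim)
  open import Data.Unit.Base using (tt)
  open import Data.List.Base using (List; []; _∷_; _++_; map; length)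
  open import Data.List.Properties using (length-map; length-++)
  open import Data.List.Membership.Propositional using (_∈_)
  open import Data.List.Membership.Propositional.Properties using (∈-++⁻; ∈-map⁻)
  open import Data.List.Relation.Unary.All as All using (All; []; _∷_)
  open import Data.List.Relation.Unary.Any using (here; there)
  open import Data.List.Relation.Unary.AllPairs using ([]; _∷_)
  open import Data.List.Relation.Unary.Unique.Propositional.Properties using () renaming (++⁺ to unique-++)
  open import Data.Nat.Base
  open import Data.Nat.Properties
  open import Data.Product.Base using (_×_; _,_; proj₁; proj₂; ∃-syntax)
  open import Data.Sum.Base using (_⊎_; inj₁; inj₂; map₂)
  open import Function.Base using (_∘_)
  open import Relation.Binary.PropositionalEquality
  open import Relation.Nullary using (¬_)

  diagonalᵇ : ℕ → Edge → Bool
  diagonalᵇ N (u , v) = (2 + u ≤ᵇ v) ∧ ((v <ᵇ N) ∧ ((0 <ᵇ u) ∨ (suc v <ᵇ N)))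

  drawingᵇ : ℕ → ℕ → List Edge → Bool
  drawingᵇ N ℓ G = uniqueᵇ G ∧ all (λ e → diagonalᵇ N e ∧ (count (cross e) G ≤ᵇ ℓ)) G

  drawingᵇ⇒ : ∀ N ℓ G → T (drawingᵇ N ℓ G) → Drawing N ℓ G
  drawingᵇ⇒ N ℓ G h = record
    { unique    = uniqueᵇ⇒ G (proj₁ (∧-elim h))
    ; diagonals = λ {e} e∈ → diag e (proj₁ (each e∈))
    ; light     = λ {e} e∈ → ≤ᵇ⇒≤ _ _ (proj₂ (each e∈))
    }
    where
    each : ∀ {e} → e ∈ G → T (diagonalᵇ N e) × T (count (cross e) G ≤ᵇ ℓ)
    each {e} e∈ = ∧-elim {diagonalᵇ N e} (all⇒ G (proj₂ (∧-elim {uniqueᵇ G} h)) e∈)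
    diag : ∀ e → T (diagonalᵇ N e) → Diagonal N e
    diag (u , v) h with ∧-elim {2 + u ≤ᵇ v} h
    ... | a , b with ∧-elim {v <ᵇ N} b
    ... | c , d with ∨-elim {0 <ᵇ u} d
    ... | inj₁ p = ≤ᵇ⇒≤ _ _ a , <ᵇ⇒< _ _ c , inj₁ (<ᵇ⇒< _ _ p)
    ... | inj₂ p = ≤ᵇ⇒≤ _ _ a , <ᵇ⇒< _ _ c , inj₂ (<ᵇ⇒< _ _ p)

  -- Two polygons glued along a side, which becomes a diagonal that is not crossed.
  module Glue {a b ℓ : ℕ} {G B : List Edge} (D : Drawing (2 + a) ℓ G) (D′ : Drawing (2 + b) ℓ B) (1≤a : 1 ≤ a) (1≤b : 1 ≤ b) where

    -- The side (0 , 1) of the second polygon is laid on the side (0 , suc a) of the first, and its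
    -- other vertices follow.
    ψ : ℕ → ℕ
    ψ zero    = 0
    ψ (suc j) = suc (a + j)

    ψ² : Edge → Edge
    ψ² (u , v) = ψ u , ψ v

    ψ-cancel : ∀ {u v} → ψ u < ψ v → u < v
    ψ-cancel {zero}  {suc v} _       = s≤s z≤n
    ψ-cancel {suc u} {suc v} (s≤s h) = s≤s (+-cancelˡ-< a u v h)

    ψ-inj : ∀ {u v} → ψ u ≡ ψ v → u ≡ v
    ψ-inj {zero}  {zero}  _  = refl
    ψ-inj {suc u} {suc v} eq = cong suc (+-cancelˡ-≡ a u v (suc-injective eq))

    ψ-end : ∀ {u v} → 2 + u ≤ v → suc a < ψ v
    ψ-end {v = suc zero} (s≤s ())
    ψ-end {u} {suc (suc v)} _ = s≤s (≤-trans (s≤s (m≤m+n a v)) (≤-reflexive (sym (+-suc a v))))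

    glued : List Edge
    glued = G ++ (0 , suc a) ∷ map ψ² B

    seam-free : ∀ {e} → e ∈ G → ¬ Interleaved e (0 , suc a)
    seam-free e∈ (before _ _ p) = <⇒≱ p (s≤s⁻¹ (proj₁ (proj₂ (diagonals D e∈))))

    apart : ∀ {e f} → e ∈ G → f ∈ B → ¬ Interleaved e (ψ² f)
    apart {f = zero , y}  e∈ f∈ (after () _ _)
    apart {f = suc x , y} e∈ f∈ (after _ p _) =
      <⇒≱ p (≤-trans (s≤s⁻¹ (proj₁ (proj₂ (diagonals D e∈)))) (s≤s (m≤m+n a x)))
    apart e∈ f∈ (before _ _ p) = <⇒≱ p (≤-trans (s≤s⁻¹ (proj₁ (proj₂ (diagonals D e∈))))
      (<⇒≤ (ψ-end (proj₁ (diagonals D′ f∈)))))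

    seam-free′ : ∀ {f} → f ∈ B → ¬ Interleaved (0 , suc a) (ψ² f)
    seam-free′ {zero , y}  f∈ (after () _ _)
    seam-free′ {suc x , y} f∈ (after _ p _) = <⇒≱ p (s≤s (m≤m+n a x))

    ψ-cross : ∀ {e f} → Interleaved (ψ² e) (ψ² f) → Interleaved e f
    ψ-cross {u , v} {x , y} (after p q r)  = after (ψ-cancel p) (ψ-cancel q) (ψ-cancel r)
    ψ-cross {u , v} {x , y} (before p q r) = before (ψ-cancel p) (ψ-cancel q) (ψ-cancel r)

    split : ∀ e → count (cross e) glued ≡ count (cross e) G + (𝟙 (cross e (0 , suc a)) + count (cross e ∘ ψ²) B)
    split e = trans (count-++ (cross e) G) (cong (λ z → count (cross e) G + (𝟙 (cross e (0 , suc a)) + z)) (count-map (cross e) ψ² B))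

    𝟙-zero : ∀ {x} → ¬ T x → 𝟙 x ≡ 0
    𝟙-zero {true}  h = ⊥-elim (h tt)
    𝟙-zero {false} h = refl

    glue : Drawing (2 + (a + b)) ℓ glued
    glue = record
      { unique = unique-++ (unique D) (All.tabulate seam∉ ∷ unique-map ψ² (unique D′)
                   λ _ _ eq → cong₂ _,_ (ψ-inj (cong proj₁ eq)) (ψ-inj (cong proj₂ eq))) disj
      ; diagonals = diag
      ; light = lt
      }
      where
      seam∉ : ∀ {x} → x ∈ map ψ² B → (0 , suc a) ≢ x
      seam∉ x∈ refl with ∈-map⁻ ψ² x∈
      ... | f , f∈ , eq = <-irrefl (cong proj₂ eq) (ψ-end (proj₁ (diagonals D′ f∈)))
      disj : ∀ {x} → ¬ (x ∈ G × x ∈ (0 , suc a) ∷ map ψ² B)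
      disj (x∈ , here refl) with proj₂ (proj₂ (diagonals D x∈))
      ... | inj₂ h = <-irrefl refl h
      disj (x∈ , there x∈′) with ∈-map⁻ ψ² x∈′
      ... | f , f∈ , refl = <⇒≱ (ψ-end (proj₁ (diagonals D′ f∈))) (s≤s⁻¹ (proj₁ (proj₂ (diagonals D x∈))))
      ψ-bound : ∀ {v} → v < 2 + b → ψ v < 2 + (a + b)
      ψ-bound {zero}  _ = s≤s z≤n
      ψ-bound {suc v} (s≤s (s≤s h)) = s≤s (s≤s (+-monoʳ-≤ a h))
      ψ-suc : ∀ v → suc (ψ (suc v)) ≡ ψ (suc (suc v))
      ψ-suc v = cong suc (sym (+-suc a v))
      diag : ∀ {x} → x ∈ glued → Diagonal (2 + (a + b)) x
      diag x∈ with ∈-++⁻ G x∈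
      ... | inj₁ g∈ with diagonals D g∈
      ...   | p , q , r = p , ≤-trans q (s≤s (s≤s (m≤m+n a b))) , map₂ (λ h → ≤-trans h (s≤s (s≤s (m≤m+n a b)))) r
      diag x∈ | inj₂ (here refl) = s≤s 1≤a , s≤s (s≤s (m≤m+n a b)) , inj₂ (s≤s (s≤s (≤-trans (≤-reflexive (+-comm 1 a)) (+-monoʳ-≤ a 1≤b))))
      diag x∈ | inj₂ (there x∈′) with ∈-map⁻ ψ² x∈′
      ... | (u , v) , f∈ , refl with diagonals D′ f∈
      ...   | p , q , r = ψ-gap p , ψ-bound q , side r
        where
        ψ-gap : ∀ {u v} → 2 + u ≤ v → 2 + ψ u ≤ ψ v
        ψ-gap {zero} {suc zero} (s≤s ())
        ψ-gap {zero} {suc (suc v)} _ = s≤s (≤-trans (s≤s z≤n) (≤-reflexive (sym (+-suc a v))))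
        ψ-gap {suc u} {suc v} (s≤s h) = s≤s (≤-trans (≤-reflexive (trans (cong suc (sym (+-suc a u))) (sym (+-suc a (suc u))))) (+-monoʳ-≤ a h))
        side : ∀ {u v} → 0 < u ⊎ suc v < 2 + b → 0 < ψ u ⊎ suc (ψ v) < 2 + (a + b)
        side {suc u} (inj₁ _) = inj₁ (s≤s z≤n)
        side {v = zero}  (inj₂ _) = inj₂ (s≤s (s≤s z≤n))
        side {v = suc v} (inj₂ h) = inj₂ (≤-trans (≤-reflexive (cong suc (ψ-suc v))) (ψ-bound h))
      lt : ∀ {x} → x ∈ glued → count (cross x) glued ≤ ℓ
      lt {x} x∈ with ∈-++⁻ G x∈
      ... | inj₁ g∈ = ≤-trans (≤-reflexive (trans (split x) (trans (cong (count (cross x) G +_)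
              (cong₂ _+_ (𝟙-zero (seam-free g∈ ∘ cross⇒ x (0 , suc a)))
                (count-zero (cross x ∘ ψ²) B λ {f} f∈ → apart g∈ f∈ ∘ cross⇒ x (ψ² f)))) (+-identityʳ _)))) (light D g∈)
      ... | inj₂ (here refl) = ≤-trans (≤-reflexive (trans (split x)
              (cong₂ _+_ (count-zero (cross x) G λ {f} f∈ → seam-free f∈ ∘ cross-sym ∘ cross⇒ x f)
                (cong₂ _+_ (𝟙-zero (cross-irrefl ∘ cross⇒ x x))
                  (count-zero (cross x ∘ ψ²) B λ {f} f∈ → seam-free′ f∈ ∘ cross⇒ x (ψ² f)))))) z≤n
      ... | inj₂ (there x∈′) with ∈-map⁻ ψ² x∈′
      ...   | f , f∈ , refl = ≤-trans (≤-reflexive (trans (split (ψ² f))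
              (cong₂ _+_ (count-zero (cross (ψ² f)) G λ {g} g∈ → apart g∈ f∈ ∘ cross-sym ∘ cross⇒ (ψ² f) g)
                (cong (_+ count (cross (ψ² f) ∘ ψ²) B) (𝟙-zero (seam-free′ f∈ ∘ cross-sym ∘ cross⇒ (ψ² f) (0 , suc a)))))))
              (≤-trans (count-mono B λ {g} _ h → ⇒cross (ψ-cross (cross⇒ (ψ² f) (ψ² g) h))) (light D′ f∈))

    glued-size : length glued ≡ length G + suc (length B)
    glued-size = trans (length-++ G) (cong (λ z → length G + suc z) (length-map ψ² B))

  Attains : ℕ → (ℕ → ℕ) → ℕ → Set
  Attains ℓ e k = ∃[ G ] Drawing (3 + k) ℓ G × length G ≡ e k

  explicit : ∀ {ℓ e k} (ps : List ℕ) → T (drawingᵇ (3 + k) ℓ (map pair ps)) → length (map pair ps) ≡ e k → Attains ℓ e k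
  explicit ps h eq = map pair ps , drawingᵇ⇒ _ _ (map pair ps) h , eq

  -- Gluing on a polygon with 3 + b vertices contributes 1 + b new vertices, its own edges, and the
  -- seam.
  extend : ∀ {ℓ e k} b (B : List ℕ) → T (drawingᵇ (3 + b) ℓ (map pair B)) →
           suc (length (map pair B)) + e k ≡ e (suc b + k) → Attains ℓ e k → Attains ℓ e (suc b + k)
  extend {ℓ} {e} {k} b B h eq (G , D , size) = glued , subst (λ n → Drawing n ℓ glued) N≡ glue
    , trans glued-size (trans (cong (_+ suc (length (map pair B))) size) (trans (+-comm (e k) _) eq))
    where
    open Glue D (drawingᵇ⇒ _ _ (map pair B) h) (s≤s z≤n) (s≤s z≤n)
    N≡ : 2 + (suc k + suc b) ≡ 3 + (suc b + k)
    N≡ = cong (3 +_) (+-comm k (suc b))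

  -- In the quadrilateral, pentagon and hexagon every diagonal is crossed at most 1, 2 and 4 times.
  -- Four crossings occur only on the long diagonals of the hexagon; `K₆⁻` omits one of them, (0 ,
  -- 3), which leaves at most 3.
  K₄ K₅ K₆ K₆⁻ : List ℕ
  K₄  = 2 ∷ 13 ∷ []
  K₅  = 2 ∷ 3 ∷ 13 ∷ 14 ∷ 24 ∷ []
  K₆  = 2 ∷ 3 ∷ 4 ∷ 13 ∷ 14 ∷ 15 ∷ 24 ∷ 25 ∷ 35 ∷ []
  K₆⁻ = 2 ∷ 4 ∷ 13 ∷ 14 ∷ 15 ∷ 24 ∷ 25 ∷ 35 ∷ []

  attains₀ : ∀ k → Attains 0 e₀ k
  attains₀ zero    = explicit {0} {e₀} {0} [] tt refl
  attains₀ (suc k) = extend {0} {e₀} {k} 0 [] tt refl (attains₀ k)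

  attains₁ : ∀ k → Attains 1 e₁ k
  attains₁ 0 = explicit {1} {e₁} {0} [] tt refl
  attains₁ 1 = explicit {1} {e₁} {1} K₄ tt refl
  attains₁ (suc (suc k)) = extend {1} {e₁} {k} 1 K₄ tt refl (attains₁ k)

  attains₂ : ∀ k → Attains 2 e₂ k
  attains₂ 0 = explicit {2} {e₂} {0} [] tt refl
  attains₂ 1 = explicit {2} {e₂} {1} K₄ tt refl
  attains₂ 2 = explicit {2} {e₂} {2} K₅ tt refl
  attains₂ (suc (suc (suc k))) = extend {2} {e₂} {k} 2 K₅ tt refl (attains₂ k)

  attains₃ : ∀ k → Attains 3 e₃ k
  attains₃ 0 = explicit {3} {e₃} {0} [] tt refl
  attains₃ 1 = explicit {3} {e₃} {1} K₄ tt refl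
  attains₃ 2 = explicit {3} {e₃} {2} K₅ tt refl
  attains₃ 3 = explicit {3} {e₃} {3} K₆⁻ tt refl
  attains₃ (suc (suc (suc (suc k)))) = extend {3} {e₃} {k} 3 K₆⁻ tt refl (attains₃ k)

  attains₄ : ∀ k → Attains 4 e₄ k
  attains₄ 0 = explicit {4} {e₄} {0} [] tt refl
  attains₄ 1 = explicit {4} {e₄} {1} K₄ tt refl
  attains₄ 2 = explicit {4} {e₄} {2} K₅ tt refl
  attains₄ 3 = explicit {4} {e₄} {3} K₆ tt refl
  -- Gluing smaller optimal drawings yields only 10 edges on 7 vertices and 12 on 8, so these two
  -- cases need drawings of their own.
  attains₄ 4 = explicit {4} {e₄} {4} (2 ∷ 5 ∷ 13 ∷ 15 ∷ 16 ∷ 24 ∷ 25 ∷ 26 ∷ 35 ∷ 36 ∷ 46 ∷ []) tt refl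
  attains₄ 5 = explicit {4} {e₄} {5} (2 ∷ 6 ∷ 13 ∷ 16 ∷ 17 ∷ 24 ∷ 25 ∷ 27 ∷ 35 ∷ 36 ∷ 37 ∷ 46 ∷ 57 ∷ []) tt refl
  attains₄ (suc (suc (suc (suc (suc (suc k)))))) = extend {4} {e₄} {suc (suc k)} 3 K₆ tt refl (attains₄ (suc (suc k)))

open import Algebra.Bundles using (CommutativeRing; CommutativeMonoid; RawRing)

-- Ring identities for the orientation determinant.

module Solver {c ℓ} (R : CommutativeRing c ℓ) where

  open import Algebra.Solver.Ring.AlmostCommutativeRing using (fromCommutativeRing; _-Raw-AlmostCommutative⟶_)
  open import Data.Maybe.Base using (Maybe; just; nothing)
  open import Data.Nat.Base as ℕ using (ℕ)
  import Data.Nat.Properties as ℕ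
  open import Data.Product.Base using (_,_) renaming (_×_ to _⊗_)
  import Relation.Binary.PropositionalEquality.Core as ≡
  open import Relation.Nullary using (yes; no)
  open CommutativeRing R
  open import Algebra.Properties.Ring ring using (-‿distribˡ-*; -‿distribʳ-*; -‿involutive; -0#≈0#)
  open import Algebra.Properties.CommutativeSemigroup (CommutativeMonoid.commutativeSemigroup +-commutativeMonoid) using (interchange)
  open import Algebra.Properties.AbelianGroup +-abelianGroup using (⁻¹-∙-comm)
  open import Algebra.Properties.Semiring.Mult semiring using (_×_; ×-homo-+; ×1-homo-*; ×-congˡ)
  open import Relation.Binary.Reasoning.Setoid setoid

  -- The pair (m , n) stands for the integer m - n.
  differences : RawRing _ _
  differences = record
    { Carrier = ℕ ⊗ ℕ
    ; _≈_ = ≡._≡_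
    ; _+_ = λ (a , b) (c , d) → a ℕ.+ c , b ℕ.+ d
    ; _*_ = λ (a , b) (c , d) → a ℕ.* c ℕ.+ b ℕ.* d , a ℕ.* d ℕ.+ b ℕ.* c
    ; -_  = λ (a , b) → b , a
    ; 0#  = 0 , 0
    ; 1#  = 1 , 0
    }

  private
    ⌊_⌋ : ℕ → Carrier
    ⌊ n ⌋ = n × 1#

    +-lemma : ∀ a b c d → (a + c) + - (b + d) ≈ (a + - b) + (c + - d)
    +-lemma a b c d = begin
      (a + c) + - (b + d)     ≈⟨ +-congˡ (⁻¹-∙-comm b d) ⟨
      (a + c) + (- b + - d)   ≈⟨ interchange a c (- b) (- d) ⟩
      (a + - b) + (c + - d)   ∎

    *-lemma : ∀ a b c d → (a * c + b * d) + - (a * d + b * c) ≈ (a + - b) * (c + - d)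
    *-lemma a b c d = begin
      (a * c + b * d) + - (a * d + b * c)     ≈⟨ +-lemma (a * c) (a * d) (b * d) (b * c) ⟩
      (a * c + - (a * d)) + (b * d + - (b * c))
        ≈⟨ +-cong (+-congˡ (-‿distribʳ-* a d)) (trans (+-comm _ _) (+-cong (-‿distribˡ-* b c) (begin
             b * d             ≈⟨ -‿involutive _ ⟨
             - (- (b * d))     ≈⟨ -‿cong (-‿distribʳ-* b d) ⟩
             - (b * - d)       ≈⟨ -‿distribˡ-* b (- d) ⟩
             (- b) * (- d)     ∎))) ⟩
      (a * c + a * - d) + ((- b) * c + (- b) * (- d))
        ≈⟨ +-cong (distribˡ a c (- d)) (distribˡ (- b) c (- d)) ⟨
      a * (c + - d) + (- b) * (c + - d)       ≈⟨ distribʳ (c + - d) a (- b) ⟨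
      (a + - b) * (c + - d) ∎

    evaluation : differences -Raw-AlmostCommutative⟶ fromCommutativeRing R
    evaluation = record
      { ⟦_⟧    = λ (a , b) → ⌊ a ⌋ + - ⌊ b ⌋
      ; +-homo = λ (a , b) (c , d) → trans (+-cong (×-homo-+ 1# a c) (-‿cong (×-homo-+ 1# b d)))
                   (+-lemma ⌊ a ⌋ ⌊ b ⌋ ⌊ c ⌋ ⌊ d ⌋)
      ; *-homo = λ (a , b) (c , d) → trans (+-cong
                   (trans (×-homo-+ 1# (a ℕ.* c) (b ℕ.* d)) (+-cong (×1-homo-* a c) (×1-homo-* b d)))
                   (-‿cong (trans (×-homo-+ 1# (a ℕ.* d) (b ℕ.* c)) (+-cong (×1-homo-* a d) (×1-homo-* b c)))))
                   (*-lemma ⌊ a ⌋ ⌊ b ⌋ ⌊ c ⌋ ⌊ d ⌋)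
      ; -‿homo = λ (a , b) → begin
          ⌊ b ⌋ + - ⌊ a ⌋        ≈⟨ +-comm _ _ ⟩
          - ⌊ a ⌋ + ⌊ b ⌋        ≈⟨ +-congˡ (-‿involutive ⌊ b ⌋) ⟨
          - ⌊ a ⌋ + - (- ⌊ b ⌋)  ≈⟨ ⁻¹-∙-comm ⌊ a ⌋ (- ⌊ b ⌋) ⟩
          - (⌊ a ⌋ + - ⌊ b ⌋)    ∎
      ; 0-homo = -‿inverseʳ 0#
      ; 1-homo = trans (+-congˡ -0#≈0#) (trans (+-identityʳ _) (+-identityʳ 1#))
      }

    cancel : ∀ a b c d → a + d ≈ c + b → a + - b ≈ c + - d
    cancel a b c d h = begin
      a + - b                     ≈⟨ +-identityʳ _ ⟨
      (a + - b) + 0#              ≈⟨ +-congˡ (-‿inverseʳ d) ⟨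
      (a + - b) + (d + - d)       ≈⟨ interchange a (- b) d (- d) ⟩
      (a + d) + (- b + - d)       ≈⟨ +-congʳ h ⟩
      (c + b) + (- b + - d)       ≈⟨ +-assoc c b _ ⟩
      c + (b + (- b + - d))       ≈⟨ +-congˡ (+-assoc b (- b) (- d)) ⟨
      c + ((b + - b) + - d)       ≈⟨ +-congˡ (+-congʳ (-‿inverseʳ b)) ⟩
      c + (0# + - d)              ≈⟨ +-congˡ (+-identityˡ (- d)) ⟩
      c + - d                     ∎

    -- Equality in the ring need not be decidable. The test a + d = c + b is equality of the
    -- represented integers and is decided among natural numbers.
    equal? : ∀ x y → Maybe (_-Raw-AlmostCommutative⟶_.⟦_⟧ evaluation x ≈ _-Raw-AlmostCommutative⟶_.⟦_⟧ evaluation y)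
    equal? (a , b) (c , d) with a ℕ.+ d ℕ.≟ c ℕ.+ b
    ... | no  _  = nothing
    ... | yes eq = just (cancel ⌊ a ⌋ ⌊ b ⌋ ⌊ c ⌋ ⌊ d ⌋
            (trans (sym (×-homo-+ 1# a d)) (trans (×-congˡ eq) (×-homo-+ 1# c b))))

  open import Algebra.Solver.Ring differences (fromCommutativeRing R) evaluation equal? public
    using (solve; _:=_; _:+_; _:*_; _:-_; :-_)

  private
    :orient : ∀ {n} (ax ay bx by rx ry : _) → _
    :orient {n} ax ay bx by rx ry = _:-_ {n} ((bx :- ax) :* (ry :- ay)) ((by :- ay) :* (rx :- ax))

    or : (ax ay bx by rx ry : Carrier) → Carrier
    or ax ay bx by rx ry = (bx - ax) * (ry - ay) - (by - ay) * (rx - ax)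

  -- The three-term Grassmann-Plücker relation for four vectors of the plane.
  plücker : ∀ p p′ q q′ r r′ s s′ →
    (p * r′ - p′ * r) * (q * s′ - q′ * s) ≈ (p * q′ - p′ * q) * (r * s′ - r′ * s) + (p * s′ - p′ * s) * (q * r′ - q′ * r)
  plücker = solve 8 (λ p p′ q q′ r r′ s s′ →
    (p :* r′ :- p′ :* r) :* (q :* s′ :- q′ :* s) :=
    (p :* q′ :- p′ :* q) :* (r :* s′ :- r′ :* s) :+ (p :* s′ :- p′ :* s) :* (q :* r′ :- q′ :* r)) refl

  cyclic : ∀ ax ay bx by rx ry → or ax ay bx by rx ry ≈ or bx by rx ry ax ay
  cyclic = solve 6 (λ ax ay bx by rx ry → :orient ax ay bx by rx ry := :orient bx by rx ry ax ay) refl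

  -- Twice the signed area of the quadrilateral a c b d, cut along either diagonal.
  total : ∀ ax ay bx by cx cy dx dy →
    or ax ay cx cy bx by + or ax ay bx by dx dy ≈ or cx cy bx by dx dy + or cx cy dx dy ax ay
  total = solve 8 (λ ax ay bx by cx cy dx dy →
    :orient ax ay cx cy bx by :+ :orient ax ay bx by dx dy := :orient cx cy bx by dx dy :+ :orient cx cy dx dy ax ay) refl

  -- The affine dependence of four points of the plane, whose coefficients are areas of triangles;
  -- `meet-y` is its other coordinate.
  meet-x : ∀ ax ay bx by cx cy dx dy →
    or cx cy bx by dx dy * ax + or cx cy dx dy ax ay * bx ≈ or ax ay bx by dx dy * cx + or ax ay cx cy bx by * dx
  meet-x = solve 8 (λ ax ay bx by cx cy dx dy →
    :orient cx cy bx by dx dy :* ax :+ :orient cx cy dx dy ax ay :* bx :=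
    :orient ax ay bx by dx dy :* cx :+ :orient ax ay cx cy bx by :* dx) refl

  meet-y : ∀ ax ay bx by cx cy dx dy →
    or cx cy bx by dx dy * ay + or cx cy dx dy ax ay * by ≈ or ax ay bx by dx dy * cy + or ax ay cx cy bx by * dy
  meet-y = solve 8 (λ ax ay bx by cx cy dx dy →
    :orient cx cy bx by dx dy :* ay :+ :orient cx cy dx dy ax ay :* by :=
    :orient ax ay bx by dx dy :* cy :+ :orient ax ay cx cy bx by :* dy) refl

  bilinear : ∀ B B′ C C′ D D′ u t →
    B * (u * C′ + t * D′) - B′ * (u * C + t * D) ≈ u * (B * C′ - B′ * C) + t * (B * D′ - B′ * D)
  bilinear = solve 8 (λ B B′ C C′ D D′ u t →
    B :* (u :* C′ :+ t :* D′) :- B′ :* (u :* C :+ t :* D) := u :* (B :* C′ :- B′ :* C) :+ t :* (B :* D′ :- B′ :* D)) refl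

  affine : ∀ e t c d a → ((e - t) * c + t * d) - e * a ≈ (e - t) * (c - a) + t * (d - a)
  affine = solve 5 (λ e t c d a → ((e :- t) :* c :+ t :* d) :- e :* a := (e :- t) :* (c :- a) :+ t :* (d :- a)) refl

  flip : ∀ ax ay bx by rx ry → or ax ay bx by rx ry ≈ - or ax ay rx ry bx by
  flip = solve 6 (λ ax ay bx by rx ry → :orient ax ay bx by rx ry := :- :orient ax ay rx ry bx by) refl

-- Crossing diagonals of a convex polygon over an ordered field.

module Geometry {c ℓ₁ ℓ₂ ℓ₃} (K : OrderedField c ℓ₁ ℓ₂ ℓ₃) where

  open import Algebra.Apartness.Bundles using (HeytingCommutativeRing)
  import Algebra.Apartness.Properties.HeytingCommutativeRing as Heyting
  import Algebra.Properties.Ring as RingProperties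
  open import Level using (_⊔_)
  open import Data.Empty using (⊥; ⊥-elim)
  open import Data.Fin.Base using (Fin; toℕ; fromℕ<)
  open import Data.Fin.Properties using (toℕ-injective; toℕ-fromℕ<; toℕ<n)
  open import Data.Nat.Base as ℕ using (ℕ; zero; suc; s≤s)
  open import Data.Nat.DivMod using (m<n⇒m%n≡m; n%n≡0; m%n<n)
  import Data.Nat.Properties as ℕ
  open import Data.Product.Base using (_×_; _,_; proj₁; proj₂; ∃-syntax)
  open import Data.Sum.Base using (_⊎_; inj₁; inj₂)
  open import Function.Base using (_∘_)
  open import Function.Bundles using (Equivalence)
  open import Relation.Binary.Definitions using (tri<; tri≈; tri>)
  import Relation.Binary.PropositionalEquality as ≡
  open ≡ using (_≡_; _≢_)
  open import Relation.Binary.Structures using (IsStrictPartialOrder)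
  import Relation.Nullary
  open Drawings using (Interleaved; after; before)

  open OrderedField K
  open Plane K
  private
    R = HeytingCommutativeRing.commutativeRing heytingCommutativeRing
    module SP = IsStrictPartialOrder isStrictPartialOrder
  open Solver R using (plücker; cyclic; total; meet-x; meet-y; bilinear; affine; flip)
  open import Algebra.Bundles using (CommutativeRing)
  open RingProperties (CommutativeRing.ring R) using (-‿distribˡ-*; -‿distribʳ-*; -‿involutive; -0#≈0#)
  open import Algebra.Properties.AbelianGroup (CommutativeRing.+-abelianGroup R) using () renaming (⁻¹-∙-comm to -‿+-comm)
  open import Relation.Binary.Reasoning.Setoid (CommutativeRing.setoid R)

  <-resp : ∀ {x y} → x ≈ y → 0# < x → 0# < y
  <-resp = proj₁ SP.<-resp-≈

  pos-+ : ∀ {x y} → 0# < x → 0# < y → 0# < x + y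
  pos-+ {x} {y} p q = SP.trans q (proj₂ SP.<-resp-≈ (+-identityˡ y) (+-monoˡ-< y p))

  neg⇒pos : ∀ {x} → x < 0# → 0# < - x
  neg⇒pos {x} p = <-resp (+-identityˡ (- x)) (proj₂ SP.<-resp-≈ (-‿inverseʳ x) (+-monoˡ-< (- x) p))

  not-both : ∀ {x} → 0# < x → 0# < - x → ⊥
  not-both {x} p q = SP.irrefl refl (<-resp (-‿inverseʳ x) (pos-+ p q))

  private
    module H = Heyting heytingCommutativeRing

  0<1 : 0# < 1#
  0<1 with Equivalence.to (#⇔<⊎> 1# 0#) H.1#0
  ... | inj₂ p = p
  -- If 1 were negative, then -1 would be positive, and 1 is its square.
  ... | inj₁ p = <-resp (trans (sym (-‿distribˡ-* 1# (- 1#))) (trans (-‿cong (*-identityˡ (- 1#))) (-‿involutive 1#)))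
                   (*-pos (neg⇒pos p) (neg⇒pos p))

  -- Apartness from 0 gives the inverse. Being invertible, it is itself apart from 0, and a negative
  -- one would make -1 positive.
  inverse : ∀ {x} → 0# < x → ∃[ y ] 0# < y × y * x ≈ 1#
  inverse {x} p with #⇒invertible (Equivalence.from (#⇔<⊎> x 0#) (inj₂ p))
  ... | y , y*x , x*y = y , y-pos , y*x≈1
    where
    y*x≈1 : y * x ≈ 1#
    y*x≈1 = trans (*-congˡ (sym (H.x-0≈x x))) y*x
    y#0 : y # 0#
    y#0 = H.invertibleˡ⇒# (x , trans (*-congˡ (H.x-0≈x y)) (trans (*-comm x y) y*x≈1))
    y-pos : 0# < y
    y-pos with Equivalence.to (#⇔<⊎> y 0#) y#0
    ... | inj₂ q = q
    ... | inj₁ q = ⊥-elim (not-both 0<1 (<-resp (trans (sym (-‿distribˡ-* y x)) (-‿cong y*x≈1)) (*-pos (neg⇒pos q) p)))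

  pos-cancel : ∀ {x y} → 0# < x → 0# < x * y → 0# < y
  pos-cancel {x} {y} p q with inverse p
  ... | z , z>0 , z*x = <-resp (trans (sym (*-assoc z x y)) (trans (*-congʳ z*x) (*-identityˡ y))) (*-pos z>0 q)

  pos-difference : ∀ {x y} → x < y → 0# < y - x
  pos-difference {x} {y} p = proj₂ SP.<-resp-≈ (-‿inverseʳ x) (+-monoˡ-< (- x) p)

  difference-pos : ∀ {x y} → 0# < y - x → x < y
  difference-pos {x} {y} p = proj₁ SP.<-resp-≈
    (trans (+-assoc y (- x) x) (trans (+-congˡ (-‿inverseˡ x)) (+-identityʳ y)))
    (proj₂ SP.<-resp-≈ (+-identityˡ x) (+-monoˡ-< x p))

  cyc : ∀ a b r → orient a b r ≈ orient b r a
  cyc (ax , ay) (bx , by) (rx , ry) = cyclic ax ay bx by rx ry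

  swap : ∀ a b r → orient a b r ≈ - orient a r b
  swap (ax , ay) (bx , by) (rx , ry) = flip ax ay bx by rx ry

  orient-end : ∀ a b → orient a b b ≈ 0#
  orient-end (ax , ay) (bx , by) = trans (+-congˡ (-‿cong (*-comm (by - ay) (bx - ax)))) (-‿inverseʳ _)

  orient-start : ∀ a b → orient a b a ≈ 0#
  orient-start a b = trans (cyc a b a) (orient-end b a)

  plücker′ : ∀ a b p q r → orient a b q * orient a p r ≈ orient a b p * orient a q r + orient a b r * orient a p q
  plücker′ (ax , ay) (bx , by) (px , py) (qx , qy) (rx , ry) =
    plücker (bx - ax) (by - ay) (px - ax) (py - ay) (qx - ax) (qy - ay) (rx - ax) (ry - ay)

  orient-affine : ∀ a b p q z t → proj₁ z ≈ (1# - t) * proj₁ p + t * proj₁ q →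
                  proj₂ z ≈ (1# - t) * proj₂ p + t * proj₂ q →
                  orient a b z ≈ (1# - t) * orient a b p + t * orient a b q
  orient-affine (ax , ay) (bx , by) (px , py) (qx , qy) (zx , zy) t hx hy = trans
    (+-cong (*-congˡ (shift zy py qy ay hy)) (-‿cong (*-congˡ (shift zx px qx ax hx))))
    (bilinear (bx - ax) (by - ay) (px - ax) (py - ay) (qx - ax) (qy - ay) (1# - t) t)
    where
    shift : ∀ z p q a → z ≈ (1# - t) * p + t * q → z - a ≈ (1# - t) * (p - a) + t * (q - a)
    shift z p q a h = trans (+-cong h (-‿cong (sym (*-identityˡ a)))) (affine 1# t p q a)

  -- If u a + r b = q c + p d with positive weights of equal sums, then the
  -- normalised weights give a point on both segments.
  record Balance (u r q p : Carrier) : Set (c ⊔ ℓ₁ ⊔ ℓ₃) where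
    field
      t s : Carrier
      t>0 : 0# < t
      t<1 : t < 1#
      s>0 : 0# < s
      s<1 : s < 1#
      along : ∀ w x y z → u * w + r * x ≈ q * y + p * z → (1# - t) * w + t * x ≈ (1# - s) * y + s * z

  balance : ∀ {u r q p} → 0# < u → 0# < r → 0# < q → 0# < p → p + q ≈ u + r → Balance u r q p
  balance {u} {r} {q} {p} u>0 r>0 q>0 p>0 sum with inverse (pos-+ u>0 r>0)
  ... | δ , δ>0 , δD = record
    { t = δ * r
    ; s = δ * p
    ; t>0 = *-pos δ>0 r>0
    ; t<1 = difference-pos (<-resp (sym 1-t) (*-pos δ>0 u>0))
    ; s>0 = *-pos δ>0 p>0
    ; s<1 = difference-pos (<-resp (sym 1-s) (*-pos δ>0 q>0))
    ; along = λ w x y z h → begin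
        (1# - δ * r) * w + δ * r * x   ≈⟨ +-congʳ (*-congʳ 1-t) ⟩
        δ * u * w + δ * r * x          ≈⟨ scaled u r w x ⟩
        δ * (u * w + r * x)            ≈⟨ *-congˡ h ⟩
        δ * (q * y + p * z)            ≈⟨ scaled q p y z ⟨
        δ * q * y + δ * p * z          ≈⟨ +-congʳ (*-congʳ 1-s) ⟨
        (1# - δ * p) * y + δ * p * z   ∎
    }
    where
    complement : ∀ x y → δ * (x + y) ≈ 1# → 1# - δ * y ≈ δ * x
    complement x y h = begin
      1# - δ * y                ≈⟨ +-congʳ h ⟨
      δ * (x + y) - δ * y       ≈⟨ +-congʳ (distribˡ δ x y) ⟩
      (δ * x + δ * y) - δ * y   ≈⟨ +-assoc (δ * x) (δ * y) (- (δ * y)) ⟩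
      δ * x + (δ * y - δ * y)   ≈⟨ +-congˡ (-‿inverseʳ (δ * y)) ⟩
      δ * x + 0#                ≈⟨ +-identityʳ (δ * x) ⟩
      δ * x                     ∎
    1-t : 1# - δ * r ≈ δ * u
    1-t = complement u r δD
    1-s : 1# - δ * p ≈ δ * q
    1-s = complement q p (trans (*-congˡ (trans (+-comm q p) sum)) δD)
    scaled : ∀ x y X Y → δ * x * X + δ * y * Y ≈ δ * (x * X + y * Y)
    scaled x y X Y = trans (+-cong (*-assoc δ x X) (*-assoc δ y Y)) (sym (distribˡ δ (x * X) (y * Y)))

  -- The four positive areas are the coefficients of the affine dependence of a, b, p, q. By `total`
  -- both sides of it have the same weight, so normalising yields one point on both segments.
  intersection : ∀ a b p q → 0# < orient p b q → 0# < orient p q a → 0# < orient a b q → 0# < orient a p b →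
                 ∃[ x ] InteriorTo a b x × InteriorTo p q x
  intersection (ax , ay) (bx , by) (px , py) (qx , qy) h₁ h₂ h₃ h₄ =
    ((1# - t) * ax + t * bx , (1# - t) * ay + t * by)
    , (t , t>0 , t<1 , refl , refl)
    , (s , s>0 , s<1 , along ax bx px qx (meet-x ax ay bx by px py qx qy) , along ay by py qy (meet-y ax ay bx by px py qx qy))
    where open Balance (balance h₁ h₂ h₃ h₄ (total ax ay bx by px py qx qy))

  toℕ-next : ∀ {n} (i : Fin n) → suc (toℕ i) ℕ.< n → toℕ (next i) ≡ suc (toℕ i)
  toℕ-next {suc n} i h = ≡.trans (toℕ-fromℕ< (m%n<n (suc (toℕ i)) (suc n))) (m<n⇒m%n≡m h)

  toℕ-next-last : ∀ {n} (i : Fin n) → suc (toℕ i) ≡ n → toℕ (next i) ≡ 0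
  toℕ-next-last {suc n} i h = ≡.trans (toℕ-fromℕ< (m%n<n (suc (toℕ i)) (suc n)))
    (≡.trans (≡.cong (λ z → z ℕ.% suc n) h) (n%n≡0 (suc n)))

  module _ {n : ℕ} (P : ConvexPolygon K n) where
    open ConvexPolygon P

    Ccw : Fin n → Fin n → Fin n → Set ℓ₃
    Ccw i j k = 0# < orient (vertex i) (vertex j) (vertex k)

    private
      rotate-ccw : ∀ {i j k} → Ccw i j k → Ccw j k i
      rotate-ccw {i} {j} {k} = <-resp (cyc (vertex i) (vertex j) (vertex k))

      successor : ∀ {i j : Fin n} → toℕ j ≡ suc (toℕ i) → j ≡ next i
      successor {i} {j} h = toℕ-injective (≡.trans h (≡.sym (toℕ-next i (≡.subst (ℕ._< n) h (toℕ<n j)))))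

      apart : ∀ {i j : Fin n} → toℕ i ℕ.< toℕ j → j ≢ i
      apart h ≡.refl = ℕ.<-irrefl ≡.refl h

      -- The fan at i: consecutive triangles are counterclockwise, and the
      -- Plücker relation with respect to the next vertex after i passes from
      -- the triangles i j k and i k (k + 1) to the triangle i j (k + 1).
      fan : ∀ d i j k → toℕ i ℕ.< toℕ j → toℕ k ≡ suc d ℕ.+ toℕ j → Ccw i j k
      fan zero i j k i<j k≡ with successor {j} {k} k≡
      ... | ≡.refl = rotate-ccw (rotate-ccw (convex j i
            (apart i<j ∘ ≡.sym) (apart {i} {k} (ℕ.<-trans i<j (ℕ.≤-reflexive (≡.sym k≡))) ∘ ≡.sym)))
      fan (suc d) i j k i<j k≡ with toℕ j ℕ.≟ suc (toℕ i)
      ... | Relation.Nullary.yes j≡ with successor {i} {j} j≡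
      ...   | ≡.refl = convex i k (apart (ℕ.<-trans i<j j<k)) (apart j<k)
        where
        j<k : toℕ j ℕ.< toℕ k
        j<k = ≡.subst (toℕ j ℕ.<_) (≡.sym k≡) (s≤s (ℕ.m≤n+m (toℕ j) (suc d)))
      fan (suc d) i j k i<j k≡ | Relation.Nullary.no j≢ =
        pos-cancel (convex i k⁻ (apart i<k⁻) (apart i⁺<k⁻))
          (<-resp (sym (plücker′ (vertex i) (vertex (next i)) (vertex j) (vertex k⁻) (vertex k)))
            (pos-+ (*-pos (convex i j (apart i<j) (apart i⁺<j)) (rotate-ccw (rotate-ccw (≡.subst (λ z → Ccw k⁻ z i) (≡.sym k≡next) (convex k⁻ i
                      (apart i<k⁻ ∘ ≡.sym) (λ eq → apart {i} {k} (ℕ.<-trans i<j j<k) (≡.trans k≡next (≡.sym eq))))))))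
                   (*-pos (convex i k (apart (ℕ.<-trans i<j j<k)) (apart (ℕ.<-trans i⁺<j j<k))) (fan d i j k⁻ i<j k⁻≡))))
        where
        j<k : toℕ j ℕ.< toℕ k
        j<k = ≡.subst (toℕ j ℕ.<_) (≡.sym k≡) (s≤s (ℕ.m≤n+m (toℕ j) (suc d)))
        k⁻<n : suc d ℕ.+ toℕ j ℕ.< n
        k⁻<n = ℕ.<-trans (ℕ.≤-reflexive (≡.sym k≡)) (toℕ<n k)
        k⁻ : Fin n
        k⁻ = fromℕ< k⁻<n
        k⁻≡ : toℕ k⁻ ≡ suc d ℕ.+ toℕ j
        k⁻≡ = toℕ-fromℕ< k⁻<n
        k≡next : k ≡ next k⁻
        k≡next = successor (≡.trans k≡ (≡.cong suc (≡.sym k⁻≡)))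
        i⁺≡ : toℕ (next i) ≡ suc (toℕ i)
        i⁺≡ = toℕ-next i (ℕ.≤-<-trans i<j (toℕ<n j))
        i⁺<j : toℕ (next i) ℕ.< toℕ j
        i⁺<j = ℕ.≤∧≢⇒< (≡.subst (ℕ._≤ toℕ j) (≡.sym i⁺≡) i<j) (λ eq → j≢ (≡.trans (≡.sym eq) i⁺≡))
        j<k⁻ : toℕ j ℕ.< toℕ k⁻
        j<k⁻ = ≡.subst (toℕ j ℕ.<_) (≡.sym k⁻≡) (s≤s (ℕ.m≤n+m (toℕ j) d))
        i<k⁻ : toℕ i ℕ.< toℕ k⁻
        i<k⁻ = ℕ.<-trans i<j j<k⁻
        i⁺<k⁻ : toℕ (next i) ℕ.< toℕ k⁻
        i⁺<k⁻ = ℕ.<-trans i⁺<j j<k⁻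

    ccw : ∀ {i j k} → toℕ i ℕ.< toℕ j → toℕ j ℕ.< toℕ k → Ccw i j k
    ccw {i} {j} {k} i<j j<k = fan (toℕ k ℕ.∸ suc (toℕ j)) i j k i<j
      (≡.trans (≡.sym (ℕ.m∸n+n≡m j<k)) (ℕ.+-suc _ (toℕ j)))

    ends : Pair n → ℕ × ℕ
    ends (i , j) = toℕ i , toℕ j

    private
      meet : ∀ {i j k l} → toℕ i ℕ.< toℕ k → toℕ k ℕ.< toℕ j → toℕ j ℕ.< toℕ l → Cross P (i , j) (k , l)
      meet {i} {j} {k} {l} i<k k<j j<l = intersection (vertex i) (vertex j) (vertex k) (vertex l)
        (ccw k<j j<l) (rotate-ccw (ccw i<k (ℕ.<-trans k<j j<l))) (ccw (ℕ.<-trans i<k k<j) j<l) (ccw i<k k<j)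

    interleaved⇒cross : ∀ e f → Interleaved (ends e) (ends f) → Cross P e f
    interleaved⇒cross (i , j) (k , l) (after x y z)  = meet {i} {j} {k} {l} x y z
    interleaved⇒cross (i , j) (k , l) (before x y z) = let p , q , r = meet {k} {l} {i} {j} x y z in p , r , q

    private
      data Side (i j k : Fin n) : Set where
        outside  : toℕ k ℕ.< toℕ i ⊎ toℕ j ℕ.< toℕ k → Side i j k
        boundary : k ≡ i ⊎ k ≡ j → Side i j k
        inside   : toℕ i ℕ.< toℕ k → toℕ k ℕ.< toℕ j → Side i j k

      side : ∀ i j k → Side i j k
      side i j k with ℕ.<-cmp (toℕ k) (toℕ i) | ℕ.<-cmp (toℕ k) (toℕ j)
      ... | tri< a _ _ | _          = outside (inj₁ a)
      ... | tri≈ _ a _ | _          = boundary (inj₁ (toℕ-injective a))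
      ... | tri> _ _ a | tri< b _ _ = inside a b
      ... | tri> _ _ a | tri≈ _ b _ = boundary (inj₂ (toℕ-injective b))
      ... | tri> _ _ a | tri> _ _ b = outside (inj₂ b)

      module _ {i j : Fin n} (i<j : toℕ i ℕ.< toℕ j) where
        σ : Fin n → Carrier
        σ k = orient (vertex i) (vertex j) (vertex k)

        outside-pos : ∀ {k} → toℕ k ℕ.< toℕ i ⊎ toℕ j ℕ.< toℕ k → 0# < σ k
        outside-pos (inj₁ h) = rotate-ccw (ccw h i<j)
        outside-pos (inj₂ h) = ccw i<j h

        boundary-zero : ∀ {k} → k ≡ i ⊎ k ≡ j → σ k ≈ 0#
        boundary-zero (inj₁ ≡.refl) = orient-start (vertex i) (vertex j)
        boundary-zero (inj₂ ≡.refl) = orient-end (vertex i) (vertex j)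

        inside-neg : ∀ {k} → toℕ i ℕ.< toℕ k → toℕ k ℕ.< toℕ j → 0# < - σ k
        inside-neg {k} x y = <-resp (trans (sym (-‿involutive _)) (-‿cong (sym (swap (vertex i) (vertex j) (vertex k))))) (ccw x y)

      zeroed : ∀ {x y z w} → x ≈ 0# → w * x + z * y ≈ z * y
      zeroed {x} {y} {z} {w} h = trans (+-congʳ (trans (*-congˡ h) (zeroʳ w))) (+-identityˡ (z * y))

      negated : ∀ u t x y → u * (- x) + t * (- y) ≈ - (u * x + t * y)
      negated u t x y = trans (+-cong (sym (-‿distribʳ-* u x)) (sym (-‿distribʳ-* t y))) (-‿+-comm (u * x) (t * y))

    -- The orientation with respect to i and j is positive at vertices outside the range from i to
    -- j, negative strictly inside, and zero at i and j. It is affine along the segment from k to l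
    -- and vanishes at the common point, so k and l have opposite signs, or both are zero, which
    -- would make the two edges equal.
    cross⇒interleaved : ∀ {i j k l} → toℕ i ℕ.< toℕ j → toℕ k ℕ.< toℕ l → (i , j) ≢ (k , l) →
                        Cross P (i , j) (k , l) → Interleaved (ends (i , j)) (ends (k , l))
    cross⇒interleaved {i} {j} {k} {l} i<j k<l e≢f (z , (t , t>0 , t<1 , zx , zy) , (s , s>0 , s<1 , zx′ , zy′)) =
      cases (side i j k) (side i j l)
      where
      u = 1# - s
      u>0 : 0# < u
      u>0 = pos-difference s<1
      -- At `z` the affine function is a combination of its values at k and l, and also of its zeros
      -- at i and j.
      value : u * σ i<j k + s * σ i<j l ≈ 0#
      value = trans (sym (orient-affine (vertex i) (vertex j) (vertex k) (vertex l) z s zx′ zy′))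
        (trans (orient-affine (vertex i) (vertex j) (vertex i) (vertex j) z t zx zy)
          (trans (zeroed (orient-start (vertex i) (vertex j))) (trans (*-congˡ (orient-end (vertex i) (vertex j))) (zeroʳ t))))
      value⁻ : u * (- σ i<j k) + s * (- σ i<j l) ≈ 0#
      value⁻ = trans (negated u s (σ i<j k) (σ i<j l)) (trans (-‿cong value) -0#≈0#)
      absurd : ∀ {A : Set} {x} → 0# < x → x ≈ 0# → A
      absurd p q = ⊥-elim (SP.irrefl refl (<-resp q p))
      zero⁻ : ∀ {x} → x ≈ 0# → - x ≈ 0#
      zero⁻ h = trans (-‿cong h) -0#≈0#
      cases : Side i j k → Side i j l → Interleaved (ends (i , j)) (ends (k , l))
      cases (outside p) (outside q)  = absurd (pos-+ (*-pos u>0 (outside-pos i<j p)) (*-pos s>0 (outside-pos i<j q))) value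
      cases (outside p) (boundary q) = absurd (*-pos u>0 (outside-pos i<j p))
        (trans (sym (trans (+-comm _ _) (zeroed (boundary-zero i<j q)))) value)
      cases (boundary p) (outside q) = absurd (*-pos s>0 (outside-pos i<j q))
        (trans (sym (zeroed (boundary-zero i<j p))) value)
      cases (inside p p′) (inside q q′) = absurd
        (pos-+ (*-pos u>0 (inside-neg i<j p p′)) (*-pos s>0 (inside-neg i<j q q′))) value⁻
      cases (inside p p′) (boundary q)  = absurd (*-pos u>0 (inside-neg i<j p p′))
        (trans (sym (trans (+-comm _ _) (zeroed (zero⁻ (boundary-zero i<j q))))) value⁻)
      cases (boundary p) (inside q q′)  = absurd (*-pos s>0 (inside-neg i<j q q′))
        (trans (sym (zeroed (zero⁻ (boundary-zero i<j p)))) value⁻)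
      cases (inside p p′) (outside (inj₁ q)) = ⊥-elim (ℕ.<-asym k<l (ℕ.<-trans q p))
      cases (inside p p′) (outside (inj₂ q)) = after p p′ q
      cases (outside (inj₁ p)) (inside q q′) = before p q q′
      cases (outside (inj₂ p)) (inside q q′) = ⊥-elim (ℕ.<-asym k<l (ℕ.<-trans q′ p))
      cases (boundary (inj₁ ≡.refl)) (boundary (inj₁ ≡.refl)) = ⊥-elim (ℕ.<-irrefl ≡.refl k<l)
      cases (boundary (inj₁ ≡.refl)) (boundary (inj₂ ≡.refl)) = ⊥-elim (e≢f ≡.refl)
      cases (boundary (inj₂ ≡.refl)) (boundary (inj₁ ≡.refl)) = ⊥-elim (ℕ.<-asym i<j k<l)
      cases (boundary (inj₂ ≡.refl)) (boundary (inj₂ ≡.refl)) = ⊥-elim (ℕ.<-irrefl ≡.refl k<l)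

open Counting
open Drawings using (Interleaved; Drawing; unique; diagonals; light; Diagonal; cross; cross⇒; ⇒cross; cross-irrefl)
open Reduction using (e₀; e₁; e₂; e₃; e₄)
open LowerBounds using (attains₀; attains₁; attains₂; attains₃; attains₄)
open UpperBounds using (at-most₀; at-most₁; at-most₂; at-most₃; at-most₄)
open Geometry using (ends; interleaved⇒cross; cross⇒interleaved; toℕ-next; toℕ-next-last)
open import Data.Bool.Base using (Bool)
open import Data.Bool.Properties using (T?)
open import Data.Fin.Base using (Fin; toℕ)
open import Data.Fin.Properties using (toℕ-injective; toℕ-fromℕ<; toℕ<n)
open import Data.Integer.Base as ℤ using (+_; -[1+_])
import Data.Integer.Properties as ℤ
open import Data.List.Base using (List; []; _∷_; map; length; filterᵇ)
open import Data.List.Properties using (length-map)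
open import Data.List.Membership.Propositional using (_∈_)
open import Data.List.Membership.Propositional.Properties using (∈-map⁻; ∈-filter⁺; ∈-filter⁻)
open import Data.List.Relation.Unary.All as All using (All; []; _∷_)
open import Data.List.Relation.Unary.Any using (here; there)
open import Data.List.Relation.Unary.AllPairs using ([]; _∷_)
open import Data.List.Relation.Unary.Unique.Propositional using (Unique)
open import Data.List.Relation.Unary.Unique.Propositional.Properties using () renaming (filter⁺ to unique-filter; map⁺ to unique-map⁺)
open import Data.Nat.Base as ℕ using (ℕ; suc; z≤n; s≤s; _≤_; _<_; _%_)
open import Data.Nat.DivMod using (_mod_; m%n<n; m<n⇒m%n≡m; [m+n]%n≡m%n)
import Data.Nat.Properties as ℕ
open import Data.Product.Base using (_×_; _,_; proj₁; proj₂; ∃-syntax)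
open import Data.Rational.Base using (ℚ; 0ℚ; 1ℚ; ½; _+_; _-_; _*_; _/_; toℚᵘ)
open import Data.Rational.Properties using (toℚᵘ-injective; toℚᵘ-fromℚᵘ; toℚᵘ-homo-+)
open import Data.Rational.Solver using (module +-*-Solver)
open import Data.Rational.Unnormalised.Base as ℚᵘ using (ℚᵘ; mkℚᵘ; *≡*)
import Data.Rational.Unnormalised.Properties as ℚᵘ
open import Data.Sum.Base using (_⊎_; inj₁; inj₂)
open import Data.Vec.Base using (lookup; []; _∷_)
open import Function.Base using (_∘_)
open import Relation.Binary.PropositionalEquality

-- Geometric subgraphs and combinatorial drawings.

module _ {c ℓ₁ ℓ₂ ℓ₃} {K : OrderedField c ℓ₁ ℓ₂ ℓ₃} {n : ℕ} (P : ConvexPolygon K n) where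

  private
    ends′ : Pair n → Edge
    ends′ = ends K P

    ends-injective : ∀ {e f} → ends′ e ≡ ends′ f → e ≡ f
    ends-injective eq = cong₂ _,_ (toℕ-injective (cong proj₁ eq)) (toℕ-injective (cong proj₂ eq))

    diagonal⇒ : ∀ {e} → IsDiagonal e → Diagonal n (ends′ e)
    diagonal⇒ {i , j} (i<j , j≢ , i≢) = gap , toℕ<n j , side
      where
      gap : 2 ℕ.+ toℕ i ≤ toℕ j
      gap = ℕ.≤∧≢⇒< i<j λ eq → j≢ (toℕ-injective (trans (sym eq) (sym (toℕ-next K i (subst (_< n) (sym eq) (toℕ<n j))))))
      side : 0 < toℕ i ⊎ suc (toℕ j) < n
      side with ℕ.m≤n⇒m<n∨m≡n (toℕ<n j)
      ... | inj₁ h = inj₂ h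
      ... | inj₂ h = inj₁ (ℕ.n≢0⇒n>0 λ eq → i≢ (toℕ-injective (trans eq (sym (toℕ-next-last K j h)))))

    ⇒diagonal : ∀ {e} → Diagonal n (ends′ e) → IsDiagonal e
    ⇒diagonal {i , j} (gap , _ , side) = ℕ.<⇒≤ gap
      , (λ eq → ℕ.<-irrefl (sym (trans (cong toℕ eq) (toℕ-next K i (ℕ.≤-<-trans (ℕ.<⇒≤ gap) (toℕ<n j))))) gap)
      , not-next side
      where
      not-next : 0 < toℕ i ⊎ suc (toℕ j) < n → i ≢ next j
      not-next (inj₂ h) eq = ℕ.<-asym (ℕ.<⇒≤ gap) (ℕ.≤-reflexive (sym (trans (cong toℕ eq) (toℕ-next K j h))))
      not-next (inj₁ p) eq with ℕ.m≤n⇒m<n∨m≡n (toℕ<n j)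
      ... | inj₁ h = not-next (inj₂ h) eq
      ... | inj₂ h = ℕ.<-irrefl (sym (trans (cong toℕ eq) (toℕ-next-last K j h))) p

  -- Interleaving is decidable and implies crossing, so a filter lists the interleaving edges, and
  -- admissibility is applied to this list.
  drawing-of : ∀ {ℓ} (G : Subgraph n) → Admissible P ℓ G → Drawing n ℓ (map ends′ (edges G))
  drawing-of {ℓ} G adm = record
    { unique    = unique-map⁺ ends-injective (Subgraph.unique G)
    ; diagonals = λ x∈ → let e , e∈ , eq = ∈-map⁻ ends′ x∈ in
        subst (Diagonal n) (sym eq) (diagonal⇒ (All.lookup (Subgraph.diagonals G) e∈))
    ; light     = λ x∈ → let e , e∈ , eq = ∈-map⁻ ends′ x∈ in
        subst (λ x → count (cross x) (map ends′ (edges G)) ≤ ℓ) (sym eq) (lt e∈)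
    }
    where
    lt : ∀ {e} → e ∈ edges G → count (cross (ends′ e)) (map ends′ (edges G)) ≤ ℓ
    lt {e} e∈ = ℕ.≤-trans (ℕ.≤-reflexive (trans (count-map (cross (ends′ e)) ends′ (edges G)) (sym (length-filter p (edges G)))))
      (adm e e∈ (filterᵇ p (edges G)) (unique-filter (T? ∘ p) (Subgraph.unique G))
        (All.tabulate λ {f} f∈ → let f∈G , h = ∈-filter⁻ (T? ∘ p) {xs = edges G} f∈ in
          f∈G , (λ { refl → cross-irrefl (cross⇒ (ends′ e) (ends′ e) h) })
          , interleaved⇒cross K P e f (cross⇒ (ends′ e) (ends′ f) h)))
      where
      p : Pair n → Bool
      p f = cross (ends′ e) (ends′ f)

  module _ {ℓ : ℕ} {G : List Edge} (D : Drawing n ℓ G) (0<n : 0 < n) where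
    private
      instance
        nonZero : ℕ.NonZero n
        nonZero = ℕ.>-nonZero 0<n

      -- Residues make the map total; on the ends of diagonals, which are below n, it inverts `toℕ`.
      vertexAt : ℕ → Fin n
      vertexAt k = k mod n

      toℕ-vertexAt : ∀ {k} → k < n → toℕ (vertexAt k) ≡ k
      toℕ-vertexAt {k} k<n = trans (toℕ-fromℕ< (m%n<n k n)) (m<n⇒m%n≡m k<n)

      toPair : Edge → Pair n
      toPair (u , v) = vertexAt u , vertexAt v

      ends-toPair : ∀ {e} → e ∈ G → ends′ (toPair e) ≡ e
      ends-toPair e∈ with diagonals D e∈
      ... | gap , v<n , _ = cong₂ _,_ (toℕ-vertexAt (ℕ.<-trans (ℕ.<⇒≤ gap) v<n)) (toℕ-vertexAt v<n)

      unique-toPair : ∀ {L} → (∀ {e} → e ∈ L → e ∈ G) → Unique L → Unique (map toPair L)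
      unique-toPair {[]}    sub _        = []
      unique-toPair {e ∷ L} sub (e∉ ∷ u) = All.tabulate (λ x∈ eq → let f , f∈ , x≡ = ∈-map⁻ toPair x∈ in
          All.lookup e∉ f∈ (trans (sym (ends-toPair (sub (here refl))))
            (trans (cong ends′ (trans eq x≡)) (ends-toPair (sub (there f∈))))))
        ∷ unique-toPair (sub ∘ there) u

    subgraph-of : Subgraph n
    subgraph-of = record
      { edges     = map toPair G
      ; unique    = unique-toPair (λ z → z) (unique D)
      ; diagonals = All.tabulate λ x∈ → let e , e∈ , eq = ∈-map⁻ toPair x∈ in
          subst IsDiagonal (sym eq) (⇒diagonal (subst (Diagonal n) (sym (ends-toPair e∈)) (diagonals D e∈)))
      }

    subgraph-size : size subgraph-of ≡ length G
    subgraph-size = length-map toPair G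

    -- Any duplicate-free list of crossing edges maps injectively into the filtered list of
    -- interleaving ones, whose length `light` bounds.
    subgraph-admissible : Admissible P ℓ subgraph-of
    subgraph-admissible x x∈ fs u all with ∈-map⁻ toPair x∈
    ... | e , e∈ , refl = begin
      length fs                          ≡⟨ sym (length-map ends′ fs) ⟩
      length (map ends′ fs)              ≤⟨ unique-⊆-length (unique-map⁺ ends-injective u) sub ⟩
      length (filterᵇ (cross e) G)       ≡⟨ length-filter (cross e) G ⟩
      count (cross e) G                  ≤⟨ light D e∈ ⟩
      ℓ                                  ∎
      where
      open ℕ.≤-Reasoning
      increasing : ∀ {f} → f ∈ map toPair G → toℕ (proj₁ f) < toℕ (proj₂ f)
      increasing f∈ = proj₁ (All.lookup (Subgraph.diagonals subgraph-of) f∈)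
      sub : ∀ {g} → g ∈ map ends′ fs → g ∈ filterᵇ (cross e) G
      sub g∈ with ∈-map⁻ ends′ g∈
      ... | f , f∈ , refl with All.lookup all f∈
      ...   | f∈G , f≢e , cr with ∈-map⁻ toPair f∈G
      ...     | h , h∈ , refl = ∈-filter⁺ (T? ∘ cross e) (subst (_∈ G) (sym (ends-toPair h∈)) h∈)
        (⇒cross (subst (λ z → Interleaved z _) (ends-toPair e∈)
          (cross⇒interleaved K P (increasing x∈) (increasing f∈G) (f≢e ∘ sym) cr)))

  is-max : ∀ {ℓ m} → (∀ {G} → Drawing n ℓ G → length G ≤ m) → (∃[ G ] Drawing n ℓ G × length G ≡ m) → 0 < n →
           IsMaxSize P ℓ m
  is-max upper (G , D , size-≡) 0<n =
    (subgraph-of D 0<n , subgraph-admissible D 0<n , trans (subgraph-size D 0<n) size-≡)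
    , λ H adm → ℕ.≤-trans (ℕ.≤-reflexive (sym (length-map ends′ (edges H)))) (upper (drawing-of H adm))

-- The closed formulas over the rational numbers.

private
  infix 8 _/1
  _/1 : ℕ → ℚ
  n /1 = + n / 1

  /1-homo : ∀ a b → (a ℕ.+ b) /1 ≡ a /1 + b /1
  /1-homo a b = toℚᵘ-injective (begin
    toℚᵘ ((a ℕ.+ b) /1)                   ≈⟨ toℚᵘ-fromℚᵘ (mkℚᵘ (+ (a ℕ.+ b)) 0) ⟩
    mkℚᵘ (+ (a ℕ.+ b)) 0                  ≈⟨ *≡* (cong (ℤ._* + 1) (sym (cong₂ ℤ._+_ (ℤ.*-identityʳ (+ a)) (ℤ.*-identityʳ (+ b))))) ⟩
    mkℚᵘ (+ a) 0 ℚᵘ.+ mkℚᵘ (+ b) 0        ≈⟨ ℚᵘ.+-cong (toℚᵘ-fromℚᵘ (mkℚᵘ (+ a) 0)) (toℚᵘ-fromℚᵘ (mkℚᵘ (+ b) 0)) ⟨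
    toℚᵘ (a /1) ℚᵘ.+ toℚᵘ (b /1)          ≈⟨ toℚᵘ-homo-+ (a /1) (b /1) ⟨
    toℚᵘ (a /1 + b /1)                    ∎)
    where open ℚᵘ.≃-Reasoning

  mod-periodic : ∀ p n .{{_ : ℕ.NonZero p}} → (p ℕ.+ n) mod p ≡ n mod p
  mod-periodic p n = toℕ-injective (trans (toℕ-fromℕ< (m%n<n (p ℕ.+ n) p))
    (trans (cong (_% p) (ℕ.+-comm p n)) (trans ([m+n]%n≡m%n n p) (sym (toℕ-fromℕ< (m%n<n n p))))))

  -- One period p raises the linear part by s p, the whole number c, and leaves δ unchanged.
  period : ∀ (s : ℚ) (δ : ℕ → ℚ) p c n → δ (p ℕ.+ n) ≡ δ n → s * p /1 ≡ c /1 → ∀ {m} →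
           m /1 ≡ s * (n /1 - 3 /1) + δ n → (c ℕ.+ m) /1 ≡ s * ((p ℕ.+ n) /1 - 3 /1) + δ (p ℕ.+ n)
  period s δ p c n δ≡ sp {m} ih = begin
    (c ℕ.+ m) /1                                ≡⟨ /1-homo c m ⟩
    c /1 + m /1                                 ≡⟨ cong₂ _+_ (sym sp) ih ⟩
    s * p /1 + (s * (n /1 - 3 /1) + δ n)        ≡⟨ rearrange s (p /1) (n /1) (3 /1) (δ n) ⟩
    s * ((p /1 + n /1) - 3 /1) + δ n            ≡⟨ cong₂ (λ x y → s * (x - 3 /1) + y) (sym (/1-homo p n)) (sym δ≡) ⟩
    s * ((p ℕ.+ n) /1 - 3 /1) + δ (p ℕ.+ n)     ∎
    where
    open ≡-Reasoning
    open +-*-Solver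
    rearrange : ∀ s p n t d → s * p + (s * (n - t) + d) ≡ s * ((p + n) - t) + d
    rearrange = solve 5 (λ s p n t d → s :* p :+ (s :* (n :- t) :+ d) := s :* ((p :+ n) :- t) :+ d) refl

formula₀ : ∀ k → (e₀ k) /1 ≡ (3 ℕ.+ k) /1 - 3 /1
formula₀ k = sym (trans (cong (_- 3 /1) (/1-homo 3 k)) (cancel (3 /1) (k /1)))
  where
  open +-*-Solver
  cancel : ∀ a b → (a + b) - a ≡ b
  cancel = solve 2 (λ a b → (a :+ b) :- a := b) refl

formula₁ : ∀ k → (e₁ k) /1 ≡ (+ 3 / 2) * ((3 ℕ.+ k) /1 - 3 /1) + δ₁ (3 ℕ.+ k)
formula₁ 0 = refl
formula₁ 1 = refl
formula₁ (suc (suc k)) = period (+ 3 / 2) δ₁ 2 3 (3 ℕ.+ k) (cong (lookup (½ ∷ 0ℚ ∷ [])) (mod-periodic 2 (3 ℕ.+ k))) refl {e₁ k} (formula₁ k)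

formula₂ : ∀ k → (e₂ k) /1 ≡ (+ 2 / 1) * ((3 ℕ.+ k) /1 - 3 /1) + δ₂ (3 ℕ.+ k)
formula₂ 0 = refl
formula₂ 1 = refl
formula₂ 2 = refl
formula₂ (suc (suc (suc k))) = period (+ 2 / 1) δ₂ 3 6 (3 ℕ.+ k) (cong (lookup (0ℚ ∷ 0ℚ ∷ 1ℚ ∷ [])) (mod-periodic 3 (3 ℕ.+ k))) refl {e₂ k} (formula₂ k)

formula₃ : ∀ k → (e₃ k) /1 ≡ (+ 9 / 4) * ((3 ℕ.+ k) /1 - 3 /1) + δ₃ (3 ℕ.+ k)
formula₃ 0 = refl
formula₃ 1 = refl
formula₃ 2 = refl
formula₃ 3 = refl
formula₃ (suc (suc (suc (suc k)))) = period (+ 9 / 4) δ₃ 4 9 (3 ℕ.+ k) (cong (lookup (-[1+ 0 ] / 4 ∷ ½ ∷ + 5 / 4 ∷ 0ℚ ∷ [])) (mod-periodic 4 (3 ℕ.+ k))) refl {e₃ k} (formula₃ k)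

-- The formula starts at n = 5: for n = 3 and n = 4 it would give 1 and 3 instead of 0 and 2.
formula₄ : ∀ k → (e₄ (2 ℕ.+ k)) /1 ≡ (+ 5 / 2) * ((5 ℕ.+ k) /1 - 3 /1) + δ₄ (5 ℕ.+ k)
formula₄ 0 = refl
formula₄ 1 = refl
formula₄ 2 = refl
formula₄ 3 = refl
formula₄ (suc (suc (suc (suc k)))) = period (+ 5 / 2) δ₄ 4 10 (5 ℕ.+ k) (cong (lookup (½ ∷ 0ℚ ∷ + 3 / 2 ∷ 1ℚ ∷ [])) (mod-periodic 4 (5 ℕ.+ k))) refl {e₄ (2 ℕ.+ k)} (formula₄ k)

theorem4 : ∀ {c ℓ₁ ℓ₂ ℓ₃} (K : OrderedField c ℓ₁ ℓ₂ ℓ₃) →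
    ∀ n → 3 ≤ n → (P : ConvexPolygon K n) →
    let n-3 = (+ n / 1) - (+ 3 / 1) in
    (e[ 0 ] P ≐ n-3)
    × (e[ 1 ] P ≐ (+ 3 / 2) * n-3 + δ₁ n)
    × (e[ 2 ] P ≐ (+ 2 / 1) * n-3 + δ₂ n)
    × (e[ 3 ] P ≐ (+ 9 / 4) * n-3 + δ₃ n)
    × (n ≡ 3 → e[ 4 ] P ≐ 0ℚ)
    × (n ≡ 4 → e[ 4 ] P ≐ + 2 / 1)
    × (5 ≤ n → e[ 4 ] P ≐ (+ 5 / 2) * n-3 + δ₄ n)
theorem4 K (suc (suc (suc k))) (s≤s (s≤s (s≤s _))) P =
    (e₀ k , is-max P (at-most₀ _) (attains₀ k) (s≤s z≤n) , formula₀ k)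
  , (e₁ k , is-max P (at-most₁ _) (attains₁ k) (s≤s z≤n) , formula₁ k)
  , (e₂ k , is-max P (at-most₂ _) (attains₂ k) (s≤s z≤n) , formula₂ k)
  , (e₃ k , is-max P (at-most₃ _) (attains₃ k) (s≤s z≤n) , formula₃ k)
  , (λ { refl → e₄ 0 , max₄ , refl })
  , (λ { refl → e₄ 1 , max₄ , refl })
  , λ { (s≤s (s≤s (s≤s (s≤s (s≤s (z≤n {k′})))))) → e₄ (2 ℕ.+ k′) , max₄ , formula₄ k′ }
  where
  max₄ : IsMaxSize P 4 (e₄ k)
  max₄ = is-max P (at-most₄ _) (attains₄ k) (s≤s z≤n)
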